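{- Let $4.2$ denote the $3$-graph on $4$ vertices with exactly $2$ edges, $K_4^-$ the $3$-graph on $4$ vertices with exactly $3$ edges, and $F_{3,2}$ the $3$-graph on $\{1,\dots,5\}$ with edges $123,124,125,345$. Then \[\pi_{4.2}(\{K_4^-,F_{3,2}\})=\frac{5}{9}.\]
   Context: A $3$-graph is a pair $G=(V,E)$ with $E$ a set of $3$-element subsets of $V$. For a $3$-graph $H$ on $h$ vertices and a $3$-graph $G$ on $n\ge h$ vertices, $e_H(G)$ is the number of $h$-subsets of $V(G)$ inducing a subgraph isomorphic to $H$. For a family $\mathcal{F}$ of $3$-graphs, $G$ is $\mathcal{F}$-free if it contains no member of $\mathcal{F}$ as a (not necessarily induced) subgraph. $\mathrm{ex}_H(n,\mathcal{F})$ is the maximum of $e_H(G)$ over $\mathcal{F}$-free $G$ on $n$ vertices, and $\pi_H(\mathcal{F})=\lim_{n\to\infty}\mathrm{ex}_H(n,\mathcal{F})/\binom{n}{h}$ (the limit exists). -}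

module Defs where

open import Data.Nat using (ℕ; zero; suc; _+_; _*_; _≤_; _<ᵇ_; _≡ᵇ_)
open import Data.Nat.Combinatorics using (_C_)
open import Data.Bool using (Bool; true; false; _∧_; _∨_; not; if_then_else_; _xor_)
open import Data.Fin using (Fin; toℕ; _≟_)
open import Data.List using (List; []; _∷_; [_]; map; concatMap; allFin; filterᵇ; length)
open import Data.Bool.ListAction using (all; any)
open import Data.Vec using (Vec; lookup) renaming ([] to []ᵥ; _∷_ to _∷ᵥ_)
open import Data.Product using (Σ; _×_; ∃-syntax)
open import Relation.Binary.PropositionalEquality using (_≡_)
open import Relation.Nullary using (¬_)
open import Relation.Nullary.Decidable using (⌊_⌋)
open import Function.Definitions using (Injective)

-- A 3-graph on the vertex set Fin n.  The edge set is
--   { {a,b,c} : a < b < c and edge a b c ≡ true };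
-- the values of the function on non-increasing triples are never consulted.
ThreeGraph : ℕ → Set
ThreeGraph n = Fin n → Fin n → Fin n → Bool

ltF : ∀ {n} → Fin n → Fin n → Bool
ltF a b = toℕ a <ᵇ toℕ b

eqF : ∀ {n} → Fin n → Fin n → Bool
eqF a b = ⌊ a ≟ b ⌋

hasEdge : ∀ {n} → ThreeGraph n → Fin n → Fin n → Fin n → Bool
hasEdge G x y z =
  if not (eqF x y) ∧ not (eqF y z) ∧ not (eqF x z)
  then (if ltF x y
        then (if ltF y z then G x y z else if ltF x z then G x z y else G z x y)
        else (if ltF x z then G y x z else if ltF y z then G y z x else G z y x))
  else false

Contains : ∀ {k n} → ThreeGraph k → ThreeGraph n → Set
Contains {k} {n} F G =
  Σ (Fin k → Fin n) λ φ → Injective _≡_ _≡_ φ ×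
    (∀ a b c → hasEdge F a b c ≡ true → hasEdge G (φ a) (φ b) (φ c) ≡ true)

allVecs : ∀ h n → List (Vec (Fin n) h)
allVecs zero n = [ []ᵥ ]
allVecs (suc h) n = concatMap (λ i → map (i ∷ᵥ_) (allVecs h n)) (allFin n)

allFinB : ∀ {h} → (Fin h → Bool) → Bool
allFinB {h} P = all P (allFin h)

-- strictly increasing vectors encode the h-subsets of Fin n
increasing : ∀ {h n} → Vec (Fin n) h → Bool
increasing S = allFinB λ i → allFinB λ j → not (ltF i j) ∨ ltF (lookup S i) (lookup S j)

injectiveB : ∀ {h n} → Vec (Fin n) h → Bool
injectiveB S = allFinB λ i → allFinB λ j → eqF i j ∨ not (eqF (lookup S i) (lookup S j))

inducesCopyOf : ∀ {h n} → ThreeGraph h → ThreeGraph n → Vec (Fin n) h → Bool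
inducesCopyOf {h} {n} H G S =
  any (λ p → injectiveB p ∧
         (allFinB λ a → allFinB λ b → allFinB λ c →
            not (hasEdge H a b c xor
                 hasEdge G (lookup S (lookup p a)) (lookup S (lookup p b)) (lookup S (lookup p c)))))
      (allVecs h h)

eH : ∀ {h n} → ThreeGraph h → ThreeGraph n → ℕ
eH {h} {n} H G =
  length (filterᵇ (λ S → increasing S ∧ inducesCopyOf H G S) (allVecs h n))


-- π_H(F) = p / q, where Free n G says that G (on n vertices) is F-free.
-- Written out: for every ε = 1/(k+1) there is N such that for all n ≥ N,
--   every F-free G on n vertices has e_H(G)/C(n,h) ≤ p/q + ε, and
--   some F-free G on n vertices has e_H(G)/C(n,h) ≥ p/q - ε
-- (i.e. ex_H(n,F)/C(n,h) → p/q), with inequalities cross-multiplied in ℕ.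
DensityIs : ∀ {h} → ThreeGraph h → (∀ n → ThreeGraph n → Set) → ℕ → ℕ → Set
DensityIs {h} H Free p q =
  ∀ (k : ℕ) → ∃[ N ] ∀ n → N ≤ n →
    ((∀ (G : ThreeGraph n) → Free n G →
        q * suc k * eH H G ≤ p * suc k * (n C h) + q * (n C h))
     × (∃[ G ] (Free n G × p * suc k * (n C h) ≤ q * suc k * eH H G + q * (n C h))))

-- The 3-graph "4.2": 4 vertices, exactly 2 edges {0,1,2},{0,1,3}.
G4-2 : ThreeGraph 4
G4-2 a b c = (toℕ a ≡ᵇ 0) ∧ (toℕ b ≡ᵇ 1)

-- K4⁻: 4 vertices, exactly 3 edges {0,1,2},{0,1,3},{0,2,3}.
K4⁻ : ThreeGraph 4
K4⁻ a b c = toℕ a ≡ᵇ 0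

-- F_{3,2} on {0,…,4} (0-indexed): edges 012, 013, 014, 234.
F32 : ThreeGraph 5
F32 a b c = ((toℕ a ≡ᵇ 0) ∧ (toℕ b ≡ᵇ 1))
          ∨ ((toℕ a ≡ᵇ 2) ∧ (toℕ b ≡ᵇ 3) ∧ (toℕ c ≡ᵇ 4))

K4⁻F32-free : ∀ n → ThreeGraph n → Set
K4⁻F32-free n G = ¬ Contains K4⁻ G × ¬ Contains F32 G

-- Upper bound.  Fix a vertex x of G and let L be its link graph; mark a triple when it is an edge of G containing
-- exactly one edge of L.  Every copy of 4.2 is seen as a marked triple from two of its vertices, so it suffices that at
-- most 5/18 of all (ordered) triples are marked.  L is triangle-free, and the two forbidden 3-graphs restrict how marked
-- triples sit on L.  Under these restrictions a sum of weighted squares of flag counts, evaluated on six vertices and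
-- averaged over their orderings, plus the density of marked triples, never exceeds 5/18 (up to the common factor scale).
-- For each L on six vertices this is verified along decision trees over the marked triples; graphs whose code decreases
-- under an adjacent transposition are reduced to smaller ones by well-founded induction.
-- Lower bound.  In the balanced blow-up of the 2-(6,3,2) design every four points in distinct parts, and every
-- quadruple with two points in one part and the others in two further parts forming an edge with it, span a 4.2.
{-# OPTIONS --safe #-}
module Submission where

open import Defs
open import Data.Bool using (Bool; true; false; _∧_; _∨_; not; if_then_else_; _xor_; T)
open import Data.Bool.ListAction using (all; any)
open import Data.Bool.Properties using (∨-comm)
open import Data.Empty using (⊥; ⊥-elim)
open import Data.Fin using (Fin; zero; suc; toℕ; _≟_; #_; combine; _↑ˡ_; _↑ʳ_)
open import Data.Fin.Properties using (toℕ-injective; toℕ<n; toℕ-↑ˡ; toℕ-combine)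
open import Data.Integer as ℤ using (ℤ; +_; -[1+_]; 0ℤ)
import Data.Integer.Properties as ℤₚ
open import Data.Integer.Solver using (module +-*-Solver)
open import Data.List using (List; []; _∷_; map; _++_; concatMap; filterᵇ; foldr; allFin; length; tabulate)
import Data.List.Properties as Listₚ
open import Data.List.Relation.Unary.All using (All; []; _∷_)
open import Data.Maybe using (Maybe; just; nothing)
open import Data.Nat as ℕ using (ℕ; zero; suc; _<ᵇ_; _≡ᵇ_)
open import Data.Nat using (_+_; _*_; _^_; _≤_)
open import Data.Nat.DivMod using (_/_; _%_; +-distrib-/-∣ˡ; m*n/n≡m; m<n⇒m/n≡0; m≡m%n+[m/n]*n; m%n<n)
open import Data.Nat.Divisibility using (divides-refl)
open import Data.Nat.Induction using (<-wellFounded)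
import Data.Nat.Properties as ℕₚ
open import Data.Nat.Solver using () renaming (module +-*-Solver to ℕ-Solver)
open import Data.Product using (_×_; _,_; proj₁; proj₂; ∃)
open import Data.Sum using (_⊎_; inj₁; inj₂; [_,_]′; map₂)
open import Data.Unit using (⊤; tt)
open import Data.Vec as Vec using (Vec; []; _∷_; insertAt)
open import Data.Vec.Properties using (lookup∘tabulate; map-lookup-allFin; insertAt-lookup; lookup-map)
open import Function using (_∘_; case_of_)
open import Induction.WellFounded using (Acc; acc)
open import Relation.Binary.PropositionalEquality
open import Relation.Nullary using (yes; no; ¬_)

open +-*-Solver using (solve; con; _:*_; _:+_; _:=_)
open ℕ-Solver using () renaming (solve to solveℕ; con to conℕ; _:*_ to _⊗_; _:+_ to _⊕_; _:=_ to _≜_)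

-- The clauses of `Valid` quantify over all points, equal or not, so they are inherited along every
-- map into the vertex set. Averages are therefore taken over all maps from six points, repetitions
-- included, and the bound `5 n^3 / 18` on ordered marked triples holds exactly for every `n`; error
-- terms enter only when powers of `n` are compared with binomial coefficients. The bound is
-- attained: in the balanced blow-up of the design the link of a vertex is a blown-up pentagon
-- together with an isolated part, and exactly 60 of the 216 ordered triples of parts are marked.
-- Hence each weighted square has to vanish on the flag counts of this configuration, which accounts
-- for the linear relations among the entries of the certificate. The obstacle is the size of the
-- finite check: there are 2^15 graphs `L` on six labelled vertices, each with up to twenty triples
-- that may be marked. Only triples with exactly one edge of `L` become variables, and forbidden
-- configurations cut branches off.

-- Integer sum-of-squares certificate.

Square : Set
Square = ℕ × List ℤ

-- A flag on the roots p, q is coded in binary by the bits pa pb qa qb ab (edges of L) and pqa pqb pab qab (marked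
-- triples), up to exchanging a and b; the argument tells whether pq is an edge of L.
pairFlags : Bool → List ℕ
pairFlags false =
    0 ∷ 4 ∷ 16 ∷ 1 ∷ 36 ∷ 144 ∷ 33 ∷ 129 ∷ 272 ∷ 260 ∷ 292 ∷ 400 ∷ 161 ∷ 12 ∷ 20 ∷ 3 ∷ 17 ∷ 5 ∷ 44 ∷ 148 ∷ 52 ∷ 35
    ∷ 273 ∷ 261 ∷ 49 ∷ 133 ∷ 108 ∷ 180 ∷ 99 ∷ 305 ∷ 389 ∷ 6 ∷ 38 ∷ 262 ∷ 41 ∷ 134 ∷ 102 ∷ 166 ∷ 297 ∷ 390 ∷ 7 ∷ 22
    ∷ 13 ∷ 263 ∷ 54 ∷ 46 ∷ 141 ∷ 57 ∷ 43 ∷ 299 ∷ 118 ∷ 174 ∷ 21 ∷ 15 ∷ []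
pairFlags true =
    0 ∷ 32 ∷ 96 ∷ 1 ∷ 4 ∷ 129 ∷ 34 ∷ 260 ∷ 40 ∷ 162 ∷ 296 ∷ 16 ∷ 144 ∷ 272 ∷ 48 ∷ 176 ∷ 304 ∷ 17 ∷ 6 ∷ 20 ∷ 273 ∷
    262 ∷ 148 ∷ 56 ∷ 134 ∷ 50 ∷ 306 ∷ 390 ∷ 184 ∷ 3 ∷ 12 ∷ 22 ∷ []

-- A pair `(c , v)` stands for `c` times the square of the linear form `v` in the flag counts, so it
-- is nonnegative whatever the entries are. The linear forms have to vanish on the extremal
-- configuration. For example, if both roots lie in the isolated part beside the blown-up pentagon,
-- then 26 of the 36 choices of parts for `a` and `b` give the code 0, and 10 give the code 400,
-- which is at position 11; accordingly entry 11 is -13/5 times entry 0 in every vector.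
nonedgeSquares : List Square
nonedgeSquares =
  (396 , (-[1+ 5394149 ] ∷ + 1006113152 ∷ -[1+ 221001119 ] ∷ -[1+ 373946259 ] ∷ + 620418276 ∷ -[1+ 1016972367 ]
    ∷ -[1+ 168030528 ] ∷ -[1+ 380456922 ] ∷ + 220856589 ∷ + 567928822 ∷ + 343084666 ∷ + 14024790 ∷ -[1+ 310447141
    ] ∷ -[1+ 83726410 ] ∷ + 44524836 ∷ + 691990327 ∷ -[1+ 58852840 ] ∷ + 317623264 ∷ + 121076524 ∷ -[1+ 542329383
    ] ∷ -[1+ 112332680 ] ∷ + 372565824 ∷ + 614873307 ∷ -[1+ 76064674 ] ∷ -[1+ 327548890 ] ∷ + 277666449 ∷ +
    474116370 ∷ -[1+ 574209285 ] ∷ -[1+ 167326019 ] ∷ + 400043717 ∷ + 18699813 ∷ -[1+ 501256771 ] ∷ -[1+ 194735286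
    ] ∷ -[1+ 491266257 ] ∷ -[1+ 208184011 ] ∷ -[1+ 902535086 ] ∷ -[1+ 367184952 ] ∷ -[1+ 531614659 ] ∷ -[1+
    39809165 ] ∷ -[1+ 664290070 ] ∷ -[1+ 78443130 ] ∷ -[1+ 327409345 ] ∷ -[1+ 525838049 ] ∷ + 582020174 ∷ -[1+
    304867063 ] ∷ -[1+ 347683318 ] ∷ -[1+ 786543161 ] ∷ -[1+ 321677590 ] ∷ + 302615301 ∷ + 200343748 ∷ -[1+
    223697113 ] ∷ -[1+ 23318048 ] ∷ + 20506871 ∷ -[1+ 66546237 ] ∷ [])) ∷
  (396 , (-[1+ 158429369 ] ∷ + 0 ∷ + 1460292047 ∷ -[1+ 207885859 ] ∷ + 49318244 ∷ + 408451457 ∷ -[1+ 70320256 ]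
    ∷ -[1+ 54245088 ] ∷ + 595570170 ∷ + 87498830 ∷ + 235660374 ∷ + 411916362 ∷ + 137128487 ∷ + 526338292 ∷ +
    229807280 ∷ + 644388059 ∷ + 214541225 ∷ -[1+ 489624698 ] ∷ + 183062259 ∷ -[1+ 258205533 ] ∷ + 723732987 ∷ +
    222838501 ∷ -[1+ 82468255 ] ∷ -[1+ 287111468 ] ∷ + 690573542 ∷ -[1+ 233508735 ] ∷ -[1+ 23990337 ] ∷ -[1+
    49392897 ] ∷ -[1+ 118235609 ] ∷ + 96261625 ∷ + 158837987 ∷ -[1+ 789400539 ] ∷ -[1+ 848347099 ] ∷ -[1+
    353150929 ] ∷ -[1+ 850276426 ] ∷ -[1+ 416252873 ] ∷ + 88713944 ∷ -[1+ 334214684 ] ∷ -[1+ 260333327 ] ∷ -[1+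
    385759051 ] ∷ -[1+ 973477031 ] ∷ -[1+ 393171106 ] ∷ -[1+ 1042816153 ] ∷ -[1+ 431610667 ] ∷ -[1+ 261971857 ] ∷
    -[1+ 1232061481 ] ∷ -[1+ 639258251 ] ∷ -[1+ 264388387 ] ∷ -[1+ 1133929367 ] ∷ -[1+ 360280729 ] ∷ + 16874432 ∷
    -[1+ 394164628 ] ∷ + 554897310 ∷ -[1+ 1078925979 ] ∷ [])) ∷
  (396 , (-[1+ 48529649 ] ∷ + 0 ∷ + 0 ∷ + 908927721 ∷ + 74444633 ∷ -[1+ 69234952 ] ∷ + 596717877 ∷ + 464413804 ∷
    -[1+ 887058478 ] ∷ -[1+ 156318064 ] ∷ -[1+ 139679490 ] ∷ + 126177090 ∷ + 291207868 ∷ + 845153137 ∷ + 14222100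
    ∷ + 330347409 ∷ + 81240164 ∷ + 364288816 ∷ + 494311173 ∷ + 409938155 ∷ -[1+ 244439841 ] ∷ + 322064795 ∷ -[1+
    357345207 ] ∷ + 207213045 ∷ -[1+ 99860013 ] ∷ -[1+ 26334917 ] ∷ -[1+ 9250825 ] ∷ + 197687519 ∷ + 404590270 ∷
    -[1+ 440120387 ] ∷ + 64909603 ∷ -[1+ 945275193 ] ∷ -[1+ 515957107 ] ∷ -[1+ 1287710893 ] ∷ -[1+ 507108460 ] ∷
    -[1+ 1012732444 ] ∷ -[1+ 549680993 ] ∷ -[1+ 341815913 ] ∷ -[1+ 664787785 ] ∷ -[1+ 1101800652 ] ∷ -[1+
    846769639 ] ∷ -[1+ 586143855 ] ∷ -[1+ 545594583 ] ∷ -[1+ 730187878 ] ∷ -[1+ 545180756 ] ∷ -[1+ 106112662 ] ∷ +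
    176493703 ∷ -[1+ 534153016 ] ∷ -[1+ 534421203 ] ∷ -[1+ 25474561 ] ∷ -[1+ 355755003 ] ∷ + 122638075 ∷ +
    165298694 ∷ -[1+ 353651363 ] ∷ [])) ∷
  (396 , (+ 86533070 ∷ + 0 ∷ + 0 ∷ + 0 ∷ + 946609138 ∷ -[1+ 751651441 ] ∷ -[1+ 527178276 ] ∷ -[1+ 68641168 ] ∷ +
    376013729 ∷ -[1+ 541071278 ] ∷ + 166839269 ∷ -[1+ 224985981 ] ∷ -[1+ 493757447 ] ∷ -[1+ 326692901 ] ∷ +
    214475300 ∷ + 230670639 ∷ -[1+ 119198332 ] ∷ + 93379938 ∷ -[1+ 205706752 ] ∷ -[1+ 497896226 ] ∷ + 418165844 ∷
    + 454368766 ∷ + 519349743 ∷ -[1+ 306589268 ] ∷ -[1+ 309540127 ] ∷ + 386734345 ∷ + 53623428 ∷ -[1+ 288837359 ]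
    ∷ + 702893952 ∷ + 47124095 ∷ -[1+ 64149436 ] ∷ + 196514068 ∷ -[1+ 132780235 ] ∷ + 92188228 ∷ + 278695217 ∷ +
    351333851 ∷ + 180377869 ∷ -[1+ 374642909 ] ∷ + 161300697 ∷ + 162888907 ∷ + 597989215 ∷ + 162961038 ∷ -[1+
    522782019 ] ∷ + 358160623 ∷ -[1+ 634810324 ] ∷ -[1+ 220797097 ] ∷ -[1+ 297862238 ] ∷ + 889957963 ∷ + 289475135
    ∷ -[1+ 172660271 ] ∷ + 532199621 ∷ -[1+ 51931606 ] ∷ -[1+ 84529246 ] ∷ + 106984614 ∷ [])) ∷
  (396 , (-[1+ 129354079 ] ∷ + 0 ∷ + 0 ∷ + 0 ∷ + 0 ∷ + 915585835 ∷ -[1+ 49205832 ] ∷ + 452540528 ∷ -[1+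
    303382278 ] ∷ -[1+ 182197565 ] ∷ + 1295288 ∷ + 336320608 ∷ + 540128358 ∷ -[1+ 917105182 ] ∷ + 447076027 ∷ +
    399164368 ∷ + 340704393 ∷ -[1+ 122181927 ] ∷ -[1+ 681448213 ] ∷ + 1058894360 ∷ -[1+ 249246434 ] ∷ -[1+
    106152606 ] ∷ -[1+ 187596573 ] ∷ -[1+ 419219204 ] ∷ + 259605557 ∷ + 207348192 ∷ -[1+ 514094247 ] ∷ + 398041324
    ∷ -[1+ 575055267 ] ∷ -[1+ 110311235 ] ∷ -[1+ 49745651 ] ∷ -[1+ 220056282 ] ∷ -[1+ 1503032190 ] ∷ -[1+
    506652304 ] ∷ + 379363072 ∷ + 62746668 ∷ -[1+ 357374201 ] ∷ -[1+ 609175879 ] ∷ + 9914452 ∷ -[1+ 302547753 ] ∷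
    + 467275143 ∷ + 35157355 ∷ -[1+ 978048849 ] ∷ + 121335974 ∷ -[1+ 531553900 ] ∷ -[1+ 1206623136 ] ∷ -[1+
    6735193 ] ∷ + 242260526 ∷ -[1+ 360271095 ] ∷ -[1+ 204505737 ] ∷ -[1+ 495419275 ] ∷ + 52130446 ∷ + 261595818 ∷
    -[1+ 139121355 ] ∷ [])) ∷
  (396 , (+ 158053100 ∷ + 0 ∷ + 0 ∷ + 0 ∷ + 0 ∷ + 0 ∷ + 789488807 ∷ -[1+ 682078297 ] ∷ -[1+ 683664095 ] ∷ -[1+
    458139063 ] ∷ -[1+ 490773335 ] ∷ -[1+ 410938059 ] ∷ -[1+ 104548832 ] ∷ + 14536782 ∷ + 21242716 ∷ -[1+
    211819214 ] ∷ + 188463359 ∷ + 171359224 ∷ + 388689923 ∷ + 352955098 ∷ -[1+ 110718696 ] ∷ + 52571953 ∷ -[1+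
    281892187 ] ∷ + 236264809 ∷ + 317048806 ∷ -[1+ 94272500 ] ∷ + 880903444 ∷ -[1+ 123536795 ] ∷ + 504029032 ∷
    -[1+ 321324092 ] ∷ -[1+ 123154195 ] ∷ + 360136146 ∷ + 165458850 ∷ + 453391287 ∷ + 64461660 ∷ + 364526099 ∷ +
    330405225 ∷ -[1+ 92995164 ] ∷ -[1+ 335866807 ] ∷ + 294715235 ∷ -[1+ 199683614 ] ∷ + 307200098 ∷ + 326353614 ∷
    -[1+ 119594181 ] ∷ + 616027181 ∷ + 141185124 ∷ + 238240700 ∷ -[1+ 145574064 ] ∷ -[1+ 76473113 ] ∷ -[1+
    192849917 ] ∷ + 986263532 ∷ -[1+ 238250996 ] ∷ -[1+ 149504167 ] ∷ + 197599908 ∷ [])) ∷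
  (396 , (+ 731200 ∷ + 0 ∷ + 0 ∷ + 0 ∷ + 0 ∷ + 0 ∷ + 0 ∷ + 796336857 ∷ -[1+ 57795819 ] ∷ -[1+ 727425025 ] ∷ -[1+
    446753850 ] ∷ -[1+ 1901119 ] ∷ + 469465677 ∷ -[1+ 526501812 ] ∷ + 368171514 ∷ + 700508149 ∷ -[1+ 352685476 ] ∷
    + 25549498 ∷ -[1+ 448963665 ] ∷ -[1+ 61378840 ] ∷ + 738249836 ∷ + 523502818 ∷ + 140629451 ∷ -[1+ 346563767 ] ∷
    -[1+ 813424154 ] ∷ + 382969675 ∷ -[1+ 394636735 ] ∷ + 643267899 ∷ + 427671974 ∷ -[1+ 684105983 ] ∷ + 50551303
    ∷ -[1+ 126659311 ] ∷ + 716387906 ∷ -[1+ 243210426 ] ∷ -[1+ 643079205 ] ∷ + 27734850 ∷ -[1+ 86187293 ] ∷ +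
    715588021 ∷ -[1+ 793198639 ] ∷ -[1+ 165941875 ] ∷ + 525039776 ∷ + 25143628 ∷ -[1+ 581312719 ] ∷ + 649038303 ∷
    + 440917513 ∷ -[1+ 384322761 ] ∷ -[1+ 713552266 ] ∷ -[1+ 698001921 ] ∷ + 528875205 ∷ + 26468249 ∷ -[1+
    82176887 ] ∷ + 45742246 ∷ -[1+ 13622872 ] ∷ -[1+ 75465499 ] ∷ [])) ∷
  (396 , (-[1+ 178026399 ] ∷ + 0 ∷ + 0 ∷ + 0 ∷ + 0 ∷ + 0 ∷ + 0 ∷ + 0 ∷ + 844766311 ∷ + 301780767 ∷ + 532711817 ∷
    + 462868640 ∷ + 220389823 ∷ + 1108032 ∷ + 586576451 ∷ -[1+ 779460710 ] ∷ + 608173290 ∷ -[1+ 164356781 ] ∷ -[1+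
    420797567 ] ∷ + 210819250 ∷ + 250263073 ∷ -[1+ 706933516 ] ∷ + 1100065338 ∷ + 30332845 ∷ -[1+ 220941278 ] ∷
    -[1+ 330378602 ] ∷ -[1+ 816339679 ] ∷ + 71287063 ∷ -[1+ 675799075 ] ∷ + 313338755 ∷ -[1+ 82050572 ] ∷ -[1+
    303336774 ] ∷ -[1+ 146005381 ] ∷ -[1+ 111756313 ] ∷ -[1+ 1502454332 ] ∷ -[1+ 489279313 ] ∷ -[1+ 507942479 ] ∷
    -[1+ 210853272 ] ∷ -[1+ 727482703 ] ∷ -[1+ 435088430 ] ∷ -[1+ 805519140 ] ∷ + 82842889 ∷ + 51962031 ∷ +
    107239995 ∷ + 86076457 ∷ -[1+ 908758811 ] ∷ + 70032917 ∷ -[1+ 491345967 ] ∷ -[1+ 1410072252 ] ∷ -[1+ 44406393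
    ] ∷ -[1+ 652437920 ] ∷ -[1+ 217602246 ] ∷ + 374976602 ∷ -[1+ 194193977 ] ∷ [])) ∷
  (396 , (-[1+ 46721119 ] ∷ + 0 ∷ + 0 ∷ + 0 ∷ + 0 ∷ + 0 ∷ + 0 ∷ + 0 ∷ + 0 ∷ + 365174411 ∷ + 260263053 ∷ +
    121474912 ∷ + 42344143 ∷ + 395259007 ∷ + 108018114 ∷ + 110477298 ∷ + 284535327 ∷ + 58895619 ∷ + 114169631 ∷ +
    371537916 ∷ -[1+ 341788010 ] ∷ -[1+ 115426698 ] ∷ + 308828761 ∷ + 118313945 ∷ + 44102379 ∷ -[1+ 54300889 ] ∷
    -[1+ 39675399 ] ∷ -[1+ 189032120 ] ∷ -[1+ 238637211 ] ∷ + 128367695 ∷ + 183927832 ∷ -[1+ 606952511 ] ∷ -[1+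
    256803841 ] ∷ -[1+ 494665579 ] ∷ + 97578113 ∷ -[1+ 556914496 ] ∷ -[1+ 485469146 ] ∷ -[1+ 479833416 ] ∷ -[1+
    103956081 ] ∷ -[1+ 801789860 ] ∷ -[1+ 341280575 ] ∷ + 122280035 ∷ -[1+ 88070132 ] ∷ -[1+ 272584602 ] ∷ -[1+
    725313595 ] ∷ + 78335266 ∷ + 58388108 ∷ -[1+ 439274141 ] ∷ -[1+ 136863445 ] ∷ + 111270663 ∷ -[1+ 514437433 ] ∷
    + 108886921 ∷ + 47737998 ∷ -[1+ 360545195 ] ∷ [])) ∷
  (396 , (-[1+ 10123509 ] ∷ + 0 ∷ + 0 ∷ + 0 ∷ + 0 ∷ + 0 ∷ + 0 ∷ + 0 ∷ + 0 ∷ + 0 ∷ -[1+ 64720403 ] ∷ + 26321126 ∷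
    + 72390026 ∷ + 1231802292 ∷ -[1+ 387494070 ] ∷ + 716049490 ∷ -[1+ 290570666 ] ∷ + 47575214 ∷ + 781329196 ∷
    -[1+ 578513823 ] ∷ + 11509 ∷ + 580989406 ∷ -[1+ 771902063 ] ∷ + 69761181 ∷ + 152188950 ∷ -[1+ 124623368 ] ∷ +
    260736376 ∷ -[1+ 54511922 ] ∷ + 145447132 ∷ -[1+ 133977730 ] ∷ + 95071515 ∷ -[1+ 680854771 ] ∷ + 495655748 ∷
    -[1+ 40019985 ] ∷ + 109580365 ∷ -[1+ 162235636 ] ∷ + 927412118 ∷ -[1+ 169049077 ] ∷ -[1+ 433628945 ] ∷ -[1+
    456543469 ] ∷ + 450264956 ∷ -[1+ 573535444 ] ∷ + 952006366 ∷ -[1+ 240506739 ] ∷ -[1+ 76406923 ] ∷ -[1+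
    179453980 ] ∷ + 178518649 ∷ -[1+ 417788327 ] ∷ -[1+ 15455778 ] ∷ -[1+ 107339208 ] ∷ + 347531929 ∷ -[1+
    101409596 ] ∷ -[1+ 134304532 ] ∷ + 100737758 ∷ [])) ∷
  (396 , (+ 7932130 ∷ + 0 ∷ + 0 ∷ + 0 ∷ + 0 ∷ + 0 ∷ + 0 ∷ + 0 ∷ + 0 ∷ + 0 ∷ -[1+ 76823065 ] ∷ -[1+ 20623537 ] ∷
    + 44808072 ∷ + 0 ∷ + 571026876 ∷ -[1+ 136138689 ] ∷ -[1+ 284783731 ] ∷ + 51864341 ∷ + 375075538 ∷ + 480944822
    ∷ + 317869188 ∷ -[1+ 471662250 ] ∷ -[1+ 160672682 ] ∷ -[1+ 259932189 ] ∷ -[1+ 382759026 ] ∷ + 165827427 ∷ +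
    652194620 ∷ -[1+ 257999586 ] ∷ -[1+ 599466351 ] ∷ + 246199761 ∷ -[1+ 1434377 ] ∷ -[1+ 279064960 ] ∷ -[1+
    207439703 ] ∷ -[1+ 1199114399 ] ∷ -[1+ 407372406 ] ∷ + 259951727 ∷ + 185546170 ∷ -[1+ 22370991 ] ∷ -[1+
    312301160 ] ∷ -[1+ 163904997 ] ∷ -[1+ 257883460 ] ∷ + 180092331 ∷ + 269473044 ∷ -[1+ 150307615 ] ∷ -[1+
    84408662 ] ∷ -[1+ 113139514 ] ∷ + 105149002 ∷ + 133258398 ∷ + 152541646 ∷ -[1+ 114741943 ] ∷ + 36581417 ∷ +
    170772593 ∷ -[1+ 70115627 ] ∷ + 125649326 ∷ [])) ∷
  (396 , (-[1+ 4170659 ] ∷ + 0 ∷ + 0 ∷ + 0 ∷ + 0 ∷ + 0 ∷ + 0 ∷ + 0 ∷ + 0 ∷ + 0 ∷ + 125373010 ∷ + 10843716 ∷ -[1+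
    125764791 ] ∷ + 0 ∷ + 0 ∷ + 992455569 ∷ -[1+ 312812638 ] ∷ + 31783322 ∷ + 211237150 ∷ -[1+ 472479812 ] ∷ +
    234081910 ∷ + 482683617 ∷ -[1+ 184675198 ] ∷ -[1+ 242267404 ] ∷ -[1+ 163947142 ] ∷ + 200926867 ∷ + 86230124 ∷
    -[1+ 163900345 ] ∷ + 131799770 ∷ + 64452633 ∷ + 49150475 ∷ -[1+ 391576240 ] ∷ -[1+ 248066111 ] ∷ -[1+
    340798182 ] ∷ + 478209424 ∷ + 107437707 ∷ + 506724534 ∷ -[1+ 418049435 ] ∷ + 59456516 ∷ -[1+ 259398100 ] ∷ +
    818957287 ∷ -[1+ 273081075 ] ∷ -[1+ 89511971 ] ∷ + 373508626 ∷ -[1+ 475257329 ] ∷ + 92777964 ∷ -[1+ 411859997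
    ] ∷ + 225403580 ∷ -[1+ 188573166 ] ∷ -[1+ 64923542 ] ∷ + 185386466 ∷ -[1+ 35776203 ] ∷ -[1+ 79290144 ] ∷ +
    69454792 ∷ [])) ∷
  (396 , (+ 13994460 ∷ + 0 ∷ + 0 ∷ + 0 ∷ + 0 ∷ + 0 ∷ + 0 ∷ + 0 ∷ + 0 ∷ + 0 ∷ -[1+ 7999403 ] ∷ -[1+ 36385595 ] ∷
    -[1+ 52964330 ] ∷ + 0 ∷ + 0 ∷ + 0 ∷ + 462910438 ∷ + 106902812 ∷ -[1+ 209845092 ] ∷ + 63835057 ∷ -[1+ 247050777
    ] ∷ + 207115228 ∷ + 373910613 ∷ + 30532111 ∷ + 142070067 ∷ -[1+ 220296525 ] ∷ -[1+ 242223831 ] ∷ + 113717414 ∷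
    + 399246896 ∷ -[1+ 162053022 ] ∷ + 10074867 ∷ -[1+ 632951087 ] ∷ -[1+ 580273180 ] ∷ -[1+ 531768250 ] ∷ -[1+
    528685791 ] ∷ -[1+ 1314980039 ] ∷ + 484765835 ∷ -[1+ 422873303 ] ∷ -[1+ 307181792 ] ∷ -[1+ 379479143 ] ∷ +
    209766889 ∷ + 271232936 ∷ + 2346938 ∷ -[1+ 9896393 ] ∷ + 94639812 ∷ + 83414795 ∷ -[1+ 86007751 ] ∷ -[1+
    66989606 ] ∷ -[1+ 33614815 ] ∷ + 114703586 ∷ + 117897359 ∷ -[1+ 34483691 ] ∷ -[1+ 153946869 ] ∷ + 256956194 ∷
    [])) ∷
  (396 , (+ 1916480 ∷ + 0 ∷ + 0 ∷ + 0 ∷ + 0 ∷ + 0 ∷ + 0 ∷ + 0 ∷ + 0 ∷ + 0 ∷ -[1+ 15973256 ] ∷ -[1+ 4982847 ] ∷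
    -[1+ 15924734 ] ∷ + 0 ∷ + 0 ∷ + 0 ∷ + 0 ∷ + 43357168 ∷ + 22095068 ∷ + 5877866 ∷ -[1+ 33472025 ] ∷ + 22061283 ∷
    + 5904909 ∷ -[1+ 21590245 ] ∷ -[1+ 33363709 ] ∷ -[1+ 21512527 ] ∷ + 57816120 ∷ -[1+ 15042930 ] ∷ + 57675502 ∷
    -[1+ 15021143 ] ∷ + 14110052 ∷ -[1+ 28029286 ] ∷ -[1+ 234905422 ] ∷ -[1+ 260853377 ] ∷ -[1+ 235190393 ] ∷ -[1+
    260917526 ] ∷ + 288580826 ∷ -[1+ 51992753 ] ∷ -[1+ 51997119 ] ∷ -[1+ 5698976 ] ∷ + 70090596 ∷ + 51210066 ∷ +
    70138974 ∷ -[1+ 4024482 ] ∷ + 38301586 ∷ + 39473445 ∷ -[1+ 4003533 ] ∷ + 38262846 ∷ + 39730041 ∷ + 27003296 ∷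
    + 58085958 ∷ + 26988040 ∷ -[1+ 82479077 ] ∷ + 132521796 ∷ [])) ∷
  (396 , (+ 1497300 ∷ + 0 ∷ + 0 ∷ + 0 ∷ + 0 ∷ + 0 ∷ + 0 ∷ + 0 ∷ + 0 ∷ + 0 ∷ -[1+ 91521809 ] ∷ -[1+ 3892979 ] ∷ +
    87983878 ∷ + 0 ∷ + 0 ∷ + 0 ∷ + 0 ∷ + 0 ∷ + 128796058 ∷ -[1+ 121653316 ] ∷ -[1+ 67896534 ] ∷ -[1+ 108136542 ] ∷
    + 106909727 ∷ -[1+ 321735262 ] ∷ + 64822457 ∷ + 319186366 ∷ + 193215886 ∷ -[1+ 6733162 ] ∷ -[1+ 182174149 ] ∷
    + 1456167 ∷ + 613096 ∷ -[1+ 24003110 ] ∷ + 343959876 ∷ + 58626582 ∷ -[1+ 357611846 ] ∷ -[1+ 83252207 ] ∷ +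
    24892890 ∷ + 5825794 ∷ -[1+ 21257086 ] ∷ + 2932065 ∷ + 42332938 ∷ + 6015862 ∷ -[1+ 21090304 ] ∷ -[1+ 115903405
    ] ∷ -[1+ 49950888 ] ∷ -[1+ 310570543 ] ∷ + 111370835 ∷ + 51390442 ∷ + 309471851 ∷ -[1+ 47561733 ] ∷ + 9535259
    ∷ + 46519414 ∷ -[1+ 6751766 ] ∷ + 8983282 ∷ [])) ∷
  (396 , (-[1+ 643489 ] ∷ + 0 ∷ + 0 ∷ + 0 ∷ + 0 ∷ + 0 ∷ + 0 ∷ + 0 ∷ + 0 ∷ + 0 ∷ + 110477912 ∷ + 1673074 ∷ -[1+
    109265863 ] ∷ + 0 ∷ + 0 ∷ + 0 ∷ + 0 ∷ + 0 ∷ + 0 ∷ + 170014868 ∷ -[1+ 88041047 ] ∷ + 3610822 ∷ -[1+ 146963472 ]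
    ∷ + 353129300 ∷ + 74776531 ∷ -[1+ 347916434 ] ∷ -[1+ 43826805 ] ∷ -[1+ 87856669 ] ∷ + 47002842 ∷ + 86472282 ∷
    + 3693151 ∷ + 11003642 ∷ -[1+ 29790693 ] ∷ -[1+ 125357149 ] ∷ + 35843150 ∷ + 124382488 ∷ -[1+ 13435170 ] ∷
    -[1+ 159098458 ] ∷ + 163172634 ∷ -[1+ 7667033 ] ∷ -[1+ 29180675 ] ∷ + 9934369 ∷ + 17697171 ∷ + 37639000 ∷ -[1+
    20887269 ] ∷ + 222256312 ∷ -[1+ 41579619 ] ∷ -[1+ 6612873 ] ∷ -[1+ 200966285 ] ∷ + 78452484 ∷ -[1+ 11702483 ]
    ∷ -[1+ 68780327 ] ∷ + 1590468 ∷ -[1+ 9151559 ] ∷ [])) ∷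
  (396 , (-[1+ 42729 ] ∷ + 0 ∷ + 0 ∷ + 0 ∷ + 0 ∷ + 0 ∷ + 0 ∷ + 0 ∷ + 0 ∷ + 0 ∷ + 65911951 ∷ + 111098 ∷ -[1+
    67044814 ] ∷ + 0 ∷ + 0 ∷ + 0 ∷ + 0 ∷ + 0 ∷ + 0 ∷ + 0 ∷ + 243246866 ∷ + 5455175 ∷ -[1+ 3532550 ] ∷ -[1+ 5383256
    ] ∷ -[1+ 238238845 ] ∷ + 6047830 ∷ -[1+ 226758687 ] ∷ + 47514396 ∷ + 228465592 ∷ -[1+ 47140977 ] ∷ + 517858 ∷
    -[1+ 13091376 ] ∷ -[1+ 518323638 ] ∷ -[1+ 116999051 ] ∷ + 527184183 ∷ + 126199705 ∷ -[1+ 582222 ] ∷ -[1+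
    15708322 ] ∷ + 14132900 ∷ + 1265289 ∷ + 147833491 ∷ + 771578 ∷ -[1+ 148485777 ] ∷ -[1+ 19154741 ] ∷ -[1+
    141879260 ] ∷ + 463725077 ∷ + 16158939 ∷ + 140746604 ∷ -[1+ 467313462 ] ∷ -[1+ 73369806 ] ∷ + 2963706 ∷ +
    71009793 ∷ + 580448 ∷ -[1+ 2102605 ] ∷ [])) ∷
  (396 , (+ 5129340 ∷ + 0 ∷ + 0 ∷ + 0 ∷ + 0 ∷ + 0 ∷ + 0 ∷ + 0 ∷ + 0 ∷ + 0 ∷ + 9726642 ∷ -[1+ 13336283 ] ∷ -[1+
    21747956 ] ∷ + 0 ∷ + 0 ∷ + 0 ∷ + 0 ∷ + 0 ∷ + 0 ∷ + 0 ∷ + 0 ∷ + 69665136 ∷ -[1+ 51116185 ] ∷ + 72863730 ∷ -[1+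
    10073552 ] ∷ -[1+ 81888830 ] ∷ -[1+ 16871273 ] ∷ -[1+ 6933278 ] ∷ + 54138754 ∷ -[1+ 10963693 ] ∷ + 1851520 ∷
    -[1+ 81086283 ] ∷ -[1+ 85232186 ] ∷ -[1+ 47274327 ] ∷ + 37605989 ∷ -[1+ 37178440 ] ∷ + 85413557 ∷ -[1+
    20782977 ] ∷ -[1+ 31751480 ] ∷ + 10288066 ∷ + 16617286 ∷ + 19850231 ∷ + 56194082 ∷ + 25547112 ∷ + 29688636 ∷ +
    42272794 ∷ -[1+ 40530098 ] ∷ -[1+ 23229812 ] ∷ -[1+ 46872540 ] ∷ + 13861494 ∷ + 32836795 ∷ -[1+ 17739595 ] ∷
    -[1+ 23092585 ] ∷ + 31197584 ∷ [])) ∷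
  (396 , (-[1+ 3167159 ] ∷ + 0 ∷ + 0 ∷ + 0 ∷ + 0 ∷ + 0 ∷ + 0 ∷ + 0 ∷ + 0 ∷ + 0 ∷ -[1+ 28214882 ] ∷ + 8234616 ∷ +
    34635670 ∷ + 0 ∷ + 0 ∷ + 0 ∷ + 0 ∷ + 0 ∷ + 0 ∷ + 0 ∷ + 0 ∷ + 0 ∷ + 89771834 ∷ -[1+ 89014326 ] ∷ -[1+ 44671875
    ] ∷ + 108847082 ∷ + 15566252 ∷ + 23915633 ∷ -[1+ 11204129 ] ∷ -[1+ 25549728 ] ∷ + 12554443 ∷ + 53155193 ∷ +
    25440215 ∷ + 41875520 ∷ + 4205842 ∷ -[1+ 30292071 ] ∷ -[1+ 62235853 ] ∷ + 58001980 ∷ -[1+ 34343950 ] ∷ -[1+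
    28656780 ] ∷ -[1+ 20773669 ] ∷ + 31145491 ∷ -[1+ 32318332 ] ∷ -[1+ 16246846 ] ∷ -[1+ 45567243 ] ∷ -[1+
    24085829 ] ∷ + 5228449 ∷ -[1+ 51631324 ] ∷ + 99346337 ∷ -[1+ 3226882 ] ∷ -[1+ 46836730 ] ∷ + 37754289 ∷ +
    9689130 ∷ -[1+ 37519393 ] ∷ [])) ∷
  (396 , (-[1+ 1252419 ] ∷ + 0 ∷ + 0 ∷ + 0 ∷ + 0 ∷ + 0 ∷ + 0 ∷ + 0 ∷ + 0 ∷ + 0 ∷ + 44617580 ∷ + 3256292 ∷ -[1+
    41996885 ] ∷ + 0 ∷ + 0 ∷ + 0 ∷ + 0 ∷ + 0 ∷ + 0 ∷ + 0 ∷ + 0 ∷ + 0 ∷ + 0 ∷ + 109857446 ∷ + 3386312 ∷ -[1+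
    93363170 ] ∷ -[1+ 26071085 ] ∷ -[1+ 30204374 ] ∷ + 20025746 ∷ + 33361675 ∷ + 4609858 ∷ -[1+ 17176616 ] ∷ +
    61343616 ∷ + 24619248 ∷ -[1+ 2386122 ] ∷ + 40579158 ∷ -[1+ 32283965 ] ∷ -[1+ 41447935 ] ∷ + 52196626 ∷ +
    2262605 ∷ -[1+ 9796754 ] ∷ -[1+ 3098531 ] ∷ -[1+ 9569538 ] ∷ + 32475471 ∷ -[1+ 6068966 ] ∷ + 72962601 ∷ -[1+
    33733364 ] ∷ -[1+ 12588227 ] ∷ -[1+ 77627973 ] ∷ + 39272390 ∷ -[1+ 3855690 ] ∷ -[1+ 42766428 ] ∷ + 6231940 ∷
    -[1+ 18928271 ] ∷ [])) ∷
  (396 , (-[1+ 3732669 ] ∷ + 0 ∷ + 0 ∷ + 0 ∷ + 0 ∷ + 0 ∷ + 0 ∷ + 0 ∷ + 0 ∷ + 0 ∷ -[1+ 11118379 ] ∷ + 9704942 ∷ +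
    8942386 ∷ + 0 ∷ + 0 ∷ + 0 ∷ + 0 ∷ + 0 ∷ + 0 ∷ + 0 ∷ + 0 ∷ + 0 ∷ + 0 ∷ + 0 ∷ + 53523144 ∷ + 10267963 ∷ +
    21274166 ∷ + 4587234 ∷ -[1+ 31874303 ] ∷ + 11100703 ∷ + 2447016 ∷ -[1+ 61685753 ] ∷ + 109502949 ∷ + 82248764 ∷
    -[1+ 2222517 ] ∷ + 54062236 ∷ -[1+ 59813832 ] ∷ + 15081482 ∷ + 5708230 ∷ + 5293135 ∷ -[1+ 43125747 ] ∷ -[1+
    8212624 ] ∷ -[1+ 9726556 ] ∷ -[1+ 7672585 ] ∷ + 11364364 ∷ -[1+ 72375706 ] ∷ -[1+ 7985674 ] ∷ -[1+ 20238066 ]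
    ∷ + 40380452 ∷ -[1+ 4254189 ] ∷ + 5944336 ∷ -[1+ 15472540 ] ∷ + 20437593 ∷ -[1+ 37557343 ] ∷ [])) ∷
  (396 , (-[1+ 3640709 ] ∷ + 0 ∷ + 0 ∷ + 0 ∷ + 0 ∷ + 0 ∷ + 0 ∷ + 0 ∷ + 0 ∷ + 0 ∷ -[1+ 7294985 ] ∷ + 9465846 ∷ +
    17180922 ∷ + 0 ∷ + 0 ∷ + 0 ∷ + 0 ∷ + 0 ∷ + 0 ∷ + 0 ∷ + 0 ∷ + 0 ∷ + 0 ∷ + 0 ∷ + 0 ∷ + 56748944 ∷ -[1+ 2736451 ]
    ∷ + 12667993 ∷ -[1+ 16540865 ] ∷ -[1+ 4905707 ] ∷ + 15940529 ∷ -[1+ 47736732 ] ∷ + 85697580 ∷ + 103820536 ∷ +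
    101379751 ∷ + 98905136 ∷ -[1+ 102060664 ] ∷ + 29980867 ∷ + 3745614 ∷ + 6905426 ∷ -[1+ 28925007 ] ∷ -[1+
    9225904 ] ∷ -[1+ 28357692 ] ∷ -[1+ 9678016 ] ∷ -[1+ 33004802 ] ∷ -[1+ 26746540 ] ∷ + 8721884 ∷ -[1+ 31786799 ]
    ∷ + 17247107 ∷ -[1+ 15348454 ] ∷ -[1+ 15148591 ] ∷ + 7277289 ∷ + 17702674 ∷ -[1+ 59276843 ] ∷ [])) ∷
  (396 , (-[1+ 4330719 ] ∷ + 0 ∷ + 0 ∷ + 0 ∷ + 0 ∷ + 0 ∷ + 0 ∷ + 0 ∷ + 0 ∷ + 0 ∷ -[1+ 2202124 ] ∷ + 11259872 ∷
    -[1+ 4328538 ] ∷ + 0 ∷ + 0 ∷ + 0 ∷ + 0 ∷ + 0 ∷ + 0 ∷ + 0 ∷ + 0 ∷ + 0 ∷ + 0 ∷ + 0 ∷ + 0 ∷ + 0 ∷ -[1+ 49468611 ]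
    ∷ + 31700223 ∷ + 33182868 ∷ -[1+ 7499102 ] ∷ -[1+ 7673676 ] ∷ + 26851185 ∷ -[1+ 57939977 ] ∷ + 5888671 ∷ +
    81544594 ∷ + 9791273 ∷ -[1+ 20707619 ] ∷ + 24380741 ∷ -[1+ 8758297 ] ∷ + 715192 ∷ + 23321804 ∷ -[1+ 5363106 ]
    ∷ -[1+ 30133436 ] ∷ -[1+ 26133472 ] ∷ + 1703378 ∷ + 52800917 ∷ + 23819083 ∷ + 21244933 ∷ -[1+ 49581146 ] ∷
    -[1+ 15114568 ] ∷ -[1+ 1498979 ] ∷ + 14845628 ∷ + 13495449 ∷ -[1+ 2115959 ] ∷ [])) ∷
  (396 , (+ 3024040 ∷ + 0 ∷ + 0 ∷ + 0 ∷ + 0 ∷ + 0 ∷ + 0 ∷ + 0 ∷ + 0 ∷ + 0 ∷ + 27102182 ∷ -[1+ 7862503 ] ∷ -[1+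
    28609153 ] ∷ + 0 ∷ + 0 ∷ + 0 ∷ + 0 ∷ + 0 ∷ + 0 ∷ + 0 ∷ + 0 ∷ + 0 ∷ + 0 ∷ + 0 ∷ + 0 ∷ + 0 ∷ -[1+ 60857251 ] ∷ +
    0 ∷ + 82696274 ∷ -[1+ 16065426 ] ∷ + 6735179 ∷ -[1+ 17601734 ] ∷ -[1+ 77655117 ] ∷ -[1+ 48815583 ] ∷ +
    42918093 ∷ + 16852288 ∷ + 24919008 ∷ -[1+ 17560177 ] ∷ + 7053403 ∷ + 76666 ∷ + 59737077 ∷ + 4196859 ∷ -[1+
    54485503 ] ∷ -[1+ 33441369 ] ∷ -[1+ 61628813 ] ∷ + 126305618 ∷ + 34194000 ∷ + 53023704 ∷ -[1+ 114045180 ] ∷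
    -[1+ 12707490 ] ∷ + 6536380 ∷ + 17238026 ∷ -[1+ 13188790 ] ∷ + 6254336 ∷ [])) ∷
  (396 , (-[1+ 4605809 ] ∷ + 0 ∷ + 0 ∷ + 0 ∷ + 0 ∷ + 0 ∷ + 0 ∷ + 0 ∷ + 0 ∷ + 0 ∷ + 10595610 ∷ + 11975106 ∷ -[1+
    21244659 ] ∷ + 0 ∷ + 0 ∷ + 0 ∷ + 0 ∷ + 0 ∷ + 0 ∷ + 0 ∷ + 0 ∷ + 0 ∷ + 0 ∷ + 0 ∷ + 0 ∷ + 0 ∷ -[1+ 11058437 ] ∷ +
    0 ∷ + 0 ∷ + 26311051 ∷ -[1+ 7323986 ] ∷ + 29201261 ∷ + 34364847 ∷ -[1+ 16326132 ] ∷ -[1+ 20348352 ] ∷ +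
    20190475 ∷ -[1+ 15629848 ] ∷ -[1+ 14332748 ] ∷ + 31176442 ∷ + 1112599 ∷ + 6822986 ∷ -[1+ 5422353 ] ∷ -[1+
    13736336 ] ∷ + 833405 ∷ -[1+ 11536692 ] ∷ + 32411634 ∷ -[1+ 3824575 ] ∷ + 40479596 ∷ -[1+ 20139759 ] ∷ +
    5818459 ∷ + 1761166 ∷ -[1+ 3459767 ] ∷ + 12056165 ∷ + 668426 ∷ [])) ∷
  (396 , (-[1+ 2105879 ] ∷ + 0 ∷ + 0 ∷ + 0 ∷ + 0 ∷ + 0 ∷ + 0 ∷ + 0 ∷ + 0 ∷ + 0 ∷ -[1+ 3830487 ] ∷ + 5475288 ∷ +
    2316468 ∷ + 0 ∷ + 0 ∷ + 0 ∷ + 0 ∷ + 0 ∷ + 0 ∷ + 0 ∷ + 0 ∷ + 0 ∷ + 0 ∷ + 0 ∷ + 0 ∷ + 0 ∷ + 12293912 ∷ + 0 ∷ + 0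
    ∷ + 0 ∷ + 20269623 ∷ -[1+ 47493594 ] ∷ + 18672542 ∷ -[1+ 8615988 ] ∷ + 11721610 ∷ -[1+ 15784275 ] ∷ + 34359920
    ∷ + 2599552 ∷ -[1+ 1678127 ] ∷ + 13907642 ∷ + 1786143 ∷ -[1+ 12360346 ] ∷ + 12037049 ∷ + 6590197 ∷ + 3305836 ∷
    -[1+ 5807788 ] ∷ + 1365388 ∷ -[1+ 8562698 ] ∷ + 16229899 ∷ + 8126759 ∷ + 10999890 ∷ + 6177713 ∷ -[1+ 21263285
    ] ∷ + 6620262 ∷ [])) ∷
  (396 , (-[1+ 695179 ] ∷ + 0 ∷ + 0 ∷ + 0 ∷ + 0 ∷ + 0 ∷ + 0 ∷ + 0 ∷ + 0 ∷ + 0 ∷ + 272232 ∷ + 1807468 ∷ + 764698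
    ∷ + 0 ∷ + 0 ∷ + 0 ∷ + 0 ∷ + 0 ∷ + 0 ∷ + 0 ∷ + 0 ∷ + 0 ∷ + 0 ∷ + 0 ∷ + 0 ∷ + 0 ∷ + 984932 ∷ + 0 ∷ + 0 ∷ + 0 ∷ +
    0 ∷ + 599354962 ∷ -[1+ 25745736 ] ∷ -[1+ 8294433 ] ∷ -[1+ 26304824 ] ∷ -[1+ 8895087 ] ∷ -[1+ 1547039 ] ∷ +
    882824 ∷ + 535520 ∷ + 207940 ∷ -[1+ 5957212 ] ∷ -[1+ 3057922 ] ∷ -[1+ 5119650 ] ∷ + 964276 ∷ + 998684 ∷ -[1+
    1535248 ] ∷ + 535133 ∷ + 31491 ∷ + 264478 ∷ + 816648 ∷ -[1+ 3745669 ] ∷ + 656669 ∷ + 2069639 ∷ -[1+ 2609881 ]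
    ∷ [])) ∷
  (396 , (+ 435120 ∷ + 0 ∷ + 0 ∷ + 0 ∷ + 0 ∷ + 0 ∷ + 0 ∷ + 0 ∷ + 0 ∷ + 0 ∷ + 1878825 ∷ -[1+ 1131311 ] ∷ -[1+
    478631 ] ∷ + 0 ∷ + 0 ∷ + 0 ∷ + 0 ∷ + 0 ∷ + 0 ∷ + 0 ∷ + 0 ∷ + 0 ∷ + 0 ∷ + 0 ∷ + 0 ∷ + 0 ∷ -[1+ 4714913 ] ∷ + 0
    ∷ + 0 ∷ + 0 ∷ + 0 ∷ + 0 ∷ + 245507598 ∷ + 21815857 ∷ -[1+ 94769560 ] ∷ + 7625116 ∷ -[1+ 22067234 ] ∷ +
    11222782 ∷ -[1+ 5606549 ] ∷ -[1+ 720781 ] ∷ -[1+ 428329 ] ∷ + 418023 ∷ -[1+ 6339152 ] ∷ + 317707 ∷ + 4526567 ∷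
    -[1+ 17275271 ] ∷ -[1+ 2968451 ] ∷ -[1+ 15923071 ] ∷ + 15866060 ∷ + 14774680 ∷ -[1+ 3477386 ] ∷ -[1+ 17741443
    ] ∷ + 4521814 ∷ -[1+ 10000891 ] ∷ [])) ∷
  (396 , (-[1+ 147779 ] ∷ + 0 ∷ + 0 ∷ + 0 ∷ + 0 ∷ + 0 ∷ + 0 ∷ + 0 ∷ + 0 ∷ + 0 ∷ + 4118529 ∷ + 384228 ∷ + 162558
    ∷ + 0 ∷ + 0 ∷ + 0 ∷ + 0 ∷ + 0 ∷ + 0 ∷ + 0 ∷ + 0 ∷ + 0 ∷ + 0 ∷ + 0 ∷ + 0 ∷ + 0 ∷ -[1+ 7911941 ] ∷ + 0 ∷ + 0 ∷ +
    0 ∷ + 0 ∷ + 0 ∷ + 0 ∷ + 116586408 ∷ + 33023153 ∷ + 32623393 ∷ -[1+ 35723350 ] ∷ + 3505627 ∷ + 6859498 ∷ -[1+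
    1012908 ] ∷ -[1+ 5734990 ] ∷ + 1276362 ∷ -[1+ 17200964 ] ∷ -[1+ 2311666 ] ∷ -[1+ 11461315 ] ∷ + 4758915 ∷ -[1+
    2633942 ] ∷ -[1+ 10237143 ] ∷ -[1+ 7022709 ] ∷ -[1+ 2786851 ] ∷ -[1+ 9564437 ] ∷ -[1+ 2338959 ] ∷ + 10586499 ∷
    -[1+ 20847881 ] ∷ [])) ∷
  (396 , (+ 550090 ∷ + 0 ∷ + 0 ∷ + 0 ∷ + 0 ∷ + 0 ∷ + 0 ∷ + 0 ∷ + 0 ∷ + 0 ∷ + 4264355 ∷ -[1+ 1430233 ] ∷ -[1+
    605098 ] ∷ + 0 ∷ + 0 ∷ + 0 ∷ + 0 ∷ + 0 ∷ + 0 ∷ + 0 ∷ + 0 ∷ + 0 ∷ + 0 ∷ + 0 ∷ + 0 ∷ + 0 ∷ -[1+ 9738907 ] ∷ + 0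
    ∷ + 0 ∷ + 0 ∷ + 0 ∷ + 0 ∷ + 0 ∷ + 0 ∷ + 228088344 ∷ + 29728985 ∷ -[1+ 30971646 ] ∷ -[1+ 4264137 ] ∷ + 11240615
    ∷ -[1+ 715667 ] ∷ -[1+ 267754 ] ∷ -[1+ 192021 ] ∷ -[1+ 6428334 ] ∷ -[1+ 5447982 ] ∷ -[1+ 21733429 ] ∷ +
    19226801 ∷ + 2758273 ∷ + 5161297 ∷ -[1+ 26173876 ] ∷ -[1+ 14279872 ] ∷ -[1+ 5597491 ] ∷ + 9382810 ∷ + 6175191
    ∷ -[1+ 13560579 ] ∷ [])) ∷
  (396 , (-[1+ 439729 ] ∷ + 0 ∷ + 0 ∷ + 0 ∷ + 0 ∷ + 0 ∷ + 0 ∷ + 0 ∷ + 0 ∷ + 0 ∷ + 6109048 ∷ + 1143298 ∷ + 483703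
    ∷ + 0 ∷ + 0 ∷ + 0 ∷ + 0 ∷ + 0 ∷ + 0 ∷ + 0 ∷ + 0 ∷ + 0 ∷ + 0 ∷ + 0 ∷ + 0 ∷ + 0 ∷ -[1+ 11250689 ] ∷ + 0 ∷ + 0 ∷
    + 0 ∷ + 0 ∷ + 0 ∷ + 0 ∷ + 0 ∷ + 0 ∷ + 117371260 ∷ -[1+ 26677141 ] ∷ + 888631 ∷ + 5608443 ∷ -[1+ 192567 ] ∷
    -[1+ 5949659 ] ∷ -[1+ 238833 ] ∷ -[1+ 9331463 ] ∷ -[1+ 5991150 ] ∷ -[1+ 19494023 ] ∷ + 8385835 ∷ + 3894000 ∷ +
    1526163 ∷ -[1+ 18579344 ] ∷ -[1+ 5390874 ] ∷ -[1+ 9345918 ] ∷ + 221453 ∷ + 8450266 ∷ -[1+ 15933125 ] ∷ [])) ∷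
  (396 , (-[1+ 2573469 ] ∷ + 0 ∷ + 0 ∷ + 0 ∷ + 0 ∷ + 0 ∷ + 0 ∷ + 0 ∷ + 0 ∷ + 0 ∷ + 831842 ∷ + 6691022 ∷ +
    2830817 ∷ + 0 ∷ + 0 ∷ + 0 ∷ + 0 ∷ + 0 ∷ + 0 ∷ + 0 ∷ + 0 ∷ + 0 ∷ + 0 ∷ + 0 ∷ + 0 ∷ + 0 ∷ + 3997950 ∷ + 0 ∷ + 0
    ∷ + 0 ∷ + 0 ∷ + 0 ∷ + 0 ∷ + 0 ∷ + 0 ∷ + 0 ∷ + 71137030 ∷ -[1+ 10713076 ] ∷ -[1+ 11941126 ] ∷ + 4891765 ∷ +
    12924155 ∷ -[1+ 1039561 ] ∷ + 16396035 ∷ + 236458 ∷ + 10923712 ∷ -[1+ 24312453 ] ∷ -[1+ 1332752 ] ∷ + 7441340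
    ∷ -[1+ 17561113 ] ∷ -[1+ 3119934 ] ∷ + 14107511 ∷ -[1+ 3447975 ] ∷ -[1+ 8114094 ] ∷ + 21889824 ∷ [])) ∷
  (396 , (+ 824950 ∷ + 0 ∷ + 0 ∷ + 0 ∷ + 0 ∷ + 0 ∷ + 0 ∷ + 0 ∷ + 0 ∷ + 0 ∷ -[1+ 5969011 ] ∷ -[1+ 2144869 ] ∷
    -[1+ 907444 ] ∷ + 0 ∷ + 0 ∷ + 0 ∷ + 0 ∷ + 0 ∷ + 0 ∷ + 0 ∷ + 0 ∷ + 0 ∷ + 0 ∷ + 0 ∷ + 0 ∷ + 0 ∷ + 10123134 ∷ + 0
    ∷ + 0 ∷ + 0 ∷ + 0 ∷ + 0 ∷ + 0 ∷ + 0 ∷ + 0 ∷ + 0 ∷ + 0 ∷ + 32536542 ∷ -[1+ 9916775 ] ∷ -[1+ 1355173 ] ∷ -[1+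
    40686548 ] ∷ + 3111912 ∷ + 13545422 ∷ + 6104148 ∷ + 10573959 ∷ -[1+ 3128674 ] ∷ -[1+ 11666976 ] ∷ -[1+
    10251617 ] ∷ + 26777741 ∷ + 9552274 ∷ -[1+ 1314377 ] ∷ -[1+ 2991468 ] ∷ + 640090 ∷ -[1+ 3095069 ] ∷ [])) ∷
  (396 , (+ 530890 ∷ + 0 ∷ + 0 ∷ + 0 ∷ + 0 ∷ + 0 ∷ + 0 ∷ + 0 ∷ + 0 ∷ + 0 ∷ -[1+ 1686922 ] ∷ -[1+ 1380313 ] ∷
    -[1+ 583978 ] ∷ + 0 ∷ + 0 ∷ + 0 ∷ + 0 ∷ + 0 ∷ + 0 ∷ + 0 ∷ + 0 ∷ + 0 ∷ + 0 ∷ + 0 ∷ + 0 ∷ + 0 ∷ + 2205888 ∷ + 0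
    ∷ + 0 ∷ + 0 ∷ + 0 ∷ + 0 ∷ + 0 ∷ + 0 ∷ + 0 ∷ + 0 ∷ + 0 ∷ + 0 ∷ + 29458986 ∷ -[1+ 594187 ] ∷ + 10162 ∷ + 1676754
    ∷ -[1+ 32690993 ] ∷ -[1+ 7144861 ] ∷ -[1+ 5373924 ] ∷ + 9307113 ∷ + 2446794 ∷ + 1700805 ∷ + 3695354 ∷ -[1+
    1466760 ] ∷ -[1+ 6077081 ] ∷ + 7308579 ∷ + 1869098 ∷ -[1+ 4906153 ] ∷ [])) ∷
  (396 , (-[1+ 2058139 ] ∷ + 0 ∷ + 0 ∷ + 0 ∷ + 0 ∷ + 0 ∷ + 0 ∷ + 0 ∷ + 0 ∷ + 0 ∷ + 5156974 ∷ + 5351164 ∷ +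
    2263954 ∷ + 0 ∷ + 0 ∷ + 0 ∷ + 0 ∷ + 0 ∷ + 0 ∷ + 0 ∷ + 0 ∷ + 0 ∷ + 0 ∷ + 0 ∷ + 0 ∷ + 0 ∷ -[1+ 5786039 ] ∷ + 0 ∷
    + 0 ∷ + 0 ∷ + 0 ∷ + 0 ∷ + 0 ∷ + 0 ∷ + 0 ∷ + 0 ∷ + 0 ∷ + 0 ∷ + 0 ∷ + 19668829 ∷ -[1+ 2940571 ] ∷ -[1+ 30005100
    ] ∷ -[1+ 5823261 ] ∷ + 678682 ∷ + 486527 ∷ -[1+ 10079746 ] ∷ + 2273558 ∷ + 4930408 ∷ -[1+ 19141261 ] ∷ -[1+
    1050423 ] ∷ -[1+ 5344310 ] ∷ -[1+ 1122592 ] ∷ + 2566168 ∷ -[1+ 604427 ] ∷ [])) ∷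
  (396 , (+ 1631540 ∷ + 0 ∷ + 0 ∷ + 0 ∷ + 0 ∷ + 0 ∷ + 0 ∷ + 0 ∷ + 0 ∷ + 0 ∷ + 2292511 ∷ -[1+ 4242003 ] ∷ -[1+
    1794693 ] ∷ + 0 ∷ + 0 ∷ + 0 ∷ + 0 ∷ + 0 ∷ + 0 ∷ + 0 ∷ + 0 ∷ + 0 ∷ + 0 ∷ + 0 ∷ + 0 ∷ + 0 ∷ -[1+ 8174409 ] ∷ + 0
    ∷ + 0 ∷ + 0 ∷ + 0 ∷ + 0 ∷ + 0 ∷ + 0 ∷ + 0 ∷ + 0 ∷ + 0 ∷ + 0 ∷ + 0 ∷ + 0 ∷ + 52376262 ∷ -[1+ 378828 ] ∷ -[1+
    3514141 ] ∷ + 6434194 ∷ -[1+ 7396654 ] ∷ -[1+ 2736794 ] ∷ -[1+ 4671423 ] ∷ -[1+ 2504589 ] ∷ + 1127755 ∷ +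
    2941114 ∷ + 4796295 ∷ -[1+ 5972626 ] ∷ -[1+ 4220446 ] ∷ + 4851506 ∷ [])) ∷
  (396 , (+ 594270 ∷ + 0 ∷ + 0 ∷ + 0 ∷ + 0 ∷ + 0 ∷ + 0 ∷ + 0 ∷ + 0 ∷ + 0 ∷ -[1+ 1391865 ] ∷ -[1+ 1545101 ] ∷
    -[1+ 653696 ] ∷ + 0 ∷ + 0 ∷ + 0 ∷ + 0 ∷ + 0 ∷ + 0 ∷ + 0 ∷ + 0 ∷ + 0 ∷ + 0 ∷ + 0 ∷ + 0 ∷ + 0 ∷ + 1476338 ∷ + 0
    ∷ + 0 ∷ + 0 ∷ + 0 ∷ + 0 ∷ + 0 ∷ + 0 ∷ + 0 ∷ + 0 ∷ + 0 ∷ + 0 ∷ + 0 ∷ + 0 ∷ + 0 ∷ + 37101682 ∷ + 231580 ∷ -[1+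
    12343774 ] ∷ -[1+ 1143895 ] ∷ + 3001492 ∷ -[1+ 12899885 ] ∷ -[1+ 2308883 ] ∷ + 5520588 ∷ -[1+ 224876 ] ∷ +
    795233 ∷ -[1+ 301484 ] ∷ + 1063568 ∷ -[1+ 3434529 ] ∷ [])) ∷
  (396 , (+ 2182570 ∷ + 0 ∷ + 0 ∷ + 0 ∷ + 0 ∷ + 0 ∷ + 0 ∷ + 0 ∷ + 0 ∷ + 0 ∷ -[1+ 3262297 ] ∷ -[1+ 5674681 ] ∷
    -[1+ 2400826 ] ∷ + 0 ∷ + 0 ∷ + 0 ∷ + 0 ∷ + 0 ∷ + 0 ∷ + 0 ∷ + 0 ∷ + 0 ∷ + 0 ∷ + 0 ∷ + 0 ∷ + 0 ∷ + 1722942 ∷ + 0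
    ∷ + 0 ∷ + 0 ∷ + 0 ∷ + 0 ∷ + 0 ∷ + 0 ∷ + 0 ∷ + 0 ∷ + 0 ∷ + 0 ∷ + 0 ∷ + 0 ∷ + 0 ∷ + 0 ∷ + 50770079 ∷ -[1+
    6317720 ] ∷ -[1+ 3172807 ] ∷ + 13688013 ∷ + 6044046 ∷ -[1+ 3208098 ] ∷ + 439592 ∷ -[1+ 4634967 ] ∷ + 9323854 ∷
    + 3865066 ∷ -[1+ 5509910 ] ∷ + 6218168 ∷ [])) ∷
  (396 , (-[1+ 260159 ] ∷ + 0 ∷ + 0 ∷ + 0 ∷ + 0 ∷ + 0 ∷ + 0 ∷ + 0 ∷ + 0 ∷ + 0 ∷ -[1+ 1374959 ] ∷ + 676416 ∷ +
    286176 ∷ + 0 ∷ + 0 ∷ + 0 ∷ + 0 ∷ + 0 ∷ + 0 ∷ + 0 ∷ + 0 ∷ + 0 ∷ + 0 ∷ + 0 ∷ + 0 ∷ + 0 ∷ + 3322272 ∷ + 0 ∷ + 0 ∷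
    + 0 ∷ + 0 ∷ + 0 ∷ + 0 ∷ + 0 ∷ + 0 ∷ + 0 ∷ + 0 ∷ + 0 ∷ + 0 ∷ + 0 ∷ + 0 ∷ + 0 ∷ + 0 ∷ + 35614222 ∷ + 8968232 ∷
    -[1+ 7521198 ] ∷ -[1+ 26765783 ] ∷ -[1+ 10402394 ] ∷ + 11462018 ∷ + 6481046 ∷ + 567449 ∷ -[1+ 4341103 ] ∷ -[1+
    1306414 ] ∷ + 3185182 ∷ [])) ∷
  (396 , (+ 1216170 ∷ + 0 ∷ + 0 ∷ + 0 ∷ + 0 ∷ + 0 ∷ + 0 ∷ + 0 ∷ + 0 ∷ + 0 ∷ -[1+ 8848318 ] ∷ -[1+ 3162041 ] ∷
    -[1+ 1337786 ] ∷ + 0 ∷ + 0 ∷ + 0 ∷ + 0 ∷ + 0 ∷ + 0 ∷ + 0 ∷ + 0 ∷ + 0 ∷ + 0 ∷ + 0 ∷ + 0 ∷ + 0 ∷ + 15021064 ∷ +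
    0 ∷ + 0 ∷ + 0 ∷ + 0 ∷ + 0 ∷ + 0 ∷ + 0 ∷ + 0 ∷ + 0 ∷ + 0 ∷ + 0 ∷ + 0 ∷ + 0 ∷ + 0 ∷ + 0 ∷ + 0 ∷ + 0 ∷ + 35616519
    ∷ -[1+ 12389472 ] ∷ -[1+ 7895145 ] ∷ -[1+ 7180777 ] ∷ + 28557596 ∷ + 6395226 ∷ + 10587321 ∷ -[1+ 5496054 ] ∷
    -[1+ 2759789 ] ∷ + 2844006 ∷ [])) ∷
  (396 , (+ 1864620 ∷ + 0 ∷ + 0 ∷ + 0 ∷ + 0 ∷ + 0 ∷ + 0 ∷ + 0 ∷ + 0 ∷ + 0 ∷ -[1+ 3202037 ] ∷ -[1+ 4848011 ] ∷
    -[1+ 2051081 ] ∷ + 0 ∷ + 0 ∷ + 0 ∷ + 0 ∷ + 0 ∷ + 0 ∷ + 0 ∷ + 0 ∷ + 0 ∷ + 0 ∷ + 0 ∷ + 0 ∷ + 0 ∷ + 2301912 ∷ + 0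
    ∷ + 0 ∷ + 0 ∷ + 0 ∷ + 0 ∷ + 0 ∷ + 0 ∷ + 0 ∷ + 0 ∷ + 0 ∷ + 0 ∷ + 0 ∷ + 0 ∷ + 0 ∷ + 0 ∷ + 0 ∷ + 0 ∷ + 0 ∷ +
    44440592 ∷ -[1+ 1176809 ] ∷ + 441987 ∷ -[1+ 6663050 ] ∷ + 2092029 ∷ + 803520 ∷ + 4422138 ∷ -[1+ 4302110 ] ∷ +
    4502058 ∷ [])) ∷
  (396 , (-[1+ 1006389 ] ∷ + 0 ∷ + 0 ∷ + 0 ∷ + 0 ∷ + 0 ∷ + 0 ∷ + 0 ∷ + 0 ∷ + 0 ∷ + 2902844 ∷ + 2616614 ∷ +
    1107029 ∷ + 0 ∷ + 0 ∷ + 0 ∷ + 0 ∷ + 0 ∷ + 0 ∷ + 0 ∷ + 0 ∷ + 0 ∷ + 0 ∷ + 0 ∷ + 0 ∷ + 0 ∷ -[1+ 3591629 ] ∷ + 0 ∷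
    + 0 ∷ + 0 ∷ + 0 ∷ + 0 ∷ + 0 ∷ + 0 ∷ + 0 ∷ + 0 ∷ + 0 ∷ + 0 ∷ + 0 ∷ + 0 ∷ + 0 ∷ + 0 ∷ + 0 ∷ + 0 ∷ + 0 ∷ + 0 ∷ +
    23719649 ∷ -[1+ 1028695 ] ∷ -[1+ 9224408 ] ∷ + 698141 ∷ -[1+ 2346931 ] ∷ + 1474519 ∷ -[1+ 2627932 ] ∷ +
    7469924 ∷ [])) ∷
  (396 , (+ 232370 ∷ + 0 ∷ + 0 ∷ + 0 ∷ + 0 ∷ + 0 ∷ + 0 ∷ + 0 ∷ + 0 ∷ + 0 ∷ + 946570 ∷ -[1+ 604161 ] ∷ -[1+
    255606 ] ∷ + 0 ∷ + 0 ∷ + 0 ∷ + 0 ∷ + 0 ∷ + 0 ∷ + 0 ∷ + 0 ∷ + 0 ∷ + 0 ∷ + 0 ∷ + 0 ∷ + 0 ∷ -[1+ 2404353 ] ∷ + 0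
    ∷ + 0 ∷ + 0 ∷ + 0 ∷ + 0 ∷ + 0 ∷ + 0 ∷ + 0 ∷ + 0 ∷ + 0 ∷ + 0 ∷ + 0 ∷ + 0 ∷ + 0 ∷ + 0 ∷ + 0 ∷ + 0 ∷ + 0 ∷ + 0 ∷
    + 0 ∷ + 29857011 ∷ -[1+ 15487082 ] ∷ -[1+ 6597235 ] ∷ + 4350053 ∷ + 3151688 ∷ -[1+ 1874311 ] ∷ + 3237410 ∷
    [])) ∷
  (396 , (+ 2164130 ∷ + 0 ∷ + 0 ∷ + 0 ∷ + 0 ∷ + 0 ∷ + 0 ∷ + 0 ∷ + 0 ∷ + 0 ∷ -[1+ 11562436 ] ∷ -[1+ 5626737 ] ∷
    -[1+ 2380542 ] ∷ + 0 ∷ + 0 ∷ + 0 ∷ + 0 ∷ + 0 ∷ + 0 ∷ + 0 ∷ + 0 ∷ + 0 ∷ + 0 ∷ + 0 ∷ + 0 ∷ + 0 ∷ + 18363788 ∷ +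
    0 ∷ + 0 ∷ + 0 ∷ + 0 ∷ + 0 ∷ + 0 ∷ + 0 ∷ + 0 ∷ + 0 ∷ + 0 ∷ + 0 ∷ + 0 ∷ + 0 ∷ + 0 ∷ + 0 ∷ + 0 ∷ + 0 ∷ + 0 ∷ + 0
    ∷ + 0 ∷ + 0 ∷ + 59528044 ∷ + 3706639 ∷ + 6366985 ∷ + 6827532 ∷ -[1+ 5555131 ] ∷ + 6349178 ∷ [])) ∷
  (396 , (-[1+ 187459 ] ∷ + 0 ∷ + 0 ∷ + 0 ∷ + 0 ∷ + 0 ∷ + 0 ∷ + 0 ∷ + 0 ∷ + 0 ∷ + 2148718 ∷ + 487396 ∷ + 206206
    ∷ + 0 ∷ + 0 ∷ + 0 ∷ + 0 ∷ + 0 ∷ + 0 ∷ + 0 ∷ + 0 ∷ + 0 ∷ + 0 ∷ + 0 ∷ + 0 ∷ + 0 ∷ -[1+ 3885023 ] ∷ + 0 ∷ + 0 ∷ +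
    0 ∷ + 0 ∷ + 0 ∷ + 0 ∷ + 0 ∷ + 0 ∷ + 0 ∷ + 0 ∷ + 0 ∷ + 0 ∷ + 0 ∷ + 0 ∷ + 0 ∷ + 0 ∷ + 0 ∷ + 0 ∷ + 0 ∷ + 0 ∷ + 0
    ∷ + 0 ∷ + 14621217 ∷ -[1+ 8387943 ] ∷ -[1+ 6865803 ] ∷ -[1+ 1497440 ] ∷ + 3407294 ∷ [])) ∷
  (396 , (+ 1752600 ∷ + 0 ∷ + 0 ∷ + 0 ∷ + 0 ∷ + 0 ∷ + 0 ∷ + 0 ∷ + 0 ∷ + 0 ∷ -[1+ 4579990 ] ∷ -[1+ 4556759 ] ∷
    -[1+ 1927859 ] ∷ + 0 ∷ + 0 ∷ + 0 ∷ + 0 ∷ + 0 ∷ + 0 ∷ + 0 ∷ + 0 ∷ + 0 ∷ + 0 ∷ + 0 ∷ + 0 ∷ + 0 ∷ + 5304262 ∷ + 0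
    ∷ + 0 ∷ + 0 ∷ + 0 ∷ + 0 ∷ + 0 ∷ + 0 ∷ + 0 ∷ + 0 ∷ + 0 ∷ + 0 ∷ + 0 ∷ + 0 ∷ + 0 ∷ + 0 ∷ + 0 ∷ + 0 ∷ + 0 ∷ + 0 ∷
    + 0 ∷ + 0 ∷ + 0 ∷ + 0 ∷ + 17285003 ∷ -[1+ 8306680 ] ∷ -[1+ 4573590 ] ∷ + 5291462 ∷ [])) ∷
  (396 , (+ 636320 ∷ + 0 ∷ + 0 ∷ + 0 ∷ + 0 ∷ + 0 ∷ + 0 ∷ + 0 ∷ + 0 ∷ + 0 ∷ -[1+ 3665680 ] ∷ -[1+ 1654431 ] ∷
    -[1+ 699951 ] ∷ + 0 ∷ + 0 ∷ + 0 ∷ + 0 ∷ + 0 ∷ + 0 ∷ + 0 ∷ + 0 ∷ + 0 ∷ + 0 ∷ + 0 ∷ + 0 ∷ + 0 ∷ + 5931458 ∷ + 0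
    ∷ + 0 ∷ + 0 ∷ + 0 ∷ + 0 ∷ + 0 ∷ + 0 ∷ + 0 ∷ + 0 ∷ + 0 ∷ + 0 ∷ + 0 ∷ + 0 ∷ + 0 ∷ + 0 ∷ + 0 ∷ + 0 ∷ + 0 ∷ + 0 ∷
    + 0 ∷ + 0 ∷ + 0 ∷ + 0 ∷ + 0 ∷ + 9821911 ∷ -[1+ 6219861 ] ∷ + 11039820 ∷ [])) ∷
  (396 , (-[1+ 566599 ] ∷ + 0 ∷ + 0 ∷ + 0 ∷ + 0 ∷ + 0 ∷ + 0 ∷ + 0 ∷ + 0 ∷ + 0 ∷ -[1+ 6179085 ] ∷ + 1473160 ∷ +
    623260 ∷ + 0 ∷ + 0 ∷ + 0 ∷ + 0 ∷ + 0 ∷ + 0 ∷ + 0 ∷ + 0 ∷ + 0 ∷ + 0 ∷ + 0 ∷ + 0 ∷ + 0 ∷ + 13604692 ∷ + 0 ∷ + 0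
    ∷ + 0 ∷ + 0 ∷ + 0 ∷ + 0 ∷ + 0 ∷ + 0 ∷ + 0 ∷ + 0 ∷ + 0 ∷ + 0 ∷ + 0 ∷ + 0 ∷ + 0 ∷ + 0 ∷ + 0 ∷ + 0 ∷ + 0 ∷ + 0 ∷
    + 0 ∷ + 0 ∷ + 0 ∷ + 0 ∷ + 0 ∷ + 6235746 ∷ -[1+ 11224971 ] ∷ [])) ∷
  (396 , (-[1+ 2919989 ] ∷ + 0 ∷ + 0 ∷ + 0 ∷ + 0 ∷ + 0 ∷ + 0 ∷ + 0 ∷ + 0 ∷ + 0 ∷ + 291999 ∷ + 7591974 ∷ +
    3211989 ∷ + 0 ∷ + 0 ∷ + 0 ∷ + 0 ∷ + 0 ∷ + 0 ∷ + 0 ∷ + 0 ∷ + 0 ∷ + 0 ∷ + 0 ∷ + 0 ∷ + 0 ∷ + 5839980 ∷ + 0 ∷ + 0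
    ∷ + 0 ∷ + 0 ∷ + 0 ∷ + 0 ∷ + 0 ∷ + 0 ∷ + 0 ∷ + 0 ∷ + 0 ∷ + 0 ∷ + 0 ∷ + 0 ∷ + 0 ∷ + 0 ∷ + 0 ∷ + 0 ∷ + 0 ∷ + 0 ∷
    + 0 ∷ + 0 ∷ + 0 ∷ + 0 ∷ + 0 ∷ + 0 ∷ + 6423978 ∷ [])) ∷
  (2133549260510096 , (+ 0 ∷ + 0 ∷ + 0 ∷ + 0 ∷ + 0 ∷ + 0 ∷ + 0 ∷ + 0 ∷ + 0 ∷ + 0 ∷ -[1+ 0 ] ∷ + 0 ∷ + 0 ∷ + 0 ∷
    + 0 ∷ + 0 ∷ + 0 ∷ + 0 ∷ + 0 ∷ + 0 ∷ + 0 ∷ + 0 ∷ + 0 ∷ + 0 ∷ + 0 ∷ + 0 ∷ + 2 ∷ + 0 ∷ + 0 ∷ + 0 ∷ + 0 ∷ + 0 ∷ +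
    0 ∷ + 0 ∷ + 0 ∷ + 0 ∷ + 0 ∷ + 0 ∷ + 0 ∷ + 0 ∷ + 0 ∷ + 0 ∷ + 0 ∷ + 0 ∷ + 0 ∷ + 0 ∷ + 0 ∷ + 0 ∷ + 0 ∷ + 0 ∷ + 1
    ∷ [])) ∷
  (1813120620950980 , (+ 0 ∷ + 0 ∷ + 0 ∷ + 0 ∷ + 0 ∷ + 0 ∷ + 0 ∷ + 0 ∷ + 0 ∷ + 0 ∷ + 1 ∷ + 0 ∷ -[1+ 0 ] ∷ + 0 ∷
    + 0 ∷ + 0 ∷ + 0 ∷ + 0 ∷ + 0 ∷ + 0 ∷ + 0 ∷ + 0 ∷ + 0 ∷ + 0 ∷ + 0 ∷ + 0 ∷ -[1+ 1 ] ∷ + 0 ∷ + 2 ∷ [])) ∷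
  (1696000911313895 , (+ 0 ∷ + 0 ∷ + 0 ∷ + 0 ∷ + 0 ∷ + 0 ∷ + 0 ∷ + 0 ∷ + 0 ∷ + 0 ∷ + 0 ∷ + 0 ∷ + 0 ∷ + 0 ∷ + 0 ∷
    + 0 ∷ + 0 ∷ + 0 ∷ + 0 ∷ + 0 ∷ + 0 ∷ + 0 ∷ + 0 ∷ + 0 ∷ + 0 ∷ + 0 ∷ -[1+ 1 ] ∷ + 1 ∷ [])) ∷
  (1640488582963359 , (+ 0 ∷ + 0 ∷ + 0 ∷ + 0 ∷ + 0 ∷ + 0 ∷ + 0 ∷ + 0 ∷ + 0 ∷ + 0 ∷ -[1+ 0 ] ∷ + 0 ∷ + 0 ∷ + 0 ∷
    + 0 ∷ + 0 ∷ + 0 ∷ + 0 ∷ + 0 ∷ + 0 ∷ + 0 ∷ + 0 ∷ + 0 ∷ + 0 ∷ + 0 ∷ + 0 ∷ + 2 ∷ + 0 ∷ + 0 ∷ + 0 ∷ + 0 ∷ + 0 ∷ +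
    0 ∷ + 0 ∷ + 0 ∷ + 0 ∷ + 0 ∷ + 0 ∷ + 0 ∷ + 0 ∷ + 0 ∷ + 0 ∷ + 0 ∷ + 0 ∷ + 0 ∷ + 0 ∷ + 0 ∷ + 0 ∷ + 0 ∷ + 0 ∷ + 0
    ∷ + 1 ∷ [])) ∷
  (1153141350813569 , (+ 0 ∷ + 0 ∷ + 0 ∷ + 0 ∷ + 0 ∷ + 0 ∷ + 0 ∷ + 0 ∷ + 0 ∷ + 0 ∷ -[1+ 0 ] ∷ + 0 ∷ + 0 ∷ + 0 ∷
    + 0 ∷ + 0 ∷ + 0 ∷ + 0 ∷ + 0 ∷ + 0 ∷ + 0 ∷ + 0 ∷ + 0 ∷ + 0 ∷ + 0 ∷ + 0 ∷ + 2 ∷ + 0 ∷ + 0 ∷ + 0 ∷ + 0 ∷ + 0 ∷ +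
    0 ∷ + 0 ∷ + 0 ∷ + 0 ∷ + 0 ∷ + 0 ∷ + 0 ∷ + 0 ∷ + 0 ∷ + 0 ∷ + 0 ∷ + 0 ∷ + 0 ∷ + 0 ∷ + 0 ∷ + 0 ∷ + 0 ∷ + 1 ∷ []))
    ∷
  (1079080833367415 , (+ 0 ∷ + 0 ∷ + 0 ∷ + 0 ∷ + 0 ∷ + 0 ∷ + 0 ∷ + 0 ∷ + 0 ∷ + 0 ∷ + 1 ∷ + 0 ∷ -[1+ 0 ] ∷ + 0 ∷
    + 0 ∷ + 0 ∷ + 0 ∷ + 0 ∷ + 0 ∷ + 0 ∷ + 0 ∷ + 0 ∷ + 0 ∷ + 0 ∷ + 0 ∷ + 0 ∷ -[1+ 1 ] ∷ + 0 ∷ + 0 ∷ + 1 ∷ [])) ∷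
  (3051479096336 , (-[1+ 9 ] ∷ + 0 ∷ + 0 ∷ + 0 ∷ + 0 ∷ + 0 ∷ + 0 ∷ + 0 ∷ + 0 ∷ + 0 ∷ + 1 ∷ + 26 ∷ + 11 ∷ + 0 ∷ +
    0 ∷ + 0 ∷ + 0 ∷ + 0 ∷ + 0 ∷ + 0 ∷ + 0 ∷ + 0 ∷ + 0 ∷ + 0 ∷ + 0 ∷ + 0 ∷ + 20 ∷ + 0 ∷ + 0 ∷ + 0 ∷ + 11 ∷ [])) ∷
  (2690746842300 , (-[1+ 9 ] ∷ + 0 ∷ + 0 ∷ + 0 ∷ + 0 ∷ + 0 ∷ + 0 ∷ + 0 ∷ + 0 ∷ + 0 ∷ + 1 ∷ + 26 ∷ + 11 ∷ + 0 ∷ +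
    0 ∷ + 0 ∷ + 0 ∷ + 0 ∷ + 0 ∷ + 0 ∷ + 0 ∷ + 0 ∷ + 0 ∷ + 0 ∷ + 0 ∷ + 0 ∷ + 20 ∷ + 0 ∷ + 0 ∷ + 0 ∷ + 0 ∷ + 0 ∷ + 0
    ∷ + 0 ∷ + 0 ∷ + 0 ∷ + 0 ∷ + 0 ∷ + 0 ∷ + 0 ∷ + 0 ∷ + 0 ∷ + 0 ∷ + 0 ∷ + 0 ∷ + 0 ∷ + 0 ∷ + 0 ∷ + 0 ∷ + 0 ∷ + 0 ∷
    + 0 ∷ + 0 ∷ + 22 ∷ [])) ∷
  []

edgeSquares : List Square
edgeSquares =
  (396 , (+ 1317845279 ∷ + 640185296 ∷ + 629931004 ∷ + 91784733 ∷ + 91784732 ∷ -[1+ 42825311 ] ∷ -[1+ 247185103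
    ] ∷ -[1+ 42825312 ] ∷ -[1+ 247185106 ] ∷ -[1+ 233317975 ] ∷ -[1+ 233317981 ] ∷ -[1+ 948322085 ] ∷ -[1+
    1336331940 ] ∷ -[1+ 1336331940 ] ∷ -[1+ 752867131 ] ∷ -[1+ 1237183579 ] ∷ -[1+ 1237183582 ] ∷ + 11616138 ∷ +
    292447945 ∷ + 11616139 ∷ -[1+ 634412136 ] ∷ + 615717972 ∷ -[1+ 634412138 ] ∷ -[1+ 322407514 ] ∷ + 615717971 ∷
    -[1+ 322407511 ] ∷ -[1+ 234232281 ] ∷ + 612816630 ∷ -[1+ 234232281 ] ∷ -[1+ 83208550 ] ∷ -[1+ 83208546 ] ∷ +
    109509332 ∷ [])) ∷
  (396 , (+ 0 ∷ + 660193631 ∷ + 1282385767 ∷ + 321410653 ∷ + 321410654 ∷ -[1+ 189851744 ] ∷ + 394140385 ∷ -[1+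
    189851745 ] ∷ + 394140384 ∷ -[1+ 227499475 ] ∷ -[1+ 227499477 ] ∷ -[1+ 629485839 ] ∷ -[1+ 1106718151 ] ∷ -[1+
    1106718150 ] ∷ -[1+ 909073890 ] ∷ -[1+ 1156430905 ] ∷ -[1+ 1156430905 ] ∷ + 941500685 ∷ -[1+ 185596638 ] ∷ +
    941500686 ∷ + 206493267 ∷ + 77131600 ∷ + 206493266 ∷ -[1+ 827158335 ] ∷ + 77131600 ∷ -[1+ 827158334 ] ∷ -[1+
    1420599819 ] ∷ -[1+ 875047145 ] ∷ -[1+ 1420599819 ] ∷ + 135660716 ∷ + 135660718 ∷ + 657943082 ∷ [])) ∷
  (396 , (+ 0 ∷ + 0 ∷ -[1+ 192105247 ] ∷ + 1113088892 ∷ -[1+ 491565631 ] ∷ + 328565601 ∷ + 881688435 ∷ +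
    51717408 ∷ -[1+ 294204496 ] ∷ + 174094610 ∷ + 21012604 ∷ -[1+ 420386811 ] ∷ + 758938391 ∷ -[1+ 382985087 ] ∷
    -[1+ 489085696 ] ∷ + 344297317 ∷ -[1+ 681395163 ] ∷ + 630166110 ∷ + 170100658 ∷ -[1+ 1553602526 ] ∷ +
    128840517 ∷ + 850031280 ∷ -[1+ 1052601601 ] ∷ -[1+ 758946740 ] ∷ -[1+ 630768964 ] ∷ + 324740870 ∷ + 187451418
    ∷ + 14032160 ∷ + 54741972 ∷ -[1+ 251633297 ] ∷ + 60689518 ∷ -[1+ 25149711 ] ∷ [])) ∷
  (396 , (+ 0 ∷ + 0 ∷ -[1+ 308674897 ] ∷ + 0 ∷ + 998664162 ∷ + 219370674 ∷ + 106073673 ∷ + 391668427 ∷ +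
    837896074 ∷ + 109113584 ∷ + 204384874 ∷ -[1+ 675477926 ] ∷ -[1+ 53299616 ] ∷ + 657381740 ∷ -[1+ 785863361 ] ∷
    -[1+ 589996797 ] ∷ + 48347659 ∷ -[1+ 1421428509 ] ∷ + 273317899 ∷ -[1+ 62349998 ] ∷ -[1+ 1109788073 ] ∷ -[1+
    284635991 ] ∷ -[1+ 374512109 ] ∷ -[1+ 11622206 ] ∷ + 636946887 ∷ -[1+ 686060198 ] ∷ + 153282116 ∷ + 22546888 ∷
    + 235874452 ∷ -[1+ 56216550 ] ∷ -[1+ 250592095 ] ∷ -[1+ 40410579 ] ∷ [])) ∷
  (396 , (+ 0 ∷ + 0 ∷ -[1+ 125253390 ] ∷ + 0 ∷ + 0 ∷ + 843497640 ∷ -[1+ 353821702 ] ∷ + 619222613 ∷ -[1+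
    26322030 ] ∷ + 481182974 ∷ + 441625962 ∷ + 839253488 ∷ + 463786585 ∷ + 531203041 ∷ + 708481539 ∷ + 444279845 ∷
    + 609144125 ∷ + 166893818 ∷ -[1+ 378365860 ] ∷ + 259936213 ∷ + 595826366 ∷ -[1+ 643088401 ] ∷ + 137580303 ∷
    -[1+ 492065021 ] ∷ -[1+ 614499889 ] ∷ -[1+ 513109399 ] ∷ -[1+ 817981121 ] ∷ -[1+ 702485059 ] ∷ -[1+ 919743845
    ] ∷ + 75576618 ∷ + 353352656 ∷ -[1+ 311856181 ] ∷ [])) ∷
  (396 , (+ 0 ∷ + 0 ∷ + 25839509 ∷ + 0 ∷ + 0 ∷ + 0 ∷ + 796808504 ∷ + 247100560 ∷ -[1+ 669094091 ] ∷ + 789700204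
    ∷ -[1+ 547606305 ] ∷ + 177911379 ∷ + 382319073 ∷ -[1+ 450826727 ] ∷ -[1+ 36293094 ] ∷ + 485885977 ∷ -[1+
    547936316 ] ∷ + 281265375 ∷ -[1+ 33759788 ] ∷ -[1+ 423015651 ] ∷ -[1+ 116751971 ] ∷ -[1+ 99564974 ] ∷ +
    77248011 ∷ -[1+ 523390717 ] ∷ -[1+ 190346500 ] ∷ + 200503422 ∷ -[1+ 656392133 ] ∷ -[1+ 134121011 ] ∷ +
    102770666 ∷ + 78730226 ∷ + 270920053 ∷ -[1+ 263172929 ] ∷ [])) ∷
  (396 , (+ 0 ∷ + 0 ∷ -[1+ 66721999 ] ∷ + 0 ∷ + 0 ∷ + 0 ∷ + 0 ∷ + 516713594 ∷ -[1+ 226073108 ] ∷ -[1+ 233367745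
    ] ∷ + 518131808 ∷ + 279190637 ∷ + 128524030 ∷ + 336103973 ∷ + 324866159 ∷ + 229606516 ∷ + 257296415 ∷ +
    89818276 ∷ -[1+ 148081938 ] ∷ + 163230785 ∷ -[1+ 433607753 ] ∷ -[1+ 184844692 ] ∷ + 770827935 ∷ + 2363709 ∷
    -[1+ 222360309 ] ∷ -[1+ 284241119 ] ∷ -[1+ 207260837 ] ∷ -[1+ 240768735 ] ∷ -[1+ 282233039 ] ∷ + 448602673 ∷
    -[1+ 429637919 ] ∷ -[1+ 9505025 ] ∷ [])) ∷
  (396 , (+ 0 ∷ + 0 ∷ + 125005418 ∷ + 0 ∷ + 0 ∷ + 0 ∷ + 0 ∷ + 0 ∷ + 510494648 ∷ -[1+ 204317379 ] ∷ + 433592944 ∷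
    + 96108759 ∷ -[1+ 489922218 ] ∷ -[1+ 139358479 ] ∷ -[1+ 414864509 ] ∷ -[1+ 516015371 ] ∷ -[1+ 122346070 ] ∷
    -[1+ 423397309 ] ∷ + 80213944 ∷ -[1+ 145406315 ] ∷ -[1+ 289109341 ] ∷ -[1+ 116711228 ] ∷ -[1+ 145494597 ] ∷
    -[1+ 41730789 ] ∷ -[1+ 89324886 ] ∷ -[1+ 365427127 ] ∷ -[1+ 196400201 ] ∷ -[1+ 41089659 ] ∷ -[1+ 495305765 ] ∷
    + 483710898 ∷ + 253547520 ∷ -[1+ 559852911 ] ∷ [])) ∷
  (396 , (+ 0 ∷ + 0 ∷ -[1+ 3564707 ] ∷ + 0 ∷ + 0 ∷ + 0 ∷ + 0 ∷ + 0 ∷ + 0 ∷ + 115307658 ∷ -[1+ 58134823 ] ∷ -[1+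
    238952468 ] ∷ -[1+ 175020956 ] ∷ + 305368120 ∷ -[1+ 80740426 ] ∷ + 85511808 ∷ + 192649961 ∷ -[1+ 139644168 ] ∷
    + 121640911 ∷ + 357725129 ∷ + 76291577 ∷ + 276699326 ∷ + 194012318 ∷ -[1+ 365700861 ] ∷ + 170804559 ∷ -[1+
    306777755 ] ∷ -[1+ 1836571 ] ∷ + 7268324 ∷ -[1+ 183329489 ] ∷ -[1+ 268541424 ] ∷ + 102969664 ∷ + 114884058 ∷
    [])) ∷
  (396 , (+ 0 ∷ + 0 ∷ -[1+ 6169284 ] ∷ + 0 ∷ + 0 ∷ + 0 ∷ + 0 ∷ + 0 ∷ + 0 ∷ + 0 ∷ + 99566664 ∷ -[1+ 416248854 ] ∷
    + 251454346 ∷ -[1+ 24393051 ] ∷ -[1+ 140647679 ] ∷ + 273035461 ∷ + 211514952 ∷ + 332744481 ∷ + 211895236 ∷ +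
    47146758 ∷ + 269229706 ∷ + 359366673 ∷ + 201632499 ∷ -[1+ 568802631 ] ∷ + 420173209 ∷ -[1+ 602637259 ] ∷ -[1+
    213385307 ] ∷ + 12661226 ∷ -[1+ 109169053 ] ∷ -[1+ 37546881 ] ∷ -[1+ 250874727 ] ∷ + 200124978 ∷ [])) ∷
  (396 , (+ 0 ∷ + 0 ∷ -[1+ 102671191 ] ∷ + 0 ∷ + 0 ∷ + 0 ∷ + 0 ∷ + 0 ∷ + 0 ∷ + 0 ∷ + 0 ∷ + 870061602 ∷ +
    597990489 ∷ + 597954851 ∷ + 1332323700 ∷ + 245044976 ∷ + 245037028 ∷ + 275382247 ∷ -[1+ 634071824 ] ∷ +
    275345350 ∷ -[1+ 161277541 ] ∷ -[1+ 553375979 ] ∷ -[1+ 161286274 ] ∷ + 861062896 ∷ -[1+ 553368124 ] ∷ +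
    861058524 ∷ + 242440200 ∷ -[1+ 363919643 ] ∷ + 242453664 ∷ -[1+ 174923833 ] ∷ -[1+ 174951394 ] ∷ + 261372874 ∷
    [])) ∷
  (396 , (+ 0 ∷ + 0 ∷ -[1+ 80557206 ] ∷ + 0 ∷ + 0 ∷ + 0 ∷ + 0 ∷ + 0 ∷ + 0 ∷ + 0 ∷ + 0 ∷ + 0 ∷ + 880350151 ∷ +
    180918576 ∷ + 1052869383 ∷ + 328757226 ∷ + 159788479 ∷ + 692863170 ∷ -[1+ 483180918 ] ∷ -[1+ 136104549 ] ∷ +
    131691944 ∷ -[1+ 514798946 ] ∷ -[1+ 288171910 ] ∷ + 675257860 ∷ -[1+ 261379901 ] ∷ + 527659746 ∷ + 16704832 ∷
    -[1+ 310967583 ] ∷ + 329730646 ∷ -[1+ 27278763 ] ∷ -[1+ 318863543 ] ∷ + 272643712 ∷ [])) ∷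
  (396 , (+ 0 ∷ + 0 ∷ -[1+ 65387223 ] ∷ + 0 ∷ + 0 ∷ + 0 ∷ + 0 ∷ + 0 ∷ + 0 ∷ + 0 ∷ + 0 ∷ + 0 ∷ + 0 ∷ + 861594099
    ∷ + 854749464 ∷ + 94257451 ∷ + 302400155 ∷ -[1+ 284563620 ] ∷ -[1+ 392248279 ] ∷ + 736589097 ∷ -[1+ 322092745
    ] ∷ -[1+ 158953348 ] ∷ + 195091586 ∷ + 397335649 ∷ -[1+ 471117547 ] ∷ + 579148135 ∷ + 333409992 ∷ -[1+
    252453645 ] ∷ -[1+ 52185729 ] ∷ -[1+ 320123282 ] ∷ + 39089774 ∷ + 221356950 ∷ [])) ∷
  (396 , (+ 0 ∷ + 0 ∷ -[1+ 22825985 ] ∷ + 0 ∷ + 0 ∷ + 0 ∷ + 0 ∷ + 0 ∷ + 0 ∷ + 0 ∷ + 0 ∷ + 0 ∷ + 0 ∷ + 0 ∷ +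
    401585587 ∷ -[1+ 43137713 ] ∷ -[1+ 43136694 ] ∷ -[1+ 44798674 ] ∷ -[1+ 163457339 ] ∷ -[1+ 44790443 ] ∷ -[1+
    123886946 ] ∷ -[1+ 191144916 ] ∷ -[1+ 123867434 ] ∷ + 320275531 ∷ -[1+ 191152710 ] ∷ + 320280385 ∷ + 92991910
    ∷ -[1+ 16831225 ] ∷ + 92988080 ∷ + 14449674 ∷ + 14430094 ∷ -[1+ 60418775 ] ∷ [])) ∷
  (396 , (+ 0 ∷ + 0 ∷ -[1+ 4260355 ] ∷ + 0 ∷ + 0 ∷ + 0 ∷ + 0 ∷ + 0 ∷ + 0 ∷ + 0 ∷ + 0 ∷ + 0 ∷ + 0 ∷ + 0 ∷ + 0 ∷ +
    106879741 ∷ + 6782715 ∷ + 101769170 ∷ + 29583224 ∷ + 9270398 ∷ -[1+ 104234437 ] ∷ -[1+ 40930299 ] ∷ +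
    217165247 ∷ -[1+ 3834655 ] ∷ + 151198844 ∷ -[1+ 183766241 ] ∷ -[1+ 95495015 ] ∷ -[1+ 21344055 ] ∷ + 60898022 ∷
    + 67725983 ∷ -[1+ 137283379 ] ∷ + 67858852 ∷ [])) ∷
  (396 , (+ 0 ∷ + 0 ∷ -[1+ 3999903 ] ∷ + 0 ∷ + 0 ∷ + 0 ∷ + 0 ∷ + 0 ∷ + 0 ∷ + 0 ∷ + 0 ∷ + 0 ∷ + 0 ∷ + 0 ∷ + 0 ∷ +
    0 ∷ + 106662441 ∷ + 2831752 ∷ + 27760313 ∷ + 101370925 ∷ + 224270014 ∷ + 154091830 ∷ -[1+ 118293720 ] ∷ -[1+
    183882843 ] ∷ -[1+ 50617829 ] ∷ + 7839505 ∷ + 67089048 ∷ -[1+ 20031041 ] ∷ -[1+ 99553709 ] ∷ -[1+ 141904444 ]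
    ∷ + 76630782 ∷ + 63680946 ∷ [])) ∷
  (396 , (+ 0 ∷ + 0 ∷ + 29061144 ∷ + 0 ∷ + 0 ∷ + 0 ∷ + 0 ∷ + 0 ∷ + 0 ∷ + 0 ∷ + 0 ∷ + 0 ∷ + 0 ∷ + 0 ∷ + 0 ∷ + 0 ∷
    + 0 ∷ + 142513029 ∷ -[1+ 5939328 ] ∷ -[1+ 12637461 ] ∷ + 109961553 ∷ + 887647 ∷ + 10515195 ∷ -[1+ 56682946 ] ∷
    + 4480156 ∷ -[1+ 62731934 ] ∷ -[1+ 68183313 ] ∷ -[1+ 50057959 ] ∷ -[1+ 44225637 ] ∷ + 12500573 ∷ -[1+ 1431374
    ] ∷ + 27402076 ∷ [])) ∷
  (396 , (+ 0 ∷ + 0 ∷ -[1+ 1286281 ] ∷ + 0 ∷ + 0 ∷ + 0 ∷ + 0 ∷ + 0 ∷ + 0 ∷ + 0 ∷ + 0 ∷ + 0 ∷ + 0 ∷ + 0 ∷ + 0 ∷ +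
    0 ∷ + 0 ∷ + 0 ∷ + 57773360 ∷ -[1+ 15963265 ] ∷ + 15879292 ∷ + 60543040 ∷ + 5614601 ∷ -[1+ 71959247 ] ∷ +
    60922922 ∷ -[1+ 72586572 ] ∷ -[1+ 3674897 ] ∷ + 34662508 ∷ -[1+ 1207905 ] ∷ -[1+ 8957454 ] ∷ -[1+ 10350521 ] ∷
    + 3802938 ∷ [])) ∷
  (396 , (+ 0 ∷ + 0 ∷ + 31809100 ∷ + 0 ∷ + 0 ∷ + 0 ∷ + 0 ∷ + 0 ∷ + 0 ∷ + 0 ∷ + 0 ∷ + 0 ∷ + 0 ∷ + 0 ∷ + 0 ∷ + 0 ∷
    + 0 ∷ + 0 ∷ + 0 ∷ + 141055472 ∷ + 22260340 ∷ + 11451493 ∷ + 112689936 ∷ -[1+ 76593181 ] ∷ + 8179822 ∷ -[1+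
    71091056 ] ∷ -[1+ 51201443 ] ∷ -[1+ 51145269 ] ∷ -[1+ 72983713 ] ∷ -[1+ 1327208 ] ∷ + 11317268 ∷ + 30577370 ∷
    [])) ∷
  (396 , (+ 0 ∷ + 0 ∷ + 4508234 ∷ + 0 ∷ + 0 ∷ + 0 ∷ + 0 ∷ + 0 ∷ + 0 ∷ + 0 ∷ + 0 ∷ + 0 ∷ + 0 ∷ + 0 ∷ + 0 ∷ + 0 ∷
    + 0 ∷ + 0 ∷ + 0 ∷ + 0 ∷ + 136919596 ∷ + 57594738 ∷ -[1+ 91919634 ] ∷ -[1+ 86687989 ] ∷ -[1+ 73240854 ] ∷ +
    60578031 ∷ + 17541798 ∷ -[1+ 19680375 ] ∷ -[1+ 50655363 ] ∷ -[1+ 32348314 ] ∷ + 50481694 ∷ + 2503572 ∷ [])) ∷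
  (396 , (+ 0 ∷ + 0 ∷ -[1+ 4419033 ] ∷ + 0 ∷ + 0 ∷ + 0 ∷ + 0 ∷ + 0 ∷ + 0 ∷ + 0 ∷ + 0 ∷ + 0 ∷ + 0 ∷ + 0 ∷ + 0 ∷ +
    0 ∷ + 0 ∷ + 0 ∷ + 0 ∷ + 0 ∷ + 0 ∷ + 96473680 ∷ -[1+ 49087997 ] ∷ -[1+ 57264593 ] ∷ -[1+ 13883205 ] ∷ +
    37611985 ∷ + 41087430 ∷ + 46223764 ∷ + 4994310 ∷ -[1+ 38455951 ] ∷ -[1+ 7000321 ] ∷ + 2481704 ∷ [])) ∷
  (396 , (+ 0 ∷ + 0 ∷ + 9125994 ∷ + 0 ∷ + 0 ∷ + 0 ∷ + 0 ∷ + 0 ∷ + 0 ∷ + 0 ∷ + 0 ∷ + 0 ∷ + 0 ∷ + 0 ∷ + 0 ∷ + 0 ∷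
    + 0 ∷ + 0 ∷ + 0 ∷ + 0 ∷ + 0 ∷ + 0 ∷ + 88810342 ∷ -[1+ 27949963 ] ∷ + 5299646 ∷ -[1+ 50129723 ] ∷ -[1+ 37200929
    ] ∷ -[1+ 25170245 ] ∷ -[1+ 22594717 ] ∷ + 23080751 ∷ -[1+ 1490802 ] ∷ + 7844670 ∷ [])) ∷
  (396 , (+ 0 ∷ + 0 ∷ + 1969954 ∷ + 0 ∷ + 0 ∷ + 0 ∷ + 0 ∷ + 0 ∷ + 0 ∷ + 0 ∷ + 0 ∷ + 0 ∷ + 0 ∷ + 0 ∷ + 0 ∷ + 0 ∷
    + 0 ∷ + 0 ∷ + 0 ∷ + 0 ∷ + 0 ∷ + 0 ∷ + 0 ∷ + 42130806 ∷ + 2870497 ∷ + 7367827 ∷ + 6085320 ∷ + 11025128 ∷ +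
    6685728 ∷ -[1+ 16557937 ] ∷ -[1+ 13807559 ] ∷ + 10998304 ∷ [])) ∷
  (396 , (+ 0 ∷ + 0 ∷ + 590041 ∷ + 0 ∷ + 0 ∷ + 0 ∷ + 0 ∷ + 0 ∷ + 0 ∷ + 0 ∷ + 0 ∷ + 0 ∷ + 0 ∷ + 0 ∷ + 0 ∷ + 0 ∷ +
    0 ∷ + 0 ∷ + 0 ∷ + 0 ∷ + 0 ∷ + 0 ∷ + 0 ∷ + 0 ∷ + 83857023 ∷ -[1+ 63380447 ] ∷ -[1+ 4790039 ] ∷ + 31341478 ∷ +
    17092276 ∷ -[1+ 8914435 ] ∷ -[1+ 22936289 ] ∷ + 6292552 ∷ [])) ∷
  (396 , (+ 0 ∷ + 0 ∷ + 1535995 ∷ + 0 ∷ + 0 ∷ + 0 ∷ + 0 ∷ + 0 ∷ + 0 ∷ + 0 ∷ + 0 ∷ + 0 ∷ + 0 ∷ + 0 ∷ + 0 ∷ + 0 ∷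
    + 0 ∷ + 0 ∷ + 0 ∷ + 0 ∷ + 0 ∷ + 0 ∷ + 0 ∷ + 0 ∷ + 0 ∷ + 41016452 ∷ + 4818464 ∷ + 7899642 ∷ + 4997878 ∷ -[1+
    9558280 ] ∷ -[1+ 13682968 ] ∷ + 8564842 ∷ [])) ∷
  (396 , (+ 0 ∷ + 0 ∷ -[1+ 15409176 ] ∷ + 0 ∷ + 0 ∷ + 0 ∷ + 0 ∷ + 0 ∷ + 0 ∷ + 0 ∷ + 0 ∷ + 0 ∷ + 0 ∷ + 0 ∷ + 0 ∷
    + 0 ∷ + 0 ∷ + 0 ∷ + 0 ∷ + 0 ∷ + 0 ∷ + 0 ∷ + 0 ∷ + 0 ∷ + 0 ∷ + 0 ∷ + 31764798 ∷ + 12712422 ∷ + 16244830 ∷ -[1+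
    11311555 ] ∷ -[1+ 687967 ] ∷ -[1+ 1968215 ] ∷ [])) ∷
  (396 , (+ 0 ∷ + 0 ∷ + 958927 ∷ + 0 ∷ + 0 ∷ + 0 ∷ + 0 ∷ + 0 ∷ + 0 ∷ + 0 ∷ + 0 ∷ + 0 ∷ + 0 ∷ + 0 ∷ + 0 ∷ + 0 ∷ +
    0 ∷ + 0 ∷ + 0 ∷ + 0 ∷ + 0 ∷ + 0 ∷ + 0 ∷ + 0 ∷ + 0 ∷ + 0 ∷ + 0 ∷ + 22305000 ∷ + 8847278 ∷ -[1+ 4737912 ] ∷ -[1+
    10777953 ] ∷ -[1+ 679465 ] ∷ [])) ∷
  (396 , (+ 0 ∷ + 0 ∷ -[1+ 9250027 ] ∷ + 0 ∷ + 0 ∷ + 0 ∷ + 0 ∷ + 0 ∷ + 0 ∷ + 0 ∷ + 0 ∷ + 0 ∷ + 0 ∷ + 0 ∷ + 0 ∷ +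
    0 ∷ + 0 ∷ + 0 ∷ + 0 ∷ + 0 ∷ + 0 ∷ + 0 ∷ + 0 ∷ + 0 ∷ + 0 ∷ + 0 ∷ + 0 ∷ + 0 ∷ + 25301422 ∷ + 8145530 ∷ -[1+
    10078153 ] ∷ -[1+ 978705 ] ∷ [])) ∷
  (396 , (+ 0 ∷ + 0 ∷ -[1+ 2053451 ] ∷ + 0 ∷ + 0 ∷ + 0 ∷ + 0 ∷ + 0 ∷ + 0 ∷ + 0 ∷ + 0 ∷ + 0 ∷ + 0 ∷ + 0 ∷ + 0 ∷ +
    0 ∷ + 0 ∷ + 0 ∷ + 0 ∷ + 0 ∷ + 0 ∷ + 0 ∷ + 0 ∷ + 0 ∷ + 0 ∷ + 0 ∷ + 0 ∷ + 0 ∷ + 0 ∷ + 10306137 ∷ + 3200202 ∷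
    -[1+ 7635257 ] ∷ [])) ∷
  (396 , (+ 0 ∷ + 0 ∷ -[1+ 1328994 ] ∷ + 0 ∷ + 0 ∷ + 0 ∷ + 0 ∷ + 0 ∷ + 0 ∷ + 0 ∷ + 0 ∷ + 0 ∷ + 0 ∷ + 0 ∷ + 0 ∷ +
    0 ∷ + 0 ∷ + 0 ∷ + 0 ∷ + 0 ∷ + 0 ∷ + 0 ∷ + 0 ∷ + 0 ∷ + 0 ∷ + 0 ∷ + 0 ∷ + 0 ∷ + 0 ∷ + 0 ∷ + 9939577 ∷ -[1+
    5740387 ] ∷ [])) ∷
  (396 , (+ 0 ∷ + 0 ∷ -[1+ 4535096 ] ∷ + 0 ∷ + 0 ∷ + 0 ∷ + 0 ∷ + 0 ∷ + 0 ∷ + 0 ∷ + 0 ∷ + 0 ∷ + 0 ∷ + 0 ∷ + 0 ∷ +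
    0 ∷ + 0 ∷ + 0 ∷ + 0 ∷ + 0 ∷ + 0 ∷ + 0 ∷ + 0 ∷ + 0 ∷ + 0 ∷ + 0 ∷ + 0 ∷ + 0 ∷ + 0 ∷ + 0 ∷ + 0 ∷ + 3023398 ∷ []))
    ∷
  (2514812978012447 , (+ 0 ∷ + 0 ∷ -[1+ 0 ] ∷ + 0 ∷ + 0 ∷ + 0 ∷ + 0 ∷ + 0 ∷ + 0 ∷ + 0 ∷ + 0 ∷ + 0 ∷ + 0 ∷ + 0 ∷
    + 0 ∷ + 0 ∷ + 0 ∷ + 0 ∷ + 0 ∷ + 0 ∷ + 0 ∷ + 0 ∷ + 0 ∷ + 0 ∷ + 0 ∷ + 0 ∷ + 0 ∷ + 0 ∷ + 2 ∷ [])) ∷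
  (1292100829343012 , (+ 0 ∷ + 0 ∷ -[1+ 0 ] ∷ + 0 ∷ + 0 ∷ + 0 ∷ + 0 ∷ + 0 ∷ + 0 ∷ + 0 ∷ + 0 ∷ + 0 ∷ + 0 ∷ + 0 ∷
    + 0 ∷ + 0 ∷ + 0 ∷ + 0 ∷ + 0 ∷ + 0 ∷ + 0 ∷ + 0 ∷ + 0 ∷ + 0 ∷ + 0 ∷ + 0 ∷ + 0 ∷ + 0 ∷ + 0 ∷ + 1 ∷ [])) ∷
  (893318081345611 , (+ 0 ∷ + 0 ∷ -[1+ 0 ] ∷ + 0 ∷ + 0 ∷ + 0 ∷ + 0 ∷ + 0 ∷ + 0 ∷ + 0 ∷ + 0 ∷ + 0 ∷ + 0 ∷ + 0 ∷ +
    0 ∷ + 0 ∷ + 0 ∷ + 0 ∷ + 0 ∷ + 0 ∷ + 0 ∷ + 0 ∷ + 0 ∷ + 0 ∷ + 0 ∷ + 0 ∷ + 0 ∷ + 2 ∷ [])) ∷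
  (282729247893378 , (+ 0 ∷ + 0 ∷ -[1+ 2 ] ∷ + 0 ∷ + 0 ∷ + 0 ∷ + 0 ∷ + 0 ∷ + 0 ∷ + 0 ∷ + 2 ∷ [])) ∷
  []

-- In this and the other four-root lists entry `i` belongs to the further vertices whose adjacencies
-- to the roots have binary code `i`. Here the entries 3, 7 and 11 are zero because the roots carry
-- the edge `ab`, and a common neighbour of `a` and `b` would close a triangle.
edgeSquares₁ : List Square
edgeSquares₁ =
  (396 , (+ 799574507 ∷ -[1+ 85151075 ] ∷ -[1+ 85151075 ] ∷ + 0 ∷ + 1096948396 ∷ -[1+ 180480351 ] ∷ -[1+
    180480351 ] ∷ + 0 ∷ + 176460076 ∷ -[1+ 1016206869 ] ∷ -[1+ 1016206869 ] ∷ + 0 ∷ + 180526521 ∷ -[1+ 1325968981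
    ] ∷ -[1+ 1325968981 ] ∷ [])) ∷
  (396 , (+ 0 ∷ + 630367163 ∷ -[1+ 234267181 ] ∷ + 0 ∷ + 609885402 ∷ -[1+ 267590138 ] ∷ + 97520836 ∷ + 0 ∷ -[1+
    775143585 ] ∷ -[1+ 145315853 ] ∷ -[1+ 467484723 ] ∷ + 0 ∷ + 73360849 ∷ + 149302204 ∷ + 957383677 ∷ [])) ∷
  (396 , (+ 0 ∷ + 0 ∷ + 585219316 ∷ + 0 ∷ + 901077341 ∷ -[1+ 2073846 ] ∷ -[1+ 249195645 ] ∷ + 0 ∷ -[1+
    1145238627 ] ∷ -[1+ 561720615 ] ∷ -[1+ 343663760 ] ∷ + 0 ∷ + 108387246 ∷ + 1091009510 ∷ + 544067454 ∷ [])) ∷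
  (396 , (+ 0 ∷ + 0 ∷ + 0 ∷ + 0 ∷ + 138829048 ∷ -[1+ 302481640 ] ∷ -[1+ 302481640 ] ∷ + 0 ∷ + 1568548906 ∷ -[1+
    398904795 ] ∷ -[1+ 398904795 ] ∷ + 0 ∷ + 665821204 ∷ -[1+ 1732440242 ] ∷ -[1+ 1732440242 ] ∷ [])) ∷
  (396 , (+ 0 ∷ + 0 ∷ + 0 ∷ + 0 ∷ + 511498787 ∷ -[1+ 161404794 ] ∷ -[1+ 161404794 ] ∷ + 0 ∷ + 0 ∷ -[1+ 251471489
    ] ∷ -[1+ 251471489 ] ∷ + 0 ∷ -[1+ 479519218 ] ∷ + 79536621 ∷ + 79536621 ∷ [])) ∷
  (396 , (+ 0 ∷ + 0 ∷ + 0 ∷ + 0 ∷ + 0 ∷ + 3194480 ∷ + 3194480 ∷ + 0 ∷ + 0 ∷ -[1+ 523950 ] ∷ -[1+ 523950 ] ∷ + 0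
    ∷ + 225199509 ∷ -[1+ 9264814 ] ∷ -[1+ 9264814 ] ∷ [])) ∷
  (396 , (+ 0 ∷ + 0 ∷ + 0 ∷ + 0 ∷ + 0 ∷ -[1+ 974699584 ] ∷ + 974648694 ∷ + 0 ∷ + 0 ∷ -[1+ 240545383 ] ∷ +
    242897546 ∷ + 0 ∷ + 0 ∷ + 1454418583 ∷ -[1+ 1454447236 ] ∷ [])) ∷
  (396 , (+ 0 ∷ + 0 ∷ + 0 ∷ + 0 ∷ + 0 ∷ + 67621364 ∷ -[1+ 68350953 ] ∷ + 0 ∷ + 0 ∷ + 33721453 ∷ + 0 ∷ + 0 ∷ + 0
    ∷ -[1+ 101656028 ] ∷ + 101245235 ∷ [])) ∷
  (396 , (+ 0 ∷ + 0 ∷ + 0 ∷ + 0 ∷ + 0 ∷ -[1+ 119532001 ] ∷ + 132463284 ∷ + 0 ∷ + 0 ∷ + 0 ∷ + 0 ∷ + 0 ∷ + 0 ∷ +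
    174710970 ∷ -[1+ 183284836 ] ∷ [])) ∷
  (396 , (+ 0 ∷ + 0 ∷ + 0 ∷ + 0 ∷ + 0 ∷ + 57084342 ∷ + 0 ∷ + 0 ∷ + 0 ∷ + 0 ∷ + 0 ∷ + 0 ∷ + 0 ∷ -[1+ 59472689 ] ∷
    + 21623887 ∷ [])) ∷
  (396 , (+ 0 ∷ + 0 ∷ + 0 ∷ + 0 ∷ + 0 ∷ + 0 ∷ + 0 ∷ + 0 ∷ + 0 ∷ + 0 ∷ + 0 ∷ + 0 ∷ + 0 ∷ -[1+ 46087100 ] ∷ +
    54142573 ∷ [])) ∷
  (396 , (+ 0 ∷ + 0 ∷ + 0 ∷ + 0 ∷ + 0 ∷ + 0 ∷ + 0 ∷ + 0 ∷ + 0 ∷ + 0 ∷ + 0 ∷ + 0 ∷ + 0 ∷ + 28414738 ∷ [])) ∷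
  []

edgeSquares₂ : List Square
edgeSquares₂ =
  (396 , (-[1+ 3646568 ] ∷ -[1+ 4612844 ] ∷ + 8259414 ∷ + 0 ∷ + 12700406 ∷ + 593226589 ∷ -[1+ 589580019 ] ∷ + 0
    ∷ + 12700406 ∷ + 593226589 ∷ -[1+ 589580019 ] ∷ + 0 ∷ + 3853400 ∷ -[1+ 727851629 ] ∷ + 731498199 ∷ [])) ∷
  (396 , (-[1+ 807378 ] ∷ + 807379 ∷ + 0 ∷ + 0 ∷ -[1+ 191998182 ] ∷ -[1+ 36726482 ] ∷ + 37533862 ∷ + 0 ∷ +
    202656167 ∷ -[1+ 36726482 ] ∷ + 37533862 ∷ + 0 ∷ + 254983 ∷ + 46214823 ∷ -[1+ 45407443 ] ∷ [])) ∷
  (396 , (-[1+ 4913022 ] ∷ + 4913023 ∷ + 0 ∷ + 0 ∷ + 64855376 ∷ -[1+ 223485966 ] ∷ + 228398990 ∷ + 0 ∷ + 0 ∷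
    -[1+ 223485966 ] ∷ + 228398990 ∷ + 0 ∷ + 1551606 ∷ + 281223889 ∷ -[1+ 276310865 ] ∷ [])) ∷
  (396 , (-[1+ 2361396 ] ∷ + 2361397 ∷ + 0 ∷ + 0 ∷ + 0 ∷ -[1+ 107416368 ] ∷ + 109777766 ∷ + 0 ∷ + 0 ∷ -[1+
    107416368 ] ∷ + 109777766 ∷ + 0 ∷ + 17707638 ∷ + 135167543 ∷ -[1+ 132806145 ] ∷ [])) ∷
  (396 , (+ 1015011 ∷ -[1+ 1015010 ] ∷ + 0 ∷ + 0 ∷ + 0 ∷ + 744466484 ∷ -[1+ 745481494 ] ∷ + 0 ∷ + 0 ∷ +
    744534200 ∷ -[1+ 745549210 ] ∷ + 0 ∷ + 0 ∷ -[1+ 916399935 ] ∷ + 915384925 ∷ [])) ∷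
  (396 , (+ 7186 ∷ -[1+ 7185 ] ∷ + 0 ∷ + 0 ∷ + 0 ∷ + 9564266 ∷ -[1+ 9571451 ] ∷ + 0 ∷ + 0 ∷ + 0 ∷ -[1+ 7185 ] ∷
    + 0 ∷ + 0 ∷ -[1+ 6488208 ] ∷ + 6481023 ∷ [])) ∷
  (396 , (+ 658213 ∷ -[1+ 658212 ] ∷ + 0 ∷ + 0 ∷ + 0 ∷ + 0 ∷ -[1+ 658212 ] ∷ + 0 ∷ + 0 ∷ + 0 ∷ -[1+ 658212 ] ∷ +
    0 ∷ + 0 ∷ -[1+ 10916886 ] ∷ + 10258674 ∷ [])) ∷
  (396 , (-[1+ 3406971 ] ∷ + 3406972 ∷ + 0 ∷ + 0 ∷ + 0 ∷ + 0 ∷ + 3406972 ∷ + 0 ∷ + 0 ∷ + 0 ∷ + 3406972 ∷ + 0 ∷ +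
    0 ∷ + 3406972 ∷ [])) ∷
  (3656818132806561 , (+ 0 ∷ + 0 ∷ + 0 ∷ + 0 ∷ + 0 ∷ + 1 ∷ -[1+ 0 ] ∷ [])) ∷
  (1566805829325309 , (+ 0 ∷ -[1+ 0 ] ∷ + 1 ∷ [])) ∷
  (704389002875669 , (-[1+ 0 ] ∷ + 1 ∷ + 0 ∷ + 0 ∷ + 0 ∷ + 0 ∷ + 1 ∷ + 0 ∷ + 0 ∷ + 0 ∷ + 1 ∷ + 0 ∷ + 0 ∷ + 1 ∷
    [])) ∷
  (716729761347578 , (-[1+ 0 ] ∷ + 1 ∷ + 0 ∷ + 0 ∷ + 0 ∷ + 0 ∷ + 1 ∷ + 0 ∷ + 0 ∷ + 0 ∷ + 1 ∷ + 0 ∷ + 0 ∷ + 0 ∷ +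
    1 ∷ [])) ∷
  []

pathSquares₀ : List Square
pathSquares₀ =
  (396 , (+ 236270544 ∷ + 277100889 ∷ -[1+ 1015438960 ] ∷ + 0 ∷ -[1+ 1015438960 ] ∷ + 0 ∷ + 135755078 ∷ + 0 ∷
    -[1+ 262191727 ] ∷ -[1+ 1142673293 ] ∷ + 1486392226 ∷ + 0 ∷ + 1486392226 ∷ + 0 ∷ -[1+ 1082670815 ] ∷ [])) ∷
  (396 , (+ 0 ∷ -[1+ 31267397 ] ∷ + 16288422 ∷ + 0 ∷ + 16288422 ∷ + 0 ∷ -[1+ 25215033 ] ∷ + 0 ∷ + 55367690 ∷
    -[1+ 14015265 ] ∷ + 29871921 ∷ + 0 ∷ + 29871921 ∷ + 0 ∷ + 22661123 ∷ [])) ∷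
  (396 , (+ 0 ∷ -[1+ 1525896 ] ∷ -[1+ 1358200948 ] ∷ + 0 ∷ + 1372622141 ∷ + 0 ∷ -[1+ 532351 ] ∷ + 0 ∷ + 0 ∷ +
    6844887 ∷ + 1422359121 ∷ + 0 ∷ -[1+ 1444595896 ] ∷ + 0 ∷ + 6208236 ∷ [])) ∷
  (396 , (+ 0 ∷ -[1+ 20997689 ] ∷ + 198448292 ∷ + 0 ∷ + 0 ∷ + 0 ∷ -[1+ 7325633 ] ∷ + 0 ∷ + 0 ∷ + 94191669 ∷ -[1+
    257169279 ] ∷ + 0 ∷ -[1+ 48828311 ] ∷ + 0 ∷ + 85430785 ∷ [])) ∷
  (396 , (+ 0 ∷ + 13366975 ∷ + 0 ∷ + 0 ∷ + 0 ∷ + 0 ∷ -[1+ 13081197 ] ∷ + 0 ∷ + 0 ∷ + 8405955 ∷ -[1+ 14745559 ] ∷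
    + 0 ∷ -[1+ 14745559 ] ∷ + 0 ∷ -[1+ 8163457 ] ∷ [])) ∷
  (396 , (+ 0 ∷ + 0 ∷ + 0 ∷ + 0 ∷ + 0 ∷ + 0 ∷ -[1+ 6159583 ] ∷ + 0 ∷ + 0 ∷ + 35168749 ∷ -[1+ 26011839 ] ∷ + 0 ∷
    -[1+ 26011839 ] ∷ + 0 ∷ + 9734326 ∷ [])) ∷
  (396 , (+ 0 ∷ + 0 ∷ + 0 ∷ + 0 ∷ + 0 ∷ + 0 ∷ -[1+ 1106435 ] ∷ + 0 ∷ + 0 ∷ + 0 ∷ + 52588278 ∷ + 0 ∷ -[1+
    37991424 ] ∷ + 0 ∷ -[1+ 3610177 ] ∷ [])) ∷
  (396 , (+ 0 ∷ + 0 ∷ + 0 ∷ + 0 ∷ + 0 ∷ + 0 ∷ -[1+ 2756208 ] ∷ + 0 ∷ + 0 ∷ + 0 ∷ + 0 ∷ + 0 ∷ + 36361773 ∷ + 0 ∷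
    -[1+ 8993203 ] ∷ [])) ∷
  (396 , (+ 0 ∷ + 0 ∷ + 0 ∷ + 0 ∷ + 0 ∷ + 0 ∷ + 13561970 ∷ + 0 ∷ + 0 ∷ + 0 ∷ + 0 ∷ + 0 ∷ + 0 ∷ + 0 ∷ -[1+
    11246529 ] ∷ [])) ∷
  (396 , (+ 0 ∷ + 0 ∷ + 0 ∷ + 0 ∷ + 0 ∷ + 0 ∷ + 0 ∷ + 0 ∷ + 0 ∷ + 0 ∷ + 0 ∷ + 0 ∷ + 0 ∷ + 0 ∷ + 24462000 ∷ []))
    ∷
  []

pathSquares₁ : List Square
pathSquares₁ =
  (396 , (+ 1218638341 ∷ + 86992222 ∷ + 465083400 ∷ + 0 ∷ -[1+ 1248501049 ] ∷ -[1+ 43269271 ] ∷ -[1+ 926105413 ]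
    ∷ + 0 ∷ -[1+ 166999446 ] ∷ + 0 ∷ + 78871442 ∷ + 0 ∷ -[1+ 1915289805 ] ∷ + 0 ∷ -[1+ 1595048880 ] ∷ [])) ∷
  (396 , (+ 0 ∷ -[1+ 1102263882 ] ∷ + 165624434 ∷ + 0 ∷ + 2365164030 ∷ -[1+ 810365362 ] ∷ + 1392636907 ∷ + 0 ∷ +
    77065842 ∷ + 0 ∷ -[1+ 172328649 ] ∷ + 0 ∷ + 1390920226 ∷ + 0 ∷ + 166902573 ∷ [])) ∷
  (396 , (+ 0 ∷ + 214092577 ∷ + 1094278953 ∷ + 0 ∷ + 0 ∷ + 711553902 ∷ -[1+ 2205185451 ] ∷ + 0 ∷ + 854028351 ∷ +
    0 ∷ -[1+ 622991561 ] ∷ + 0 ∷ + 604803494 ∷ + 0 ∷ + 1293630290 ∷ [])) ∷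
  (396 , (+ 0 ∷ -[1+ 360898099 ] ∷ + 2022810237 ∷ + 0 ∷ + 0 ∷ + 239258033 ∷ -[1+ 1705203930 ] ∷ + 0 ∷ + 0 ∷ + 0
    ∷ + 1397976110 ∷ + 0 ∷ -[1+ 680971475 ] ∷ + 0 ∷ + 1342585283 ∷ [])) ∷
  (396 , (+ 0 ∷ + 532920763 ∷ + 0 ∷ + 0 ∷ + 0 ∷ -[1+ 1827965558 ] ∷ + 550296853 ∷ + 0 ∷ + 0 ∷ + 0 ∷ -[1+
    430243749 ] ∷ + 0 ∷ + 1630302509 ∷ + 0 ∷ -[1+ 28185740 ] ∷ [])) ∷
  (396 , (+ 0 ∷ + 0 ∷ + 0 ∷ + 0 ∷ + 0 ∷ + 417149084 ∷ -[1+ 279000924 ] ∷ + 0 ∷ + 0 ∷ + 0 ∷ + 16498753 ∷ + 0 ∷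
    -[1+ 313931546 ] ∷ + 0 ∷ + 61473591 ∷ [])) ∷
  (396 , (+ 0 ∷ + 0 ∷ + 0 ∷ + 0 ∷ + 0 ∷ + 0 ∷ -[1+ 7115806 ] ∷ + 0 ∷ + 0 ∷ + 0 ∷ -[1+ 35230407 ] ∷ + 0 ∷ +
    100959484 ∷ + 0 ∷ + 45121931 ∷ [])) ∷
  (396 , (+ 0 ∷ + 0 ∷ + 0 ∷ + 0 ∷ + 0 ∷ + 0 ∷ + 54643352 ∷ + 0 ∷ + 0 ∷ + 0 ∷ -[1+ 45586962 ] ∷ + 0 ∷ + 0 ∷ + 0 ∷
    -[1+ 44510332 ] ∷ [])) ∷
  (396 , (+ 0 ∷ + 0 ∷ + 0 ∷ + 0 ∷ + 0 ∷ + 0 ∷ + 0 ∷ + 0 ∷ + 0 ∷ + 0 ∷ + 40896565 ∷ + 0 ∷ + 0 ∷ + 0 ∷ -[1+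
    39502988 ] ∷ [])) ∷
  (396 , (+ 0 ∷ + 0 ∷ + 0 ∷ + 0 ∷ + 0 ∷ + 0 ∷ + 0 ∷ + 0 ∷ + 0 ∷ + 0 ∷ + 0 ∷ + 0 ∷ + 0 ∷ + 0 ∷ + 52168309 ∷ []))
    ∷
  []

starSquares : List Square
starSquares =
  (396 , (-[1+ 139626181 ] ∷ + 102340343 ∷ -[1+ 637972885 ] ∷ + 0 ∷ -[1+ 637972885 ] ∷ + 0 ∷ + 535632543 ∷ + 0 ∷
    -[1+ 637972885 ] ∷ + 0 ∷ + 535632543 ∷ + 0 ∷ + 535632543 ∷ + 0 ∷ + 37285839 ∷ [])) ∷
  (396 , (-[1+ 8308408 ] ∷ + 0 ∷ -[1+ 50496105 ] ∷ + 0 ∷ -[1+ 51964256 ] ∷ + 0 ∷ + 50496106 ∷ + 0 ∷ -[1+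
    50496105 ] ∷ + 0 ∷ + 51964257 ∷ + 0 ∷ + 50496106 ∷ + 0 ∷ + 8308409 ∷ [])) ∷
  (396 , (-[1+ 1062960 ] ∷ + 0 ∷ -[1+ 6460371 ] ∷ + 0 ∷ + 0 ∷ + 0 ∷ + 11475486 ∷ + 0 ∷ -[1+ 11475485 ] ∷ + 0 ∷ +
    0 ∷ + 0 ∷ + 6460372 ∷ + 0 ∷ + 1062961 ∷ [])) ∷
  (396 , (-[1+ 511330 ] ∷ + 0 ∷ -[1+ 10425491 ] ∷ + 0 ∷ + 0 ∷ + 0 ∷ + 0 ∷ + 0 ∷ + 0 ∷ + 0 ∷ + 0 ∷ + 0 ∷ +
    10425492 ∷ + 0 ∷ + 511331 ∷ [])) ∷
  (396 , (-[1+ 4121746 ] ∷ + 0 ∷ + 0 ∷ + 0 ∷ + 0 ∷ + 0 ∷ + 0 ∷ + 0 ∷ + 0 ∷ + 0 ∷ + 0 ∷ + 0 ∷ + 0 ∷ + 0 ∷ +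
    4121747 ∷ [])) ∷
  (7405374828801567 , (+ 0 ∷ + 0 ∷ + 0 ∷ + 0 ∷ + 0 ∷ + 0 ∷ + 1 ∷ + 0 ∷ -[1+ 0 ] ∷ [])) ∷
  (3673640247905365 , (-[1+ 0 ] ∷ + 1 ∷ -[1+ 0 ] ∷ + 0 ∷ -[1+ 0 ] ∷ + 0 ∷ + 0 ∷ + 0 ∷ -[1+ 0 ] ∷ [])) ∷
  (1506516839272280 , (-[1+ 0 ] ∷ + 0 ∷ + 0 ∷ + 0 ∷ + 0 ∷ + 0 ∷ + 0 ∷ + 0 ∷ + 0 ∷ + 0 ∷ + 0 ∷ + 0 ∷ + 0 ∷ + 0 ∷
    + 1 ∷ [])) ∷
  []

-- Squares on four roots: the code of L on the roots, the code of the marked triples among them, and the squares, whose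
-- coefficients are indexed by the neighbourhood of a further vertex.
quadBlocks : List (ℕ × ℕ × List Square)
quadBlocks =
    (1 , 1 , edgeSquares₁) ∷
    (1 , 3 , edgeSquares₂) ∷
    (3 , 0 , pathSquares₀) ∷
    (5 , 1 , pathSquares₁) ∷
    (7 , 0 , starSquares) ∷ []

opaque
  -- The certificate is integral: its squares are added to `scale` times the indicator of a marked
  -- triple. Opacity hides the numeral from every symbolic step.
  scale : ℕ
  scale = 39600000000000000000

  instance
    scale-nonZero : ℕ.NonZero scale
    scale-nonZero = _

-- Gram tables, flag indices and orderings of six vertices.

nth : {A : Set} → A → List A → ℕ → A
nth d []       _       = d
nth d (x ∷ _)  zero    = x
nth d (_ ∷ xs) (suc i) = nth d xs i

addRow : List ℤ → List ℤ → List ℤ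
addRow []       ys       = ys
addRow (x ∷ xs) []       = x ∷ xs
addRow (x ∷ xs) (y ∷ ys) = (x ℤ.+ y) ∷ addRow xs ys

addTable : List (List ℤ) → List (List ℤ) → List (List ℤ)
addTable []       ys       = ys
addTable (x ∷ xs) []       = x ∷ xs
addTable (x ∷ xs) (y ∷ ys) = addRow x y ∷ addTable xs ys

outer : ℕ → List ℤ → List (List ℤ)
outer c v = map (λ x → map (λ y → (+ c ℤ.* x) ℤ.* y) v) v

gram : List Square → List (List ℤ)
gram []             = []
gram ((c , v) ∷ rs) = addTable (outer c v) (gram rs)

entry : List (List ℤ) → ℕ → ℕ → ℤ
entry T i j = nth 0ℤ (nth [] T i) j

bit : Bool → ℕ
bit b = if b then 1 else 0

value : ∀ {k} → Vec Bool k → ℕ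
value []       = 0
value (b ∷ bs) = bit b ℕ.+ 2 ℕ.* value bs

-- A code that is not listed gets the length of the list, a position past all coefficients, where
-- `nth` reads 0.
position : ℕ → List ℕ → ℕ
position x []       = 0
position x (y ∷ ys) = if x ≡ᵇ y then 0 else suc (position x ys)

swapBits : Vec Bool 9 → Vec Bool 9
swapBits (pa ∷ pb ∷ qa ∷ qb ∷ ab ∷ pqa ∷ pqb ∷ pab ∷ qab ∷ []) =
  pb ∷ pa ∷ qb ∷ qa ∷ ab ∷ pqb ∷ pqa ∷ pab ∷ qab ∷ []

pairFlag : Bool → Vec Bool 9 → ℕ
pairFlag e bs = position (value bs ℕ.⊓ value (swapBits bs)) (pairFlags e)

select : {A : Set} → A → A → Bool → A
select x y b = if b then y else x

pairSquares : Bool → List Square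
pairSquares = select nonedgeSquares edgeSquares

Block : Set
Block = ℕ × ℕ × List (List ℤ)

tabulateBlock : ℕ × ℕ × List Square → Block
tabulateBlock (r , s , sq) = r , s , gram sq

-- Complete binary trees indexed by Boolean vectors. Splitting 9 as `5 + 4` lets the five
-- adjacencies, which are known for a given graph, select a subtree by `_at_`, while the four marked
-- triples stay undecided and become branchings.
Trie : ℕ → Set
Trie zero    = ℕ
Trie (suc k) = Trie k × Trie k

tabulateᵗ : ∀ {k} → (Vec Bool k → ℕ) → Trie k
tabulateᵗ {zero}  f = f []
tabulateᵗ {suc k} f = tabulateᵗ (f ∘ (false ∷_)) , tabulateᵗ (f ∘ (true ∷_))

_at_ : ∀ {k m} → Trie (k ℕ.+ m) → Vec Bool k → Trie m
t at []               = t
(lo , hi) at (b ∷ bs) = (if b then hi else lo) at bs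

-- Insertion (Lehmer) codes of permutations: the head says where the first entry goes once the
-- remaining ones are arranged.
Code : ℕ → Set
Code zero    = ⊤
Code (suc k) = Fin (suc k) × Code k

permute : ∀ {A : Set} {k} → Code k → Vec A k → Vec A k
permute {k = zero}  _       []       = []
permute {k = suc k} (i , c) (x ∷ xs) = insertAt (permute c xs) i x

allCodes : ∀ k → List (Code k)
allCodes zero    = tt ∷ []
allCodes (suc k) = concatMap (λ i → map (i ,_) (allCodes k)) (allFin (suc k))

Tuple : Set
Tuple = Vec (Fin 6) 6

tuple : Code 6 → Tuple
tuple c = permute c (Vec.allFin 6)

lt : Fin 6 → Fin 6 → Bool
lt i j = toℕ i <ᵇ toℕ j

-- Each condition picks one tuple from every orbit of the exchanges that leave the corresponding
-- term unchanged. Of the 720 orderings there remain 90, 360, 90, 60 and 60 respectively.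
pairOrder quadOrder codegOrder k4Order f32Order : Tuple → Bool
pairOrder  (p ∷ q ∷ a ∷ b ∷ c ∷ d ∷ []) = lt a b ∧ lt c d ∧ lt a c
quadOrder  (p ∷ q ∷ a ∷ b ∷ c ∷ d ∷ []) = lt c d
codegOrder (p ∷ q ∷ a ∷ b ∷ c ∷ d ∷ []) = lt p q ∧ lt a b ∧ lt c d
k4Order    (p ∷ q ∷ a ∷ b ∷ c ∷ d ∷ []) = lt q a ∧ lt a b ∧ lt c d
f32Order   (p ∷ q ∷ a ∷ b ∷ c ∷ d ∷ []) = lt p q ∧ lt a b ∧ lt b c

tuplesBy : (Tuple → Bool) → List Tuple
tuplesBy ok = filterᵇ ok (map tuple (allCodes 6))

-- Decision trees over the marked triples, with increasing variables; a dead leaf is a forbidden configuration.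
data Tree (A : Set) : Set where
  dead : Tree A
  leaf : A → Tree A
  node : ℕ → Tree A → Tree A → Tree A

mapTree : {A B : Set} → (A → B) → Tree A → Tree B
mapTree f dead         = dead
mapTree f (leaf a)     = leaf (f a)
mapTree f (node v l h) = node v (mapTree f l) (mapTree f h)

zipTree : {A B C : Set} → (A → B → C) → Tree A → Tree B → Tree C
zipNode : {A B C : Set} → (A → B → C) → ℕ → Tree A → Tree A → Tree B → Tree C
zipTree f dead         _ = dead
zipTree f (leaf a)     y = mapTree (f a) y
zipTree f (node v l h) y = zipNode f v l h y
zipNode f v l h dead     = dead
zipNode f v l h (leaf b) = node v (mapTree (λ a → f a b) l) (mapTree (λ a → f a b) h)
zipNode f v l h (node w l′ h′) =
  if v <ᵇ w then node v (zipTree f l (node w l′ h′)) (zipTree f h (node w l′ h′))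
  else if w <ᵇ v then node w (zipNode f v l h l′) (zipNode f v l h h′)
  else node v (zipTree f l l′) (zipTree f h h′)

everyLeaf : {A : Set} → (A → Bool) → Tree A → Bool
everyLeaf ok dead         = true
everyLeaf ok (leaf a)     = ok a
everyLeaf ok (node v l h) = everyLeaf ok l ∧ everyLeaf ok h

-- Plain `node v lo hi` would break the increasing order of variables when `lo` or `hi` tests a
-- smaller one; merging with a one-variable tree preserves it.
choose : {A : Set} → ℕ → Tree A → Tree A → Tree A
choose v lo hi = zipTree (λ b (x , y) → if b then y else x) (node v (leaf false) (leaf true)) (zipTree _,_ lo hi)

-- Adding neighbours in rounds keeps most intermediate trees small, whereas a fold would carry one
-- large tree through every addition.
addPairs : List (Tree ℤ) → List (Tree ℤ)
addPairs (x ∷ y ∷ xs) = zipTree ℤ._+_ x y ∷ addPairs xs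
addPairs xs           = xs

addTrees : ℕ → List (Tree ℤ) → Tree ℤ
addTrees zero    xs = foldr (zipTree ℤ._+_) (leaf 0ℤ) xs
addTrees (suc k) xs = addTrees k (addPairs xs)

-- Trees of the summands for a fixed graph on six vertices.

Graph : Set
Graph = Fin 6 → Fin 6 → Bool

-- Sorting makes the six orders of a triple share one variable; base 6 keeps the code readable by
-- `decode`.
var : Fin 6 → Fin 6 → Fin 6 → ℕ
var i j k = sort₃ (toℕ i) (toℕ j) (toℕ k)
  where
  key : ℕ → ℕ → ℕ → ℕ
  key a b c = (a ℕ.* 6 ℕ.+ b) ℕ.* 6 ℕ.+ c
  sort₃ : ℕ → ℕ → ℕ → ℕ
  sort₃ a b c =
    if a <ᵇ b
    then (if b <ᵇ c then key a b c else if a <ᵇ c then key a c b else key c a b)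
    else (if a <ᵇ c then key b a c else if b <ᵇ c then key b c a else key c b a)

oneEdge : {X : Set} → (X → X → Bool) → X → X → X → Bool
oneEdge l i j k = if l i j then not (l i k) ∧ not (l j k) else l i k xor l j k

triple : Graph → Fin 6 → Fin 6 → Fin 6 → Maybe ℕ
triple l i j k = if oneEdge l i j k then just (var i j k) else nothing

lookupTree : ∀ {k} → Trie k → Vec (Maybe ℕ) k → Tree ℕ
lookupTree n         []             = leaf n
lookupTree (lo , hi) (nothing ∷ bs) = lookupTree lo bs
lookupTree (lo , hi) (just v ∷ bs)  = choose v (lookupTree lo bs) (lookupTree hi bs)

bitTree : Maybe ℕ → Tree Bool
bitTree nothing  = leaf false
bitTree (just v) = node v (leaf false) (leaf true)

valueTree : ∀ {k} → Vec (Maybe ℕ) k → Tree ℕ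
valueTree []       = leaf 0
valueTree (b ∷ bs) = zipTree (λ x n → bit x ℕ.+ 2 ℕ.* n) (bitTree b) (valueTree bs)

-- A completed forbidden pattern dies, anything else becomes the neutral summand 0, so the forbidden
-- trees can be added to the numerical ones as a filter.
kill : Tree Bool → Tree ℤ
kill dead         = dead
kill (leaf true)  = dead
kill (leaf false) = leaf 0ℤ
kill (node v l h) = node v (kill l) (kill h)

conjTree : List (Maybe ℕ) → Tree Bool
conjTree []       = leaf true
conjTree (b ∷ bs) = zipTree _∧_ (bitTree b) (conjTree bs)

forbid : List (Maybe ℕ) → Tree ℤ
forbid bs = kill (conjTree bs)

edgeBits₅ : {X : Set} → (X → X → Bool) → X → X → X → X → Vec Bool 5
edgeBits₅ l p q a b = l p a ∷ l p b ∷ l q a ∷ l q b ∷ l a b ∷ []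

edgeBits₆ : {X : Set} → (X → X → Bool) → X → X → X → X → Vec Bool 6
edgeBits₆ l a b c d = l a b ∷ l a c ∷ l a d ∷ l b c ∷ l b d ∷ l c d ∷ []

starBits : {X : Set} → (X → X → Bool) → X → X → X → X → X → Vec Bool 4
starBits l a b c d u = l a u ∷ l b u ∷ l c u ∷ l d u ∷ []

tripleBits : {X Y : Set} → (X → X → X → Y) → X → X → X → X → Vec Y 4
tripleBits t a b c d = t a b c ∷ t a b d ∷ t a c d ∷ t b c d ∷ []

codegTree k4Tree f32Tree : Graph → Tuple → Tree ℤ
codegTree l (p ∷ q ∷ a ∷ b ∷ _) =
  if l p q ∧ l a b then forbid (triple l p q a ∷ triple l p q b ∷ []) else leaf 0ℤ
k4Tree l (p ∷ q ∷ a ∷ b ∷ _) = forbid (triple l p q a ∷ triple l p q b ∷ triple l p a b ∷ [])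
f32Tree l (p ∷ q ∷ a ∷ b ∷ c ∷ _) =
  forbid (triple l p q a ∷ triple l p q b ∷ triple l p q c ∷ triple l a b c ∷ [])

sideTree : (Bool → Trie 9) → Graph → Fin 6 → Fin 6 → Fin 6 → Fin 6 → Tree ℕ
sideTree flag l p q a b =
  lookupTree (flag (l p q) at edgeBits₅ l p q a b) (tripleBits (triple l) p q a b)

pairTree : (Bool → Trie 9) → (Bool → List (List ℤ)) → Graph → Tuple → Tree ℤ
pairTree flag table l (p ∷ q ∷ a ∷ b ∷ c ∷ d ∷ []) =
  zipTree (entry (table (l p q))) (sideTree flag l p q a b) (sideTree flag l p q c d)

blockTree : List Block → ℕ → Tree ℕ → ℕ → ℕ → Tree ℤ
blockTree []                 root ts x y = leaf 0ℤ
blockTree ((r , s , T) ∷ bs) root ts x y =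
  if root ≡ᵇ r
  then zipTree ℤ._+_ (mapTree (λ n → if n ≡ᵇ s then entry T x y else 0ℤ) ts) (blockTree bs root ts x y)
  else blockTree bs root ts x y

weight : Bool → ℤ
weight b = if b then + scale else 0ℤ

quadTree : List Block → Graph → Tuple → Tree ℤ
quadTree blocks l (a ∷ b ∷ c ∷ d ∷ u ∷ v ∷ []) =
  zipTree ℤ._+_ (mapTree weight (bitTree (triple l a b c)))
    (blockTree blocks (value (edgeBits₆ l a b c d)) (valueTree (tripleBits (triple l) a b c d))
      (value (starBits l a b c d u)) (value (starBits l a b c d v)))

-- Enumeration of the graphs on six vertices and the finite check.

-- A strictly upper triangular matrix: symmetry and irreflexivity are built in, which leaves 2^15
-- cases on six vertices.
Tri : ℕ → Set
Tri zero    = ⊤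
Tri (suc k) = Vec Bool k × Tri k

adj : ∀ {k} → Tri k → Fin k → Fin k → Bool
adj (r , T) zero    zero    = false
adj (r , T) zero    (suc j) = Vec.lookup r j
adj (r , T) (suc i) zero    = Vec.lookup r i
adj (r , T) (suc i) (suc j) = adj T i j

fromAdj : ∀ {k} → (Fin k → Fin k → Bool) → Tri k
fromAdj {zero}  l = tt
fromAdj {suc k} l = Vec.tabulate (λ j → l zero (suc j)) , fromAdj (λ i j → l (suc i) (suc j))

triCode : ∀ {k} → Tri k → ℕ
triCode {zero}  _       = 0
triCode {suc k} (r , T) = value r ℕ.+ 2 ℕ.^ k ℕ.* triCode T

everyVec : ∀ k → (Vec Bool k → Bool) → Bool
everyVec zero    ok = ok []
everyVec (suc k) ok = everyVec k (ok ∘ (false ∷_)) ∧ everyVec k (ok ∘ (true ∷_))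

everyTri : ∀ k → (Tri k → Bool) → Bool
everyTri zero    ok = ok tt
everyTri (suc k) ok = everyTri k (λ T → everyVec k (λ r → ok (r , T)))

-- The exchange of `k` and `k + 1`. A descent step uses a single such exchange, so invariance of the
-- sums has to be verified for five relabellings only.
transposition : Fin 5 → Fin 6 → Fin 6
transposition zero    zero          = suc zero
transposition zero    (suc zero)    = zero
transposition zero    (suc (suc i)) = suc (suc i)
transposition (suc k) zero          = zero
transposition (suc zero) (suc i)    = shift i
  where
  shift : Fin 5 → Fin 6
  shift zero          = suc (suc zero)
  shift (suc zero)    = suc zero
  shift (suc (suc i)) = suc (suc (suc i))
transposition (suc (suc zero)) (suc i) = shift i
  where
  shift : Fin 5 → Fin 6
  shift zero                = suc zero
  shift (suc zero)          = suc (suc (suc zero))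
  shift (suc (suc zero))    = suc (suc zero)
  shift (suc (suc (suc i))) = suc (suc (suc (suc i)))
transposition (suc (suc (suc zero))) (suc i) = shift i
  where
  shift : Fin 5 → Fin 6
  shift (suc (suc zero))       = suc (suc (suc (suc zero)))
  shift (suc (suc (suc zero))) = suc (suc (suc zero))
  shift i                      = suc i
transposition (suc (suc (suc (suc zero)))) (suc i) = shift i
  where
  shift : Fin 5 → Fin 6
  shift (suc (suc (suc zero)))       = suc (suc (suc (suc (suc zero))))
  shift (suc (suc (suc (suc zero)))) = suc (suc (suc (suc zero)))
  shift i                            = suc i

anyᵇ : {A : Set} → (A → Bool) → List A → Bool
anyᵇ ok []       = false
anyᵇ ok (x ∷ xs) = ok x ∨ anyᵇ ok xs

hasTriangle : Graph → Bool
hasTriangle l =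
  anyᵇ (λ i → anyᵇ (λ j → l i j ∧ anyᵇ (λ k → l i k ∧ l j k) (allFin 6)) (allFin 6)) (allFin 6)

lowered : Tri 6 → Fin 5 → Tri 6
lowered L k = fromAdj (λ i j → adj L (transposition k i) (transposition k j))

reducible : Tri 6 → Bool
reducible L = anyᵇ (λ k → triCode (lowered L k) <ᵇ triCode L) (allFin 5)

forbiddenTrees : Graph → List Tuple → List Tuple → List Tuple → List (Tree ℤ)
forbiddenTrees l t₁ t₂ t₃ = map (codegTree l) t₁ ++ map (k4Tree l) t₂ ++ map (f32Tree l) t₃

_≤ᵇ_ : ℤ → ℤ → Bool
x ≤ᵇ y = nonneg (y ℤ.- x)
  where
  nonneg : ℤ → Bool
  nonneg (+ _)    = true
  nonneg -[1+ _ ] = false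

-- The 360 ordered tuples that carry the weight `scale` are to average at most 5/18, and 360 * 5/18
-- = 100.
bound : ℤ
bound = + (100 ℕ.* scale)

checkGraph : (t₁ t₂ t₃ ts₂ ts₄ : List Tuple) → (Bool → Trie 9) → (Bool → List (List ℤ)) → List Block → Tri 6 → Bool
checkGraph t₁ t₂ t₃ ts₂ ts₄ flag table blocks L =
  hasTriangle (adj L) ∨ reducible L ∨
  everyLeaf (_≤ᵇ bound)
    -- There are 90 + 60 + 60 forbidden patterns, 360 four-root terms and 90 two-root terms; ten
    -- rounds of pairing reduce these 660 trees to one, since 660 is at most 2^10.
    (addTrees 10 (forbiddenTrees (adj L) t₁ t₂ t₃ ++
                  map (quadTree blocks (adj L)) ts₄ ++ map (pairTree flag table (adj L)) ts₂))

-- Boolean reflection and evaluation of decision trees.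

∧-true : ∀ {x y} → x ∧ y ≡ true → x ≡ true × y ≡ true
∧-true {true} {true} _ = refl , refl

∨-true : ∀ {x y} → x ∨ y ≡ true → x ≡ true ⊎ y ≡ true
∨-true {true}  _ = inj₁ refl
∨-true {false} e = inj₂ e

T⇒≡ : ∀ {b} → T b → b ≡ true
T⇒≡ {true} _ = refl

≡⇒T : ∀ {b} → b ≡ true → T b
≡⇒T refl = tt

anyᵇ-true : {A : Set} (ok : A → Bool) (xs : List A) → anyᵇ ok xs ≡ true → ∃ λ x → ok x ≡ true
anyᵇ-true ok (x ∷ xs) e with ∨-true {ok x} e
... | inj₁ h = x , h
... | inj₂ h = anyᵇ-true ok xs h

everyVec-true : ∀ k (ok : Vec Bool k → Bool) → everyVec k ok ≡ true → ∀ r → ok r ≡ true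
everyVec-true zero    ok e []          = e
everyVec-true (suc k) ok e (false ∷ r) = everyVec-true k _ (proj₁ (∧-true e)) r
everyVec-true (suc k) ok e (true ∷ r)  = everyVec-true k _ (proj₂ (∧-true e)) r

everyTri-true : ∀ k (ok : Tri k → Bool) → everyTri k ok ≡ true → ∀ L → ok L ≡ true
everyTri-true zero    ok e tt      = e
everyTri-true (suc k) ok e (r , L) = everyVec-true k _ (everyTri-true k _ e L) r

adj-fromAdj : ∀ {k} (l : Fin k → Fin k → Bool) → (∀ i j → l i j ≡ l j i) → (∀ i → l i i ≡ false) →
              ∀ i j → adj (fromAdj l) i j ≡ l i j
adj-fromAdj l s r zero    zero    = sym (r zero)
adj-fromAdj l s r zero    (suc j) = lookup∘tabulate (λ j → l zero (suc j)) j
adj-fromAdj l s r (suc i) zero    = trans (lookup∘tabulate (λ j → l zero (suc j)) i) (s zero (suc i))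
adj-fromAdj l s r (suc i) (suc j) = adj-fromAdj (λ i j → l (suc i) (suc j)) (λ i j → s _ _) (λ i → r _) i j

Env : Set
Env = ℕ → Bool

-- `nothing` marks a dead leaf. The lemmas below assume live evaluations, so they need not describe
-- how dead branches are merged.
eval : {A : Set} → Env → Tree A → Maybe A
eval ρ dead         = nothing
eval ρ (leaf a)     = just a
eval ρ (node v l h) = if ρ v then eval ρ h else eval ρ l

eval-map : {A B : Set} (f : A → B) (ρ : Env) (t : Tree A) {a : A} →
           eval ρ t ≡ just a → eval ρ (mapTree f t) ≡ just (f a)
eval-map f ρ (leaf _) refl = refl
eval-map f ρ (node v l h) e with ρ v
... | true  = eval-map f ρ h e
... | false = eval-map f ρ l e

≮ᵇ-antisym : ∀ v w → (v <ᵇ w) ≡ false → (w <ᵇ v) ≡ false → v ≡ w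
≮ᵇ-antisym v w e₁ e₂ = ℕₚ.≤-antisym (≮ w v e₂) (≮ v w e₁)
  where
  ≮ : ∀ x y → (x <ᵇ y) ≡ false → y ℕ.≤ x
  ≮ x y e = ℕₚ.≮⇒≥ λ lt → case trans (sym e) (T⇒≡ (ℕₚ.<⇒<ᵇ lt)) of λ ()

eval-zip : {A B C : Set} (f : A → B → C) (ρ : Env) (s : Tree A) (t : Tree B) {a : A} {b : B} →
           eval ρ s ≡ just a → eval ρ t ≡ just b → eval ρ (zipTree f s t) ≡ just (f a b)
eval-zipNode : {A B C : Set} (f : A → B → C) (ρ : Env) (v : ℕ) (l h : Tree A) (t : Tree B) {a : A} {b : B} →
               eval ρ (node v l h) ≡ just a → eval ρ t ≡ just b → eval ρ (zipNode f v l h t) ≡ just (f a b)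
eval-zip f ρ (leaf _)     t refl e₂ = eval-map (f _) ρ t e₂
eval-zip f ρ (node v l h) t e₁   e₂ = eval-zipNode f ρ v l h t e₁ e₂
eval-zipNode f ρ v l h (leaf b) e refl = eval-map (λ a → f a b) ρ (node v l h) e
eval-zipNode f ρ v l h (node w l′ h′) e₁ e₂ with v <ᵇ w in p | w <ᵇ v in q
eval-zipNode f ρ v l h (node w l′ h′) e₁ e₂ | true | _ with ρ v
... | true  = eval-zip f ρ h (node w l′ h′) e₁ e₂
... | false = eval-zip f ρ l (node w l′ h′) e₁ e₂
eval-zipNode f ρ v l h (node w l′ h′) e₁ e₂ | false | true with ρ w
... | true  = eval-zipNode f ρ v l h h′ e₁ e₂
... | false = eval-zipNode f ρ v l h l′ e₁ e₂
eval-zipNode f ρ v l h (node w l′ h′) e₁ e₂ | false | false with ≮ᵇ-antisym v w p q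
... | refl with ρ v
... | true  = eval-zip f ρ h h′ e₁ e₂
... | false = eval-zip f ρ l l′ e₁ e₂

eval-var : (ρ : Env) (v : ℕ) → eval ρ (node v (leaf false) (leaf true)) ≡ just (ρ v)
eval-var ρ v with ρ v
... | true  = refl
... | false = refl

eval-choose : {A : Set} (ρ : Env) (v : ℕ) (lo hi : Tree A) {x y : A} →
              eval ρ lo ≡ just x → eval ρ hi ≡ just y → eval ρ (choose v lo hi) ≡ just (if ρ v then y else x)
eval-choose ρ v lo hi e₁ e₂ =
  eval-zip _ ρ (node v (leaf false) (leaf true)) (zipTree _,_ lo hi) (eval-var ρ v) (eval-zip _,_ ρ lo hi e₁ e₂)

meaning : Env → Maybe ℕ → Bool
meaning ρ nothing  = false
meaning ρ (just v) = ρ v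

look : ∀ {k} → Trie k → Vec Bool k → ℕ
look n         []       = n
look (lo , hi) (b ∷ bs) = look (if b then hi else lo) bs

look-tabulate : ∀ {k} (f : Vec Bool k → ℕ) bs → look (tabulateᵗ f) bs ≡ f bs
look-tabulate f []           = refl
look-tabulate f (false ∷ bs) = look-tabulate (f ∘ (false ∷_)) bs
look-tabulate f (true ∷ bs)  = look-tabulate (f ∘ (true ∷_)) bs

look-at : ∀ {k m} (t : Trie (k ℕ.+ m)) (bs : Vec Bool k) (cs : Vec Bool m) → look (t at bs) cs ≡ look t (bs Vec.++ cs)
look-at t         []       cs = refl
look-at (lo , hi) (b ∷ bs) cs = look-at (if b then hi else lo) bs cs

eval-lookup : ∀ {k} (ρ : Env) (t : Trie k) (bs : Vec (Maybe ℕ) k) →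
              eval ρ (lookupTree t bs) ≡ just (look t (Vec.map (meaning ρ) bs))
eval-lookup ρ t         []             = refl
eval-lookup ρ (lo , hi) (nothing ∷ bs) = eval-lookup ρ lo bs
eval-lookup ρ (lo , hi) (just v ∷ bs)  =
  trans (eval-choose ρ v (lookupTree lo bs) (lookupTree hi bs) (eval-lookup ρ lo bs) (eval-lookup ρ hi bs))
        (cong just (split (ρ v)))
  where
  split : ∀ b → (if b then look hi (Vec.map (meaning ρ) bs) else look lo (Vec.map (meaning ρ) bs))
              ≡ look (if b then hi else lo) (Vec.map (meaning ρ) bs)
  split true  = refl
  split false = refl

eval-bit : (ρ : Env) (m : Maybe ℕ) → eval ρ (bitTree m) ≡ just (meaning ρ m)
eval-bit ρ nothing  = refl
eval-bit ρ (just v) = eval-var ρ v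

eval-value : ∀ {k} (ρ : Env) (bs : Vec (Maybe ℕ) k) → eval ρ (valueTree bs) ≡ just (value (Vec.map (meaning ρ) bs))
eval-value ρ []       = refl
eval-value ρ (b ∷ bs) = eval-zip _ ρ (bitTree b) (valueTree bs) (eval-bit ρ b) (eval-value ρ bs)

conj : Env → List (Maybe ℕ) → Bool
conj ρ []       = true
conj ρ (b ∷ bs) = meaning ρ b ∧ conj ρ bs

eval-conj : (ρ : Env) (bs : List (Maybe ℕ)) → eval ρ (conjTree bs) ≡ just (conj ρ bs)
eval-conj ρ []       = refl
eval-conj ρ (b ∷ bs) = eval-zip _∧_ ρ (bitTree b) (conjTree bs) (eval-bit ρ b) (eval-conj ρ bs)

eval-kill : (ρ : Env) (t : Tree Bool) → eval ρ t ≡ just false → eval ρ (kill t) ≡ just 0ℤ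
eval-kill ρ (leaf false) refl = refl
eval-kill ρ (node v l h) e with ρ v
... | true  = eval-kill ρ h e
... | false = eval-kill ρ l e

eval-forbid : (ρ : Env) (bs : List (Maybe ℕ)) → conj ρ bs ≡ false → eval ρ (forbid bs) ≡ just 0ℤ
eval-forbid ρ bs e = eval-kill ρ (conjTree bs) (trans (eval-conj ρ bs) (cong just e))

sumℤ : List ℤ → ℤ
sumℤ = foldr ℤ._+_ 0ℤ

sumℤ-++ : ∀ xs ys → sumℤ (xs ++ ys) ≡ sumℤ xs ℤ.+ sumℤ ys
sumℤ-++ []       ys = sym (ℤₚ.+-identityˡ _)
sumℤ-++ (x ∷ xs) ys = trans (cong (ℤ._+_ x) (sumℤ-++ xs ys)) (sym (ℤₚ.+-assoc x _ _))

data Evals (ρ : Env) : List (Tree ℤ) → List ℤ → Set where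
  []  : Evals ρ [] []
  _∷_ : ∀ {t x ts xs} → eval ρ t ≡ just x → Evals ρ ts xs → Evals ρ (t ∷ ts) (x ∷ xs)

evals-++ : ∀ {ρ ts us xs ys} → Evals ρ ts xs → Evals ρ us ys → Evals ρ (ts ++ us) (xs ++ ys)
evals-++ []       q = q
evals-++ (e ∷ es) q = e ∷ evals-++ es q

evals-map : {A : Set} {ρ : Env} (f : A → Tree ℤ) (g : A → ℤ) → (∀ u → eval ρ (f u) ≡ just (g u)) →
            ∀ us → Evals ρ (map f us) (map g us)
evals-map f g e []       = []
evals-map f g e (u ∷ us) = e u ∷ evals-map f g e us

evals-addPairs : ∀ {ρ ts xs} → Evals ρ ts xs → ∃ λ ys → Evals ρ (addPairs ts) ys × sumℤ ys ≡ sumℤ xs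
evals-addPairs []       = [] , [] , refl
evals-addPairs (e ∷ []) = _ , e ∷ [] , refl
evals-addPairs {ρ} (_∷_ {t} {x} e (_∷_ {u} {y} {xs = xs} e′ es)) =
  let ys , ev , eq = evals-addPairs es
  in (x ℤ.+ y) ∷ ys , eval-zip ℤ._+_ ρ t u e e′ ∷ ev ,
     trans (cong (λ z → x ℤ.+ y ℤ.+ z) eq) (ℤₚ.+-assoc x y (sumℤ xs))

eval-addTrees : ∀ {ρ ts xs} k → Evals ρ ts xs → eval ρ (addTrees k ts) ≡ just (sumℤ xs)
eval-addTrees zero [] = refl
eval-addTrees {ρ} zero (_∷_ {t} {ts = ts} e es) =
  eval-zip ℤ._+_ ρ t (foldr (zipTree ℤ._+_) (leaf 0ℤ) ts) e (eval-addTrees zero es)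
eval-addTrees (suc k) es =
  let ys , ev , eq = evals-addPairs es in trans (eval-addTrees k ev) (cong just eq)

everyLeaf-true : {A : Set} (ok : A → Bool) (ρ : Env) (t : Tree A) {a : A} →
                 everyLeaf ok t ≡ true → eval ρ t ≡ just a → ok a ≡ true
everyLeaf-true ok ρ (leaf _) p refl = p
everyLeaf-true ok ρ (node v l h) p e with ρ v
... | true  = everyLeaf-true ok ρ h (proj₂ (∧-true p)) e
... | false = everyLeaf-true ok ρ l (proj₁ (∧-true p)) e

-- Link graphs with marked triples, and the variables that describe them.

-- What the link `l` of a vertex `x` and its marked triples `t` inherit from the two forbidden
-- 3-graphs. The clause `codegree` comes from an `F32` through `x`: if `pq` and `ab` are edges of
-- the link, then `pqx`, `pqa`, `pqb` and `xab` form one.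
record Valid {X : Set} (l : X → X → Bool) (t : X → X → X → Bool) : Set where
  field
    l-sym    : ∀ i j → l i j ≡ l j i
    l-irrefl : ∀ i → l i i ≡ false
    t-swap   : ∀ i j k → t i j k ≡ t j i k
    t-swapʳ  : ∀ i j k → t i j k ≡ t i k j
    triangle : ∀ i j k → l i j ≡ true → l i k ≡ true → l j k ≡ true → ⊥
    t-edge   : ∀ i j k → t i j k ≡ true → oneEdge l i j k ≡ true
    codegree : ∀ p q a b → l p q ≡ true → l a b ≡ true → t p q a ≡ true → t p q b ≡ true → ⊥
    k4-free  : ∀ p q a b → t p q a ≡ true → t p q b ≡ true → t p a b ≡ true → ⊥
    f32-free : ∀ p q a b c → t p q a ≡ true → t p q b ≡ true → t p q c ≡ true → t a b c ≡ true → ⊥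

-- Holds for arbitrary `h` because the clauses speak about all points, equal or not. In particular a
-- six-tuple of vertices with repetitions still yields a valid structure on `Fin 6`.
pullback : {X Y : Set} {l : X → X → Bool} {t : X → X → X → Bool} → Valid l t → (h : Y → X) →
           Valid (λ i j → l (h i) (h j)) (λ i j k → t (h i) (h j) (h k))
pullback V h = record
  { l-sym = λ i j → l-sym _ _ ; l-irrefl = λ i → l-irrefl _ ; t-swap = λ i j k → t-swap _ _ _
  ; t-swapʳ = λ i j k → t-swapʳ _ _ _ ; triangle = λ i j k → triangle _ _ _ ; t-edge = λ i j k → t-edge _ _ _
  ; codegree = λ p q a b → codegree _ _ _ _ ; k4-free = λ p q a b → k4-free _ _ _ _
  ; f32-free = λ p q a b c → f32-free _ _ _ _ _ }
  where open Valid V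

oneEdge-cong : {X : Set} {l l′ : X → X → Bool} → (∀ i j → l i j ≡ l′ i j) → ∀ i j k → oneEdge l i j k ≡ oneEdge l′ i j k
oneEdge-cong e i j k rewrite e i j | e i k | e j k = refl

valid-cong : {X : Set} {l l′ : X → X → Bool} {t : X → X → X → Bool} → (∀ i j → l i j ≡ l′ i j) → Valid l t → Valid l′ t
valid-cong e V = record
  { l-sym = λ i j → trans (sym (e i j)) (trans (l-sym i j) (e j i))
  ; l-irrefl = λ i → trans (sym (e i i)) (l-irrefl i)
  ; t-swap = t-swap ; t-swapʳ = t-swapʳ
  ; triangle = λ i j k p q r → triangle i j k (trans (e i j) p) (trans (e i k) q) (trans (e j k) r)
  ; t-edge = λ i j k p → trans (sym (oneEdge-cong e i j k)) (t-edge i j k p)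
  ; codegree = λ p q a b x y → codegree p q a b (trans (e p q) x) (trans (e a b) y)
  ; k4-free = k4-free ; f32-free = f32-free }
  where open Valid V

clamp : ∀ k → ℕ → Fin (suc k)
clamp k       zero    = zero
clamp zero    (suc m) = zero
clamp (suc k) (suc m) = suc (clamp k m)

-- The base-6 digits. On values of `var` they are at most 5, so `clamp` changes nothing there.
decode : ℕ → Fin 6 × Fin 6 × Fin 6
decode m = clamp 5 (m / 36) , clamp 5 ((m / 6) % 6) , clamp 5 (m % 6)

environment : (Fin 6 → Fin 6 → Fin 6 → Bool) → Env
environment t m = t (proj₁ (decode m)) (proj₁ (proj₂ (decode m))) (proj₂ (proj₂ (decode m)))

Rearranged : ∀ {n} → Fin n → Fin n → Fin n → Fin n × Fin n × Fin n → Set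
Rearranged i j k d =
  d ≡ (i , j , k) ⊎ d ≡ (i , k , j) ⊎ d ≡ (j , i , k) ⊎ d ≡ (j , k , i) ⊎ d ≡ (k , i , j) ⊎ d ≡ (k , j , i)

sameTriple : ∀ {n} → Fin n × Fin n × Fin n → Fin n × Fin n × Fin n → Bool
sameTriple (a , b , c) (i , j , k) = (toℕ a ≡ᵇ toℕ i) ∧ (toℕ b ≡ᵇ toℕ j) ∧ (toℕ c ≡ᵇ toℕ k)

sameTriple-true : ∀ {n} (d e : Fin n × Fin n × Fin n) → sameTriple d e ≡ true → d ≡ e
sameTriple-true {n} (a , b , c) (i , j , k) h =
  let h₁ , h′ = ∧-true h ; h₂ , h₃ = ∧-true h′
  in cong₂ _,_ (same a i h₁) (cong₂ _,_ (same b j h₂) (same c k h₃))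
  where
  same : ∀ (x y : Fin n) → (toℕ x ≡ᵇ toℕ y) ≡ true → x ≡ y
  same x y p = toℕ-injective (ℕₚ.≡ᵇ⇒≡ (toℕ x) (toℕ y) (≡⇒T p))

rearranged : ∀ {n} → Fin n → Fin n → Fin n → Fin n × Fin n × Fin n → Bool
rearranged i j k d =
  sameTriple d (i , j , k) ∨ sameTriple d (i , k , j) ∨ sameTriple d (j , i , k) ∨
  sameTriple d (j , k , i) ∨ sameTriple d (k , i , j) ∨ sameTriple d (k , j , i)

rearranged-true : ∀ {n} (i j k : Fin n) d → rearranged i j k d ≡ true → Rearranged i j k d
rearranged-true i j k d h with ∨-true {sameTriple d (i , j , k)} h
... | inj₁ e = inj₁ (sameTriple-true d _ e)
... | inj₂ h with ∨-true {sameTriple d (i , k , j)} h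
... | inj₁ e = inj₂ (inj₁ (sameTriple-true d _ e))
... | inj₂ h with ∨-true {sameTriple d (j , i , k)} h
... | inj₁ e = inj₂ (inj₂ (inj₁ (sameTriple-true d _ e)))
... | inj₂ h with ∨-true {sameTriple d (j , k , i)} h
... | inj₁ e = inj₂ (inj₂ (inj₂ (inj₁ (sameTriple-true d _ e))))
... | inj₂ h with ∨-true {sameTriple d (k , i , j)} h
... | inj₁ e = inj₂ (inj₂ (inj₂ (inj₂ (inj₁ (sameTriple-true d _ e)))))
... | inj₂ e = inj₂ (inj₂ (inj₂ (inj₂ (inj₂ (sameTriple-true d _ e)))))

everyFin : ∀ n → (Fin n → Bool) → Bool
everyFin zero    ok = true
everyFin (suc n) ok = ok zero ∧ everyFin n (ok ∘ suc)

everyFin-true : ∀ n (ok : Fin n → Bool) → everyFin n ok ≡ true → ∀ i → ok i ≡ true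
everyFin-true (suc n) ok e zero    = proj₁ (∧-true e)
everyFin-true (suc n) ok e (suc i) = everyFin-true n (ok ∘ suc) (proj₂ (∧-true e)) i

var-checked : everyFin 6 (λ i → everyFin 6 λ j → everyFin 6 λ k → rearranged i j k (decode (var i j k))) ≡ true
var-checked = refl

var-rearranged : ∀ i j k → Rearranged i j k (decode (var i j k))
var-rearranged i j k = rearranged-true i j k (decode (var i j k))
  (everyFin-true 6 (λ k → rearranged i j k (decode (var i j k)))
    (everyFin-true 6 (λ j → everyFin 6 λ k → rearranged i j k (decode (var i j k)))
      (everyFin-true 6 (λ i → everyFin 6 λ j → everyFin 6 λ k → rearranged i j k (decode (var i j k))) var-checked i) j) k)

rearranged-value : ∀ {n} {X : Set} {t : Fin n → Fin n → Fin n → X} → (∀ i j k → t i j k ≡ t j i k) → (∀ i j k → t i j k ≡ t i k j) →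
                   ∀ i j k d → Rearranged i j k d → t (proj₁ d) (proj₁ (proj₂ d)) (proj₂ (proj₂ d)) ≡ t i j k
rearranged-value s₁ s₂ i j k _ (inj₁ refl) = refl
rearranged-value s₁ s₂ i j k _ (inj₂ (inj₁ refl)) = s₂ i k j
rearranged-value s₁ s₂ i j k _ (inj₂ (inj₂ (inj₁ refl))) = s₁ j i k
rearranged-value s₁ s₂ i j k _ (inj₂ (inj₂ (inj₂ (inj₁ refl)))) = trans (s₂ j k i) (s₁ j i k)
rearranged-value s₁ s₂ i j k _ (inj₂ (inj₂ (inj₂ (inj₂ (inj₁ refl))))) = trans (s₁ k i j) (s₂ i k j)
rearranged-value s₁ s₂ i j k _ (inj₂ (inj₂ (inj₂ (inj₂ (inj₂ refl))))) =
  trans (s₁ k j i) (trans (s₂ j k i) (s₁ j i k))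

environment-var : ∀ {l t} → Valid l t → ∀ i j k → environment t (var i j k) ≡ t i j k
environment-var V i j k = rearranged-value (Valid.t-swap V) (Valid.t-swapʳ V) i j k (decode (var i j k)) (var-rearranged i j k)

-- In the trees a triple without exactly one edge of `l` is the constant `false`; by `t-edge` it is
-- indeed never marked.
meaning-triple : ∀ {l t} → Valid l t → ∀ i j k → meaning (environment t) (triple l i j k) ≡ t i j k
meaning-triple {l} {t} V i j k with oneEdge l i j k in e
... | true  = environment-var V i j k
... | false with t i j k in f
...   | false = refl
...   | true  = ⊥-elim (case trans (sym (Valid.t-edge V i j k f)) e of λ ())

-- Terms of the certificate and soundness of the leaf check.

flagOf : {X : Set} → (Bool → Vec Bool 9 → ℕ) → (X → X → Bool) → (X → X → X → Bool) → X → X → X → X → ℕ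
flagOf flag l t p q a b = flag (l p q) (edgeBits₅ l p q a b Vec.++ tripleBits t p q a b)

pairTerm : {X : Set} → (X → X → Bool) → (X → X → X → Bool) → Vec X 6 → ℤ
pairTerm l t (p ∷ q ∷ a ∷ b ∷ c ∷ d ∷ []) =
  entry (gram (pairSquares (l p q))) (flagOf pairFlag l t p q a b) (flagOf pairFlag l t p q c d)

blockTerm : List (ℕ × ℕ × List Square) → ℕ → ℕ → ℕ → ℕ → ℤ
blockTerm []                  root ts x y = 0ℤ
blockTerm ((r , s , sq) ∷ bs) root ts x y =
  if root ≡ᵇ r then (if ts ≡ᵇ s then entry (gram sq) x y else 0ℤ) ℤ.+ blockTerm bs root ts x y
  else blockTerm bs root ts x y

quadTerm : {X : Set} → List (ℕ × ℕ × List Square) → (X → X → Bool) → (X → X → X → Bool) → Vec X 6 → ℤ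
quadTerm blocks l t (a ∷ b ∷ c ∷ d ∷ u ∷ v ∷ []) =
  weight (t a b c) ℤ.+
  blockTerm blocks (value (edgeBits₆ l a b c d)) (value (tripleBits t a b c d))
    (value (starBits l a b c d u)) (value (starBits l a b c d v))

tripleBits-cong : {X Y : Set} {f g : X → X → X → Y} → (∀ i j k → f i j k ≡ g i j k) → ∀ a b c d → tripleBits f a b c d ≡ tripleBits g a b c d
tripleBits-cong e a b c d rewrite e a b c | e a b d | e a c d | e b c d = refl

eval-side : ∀ {l t} → Valid l t → (flag : Bool → Trie 9) → (∀ e bs → look (flag e) bs ≡ pairFlag e bs) →
            ∀ p q a b → eval (environment t) (sideTree flag l p q a b) ≡ just (flagOf pairFlag l t p q a b)
eval-side {l} {t} V flag spec p q a b =
  trans (eval-lookup ρ (flag (l p q) at edgeBits₅ l p q a b) (tripleBits (triple l) p q a b))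
    (cong just (trans (look-at (flag (l p q)) (edgeBits₅ l p q a b) bits)
      (trans (spec (l p q) (edgeBits₅ l p q a b Vec.++ bits))
        (cong (λ bs → pairFlag (l p q) (edgeBits₅ l p q a b Vec.++ bs))
          (tripleBits-cong {f = λ i j k → meaning ρ (triple l i j k)} {g = t} (meaning-triple V) p q a b)))))
  where
  ρ = environment t
  bits : Vec Bool 4
  bits = Vec.map (meaning ρ) (tripleBits (triple l) p q a b)

eval-pair : ∀ {l t} → Valid l t → (flag : Bool → Trie 9) → (∀ e bs → look (flag e) bs ≡ pairFlag e bs) →
            (table : Bool → List (List ℤ)) → (∀ e → table e ≡ gram (pairSquares e)) →
            ∀ u → eval (environment t) (pairTree flag table l u) ≡ just (pairTerm l t u)
eval-pair {l} {t} V flag spec table spec′ (p ∷ q ∷ a ∷ b ∷ c ∷ d ∷ []) =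
  trans (eval-zip (entry (table (l p q))) (environment t) (sideTree flag l p q a b) (sideTree flag l p q c d)
          (eval-side V flag spec p q a b) (eval-side V flag spec p q c d))
        (cong (λ T → just (entry T (flagOf pairFlag l t p q a b) (flagOf pairFlag l t p q c d))) (spec′ (l p q)))

eval-block : ∀ (ρ : Env) blocks root (ts : Tree ℕ) {n} x y → eval ρ ts ≡ just n →
             eval ρ (blockTree (map tabulateBlock blocks) root ts x y) ≡ just (blockTerm blocks root n x y)
eval-block ρ []                  root ts x y e = refl
eval-block ρ ((r , s , sq) ∷ bs) root ts x y e with root ≡ᵇ r
... | true  = eval-zip ℤ._+_ ρ (mapTree _ ts) (blockTree (map tabulateBlock bs) root ts x y)
                (eval-map _ ρ ts e) (eval-block ρ bs root ts x y e)
... | false = eval-block ρ bs root ts x y e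

eval-quad : ∀ {l t} → Valid l t → ∀ blocks u →
            eval (environment t) (quadTree (map tabulateBlock blocks) l u) ≡ just (quadTerm blocks l t u)
eval-quad {l} {t} V blocks (a ∷ b ∷ c ∷ d ∷ u ∷ v ∷ []) =
  eval-zip ℤ._+_ ρ (mapTree weight (bitTree (triple l a b c))) (blockTree (map tabulateBlock blocks) _ _ _ _)
    (trans (eval-map weight ρ (bitTree (triple l a b c)) (eval-bit ρ (triple l a b c)))
           (cong (λ x → just (weight x)) (meaning-triple V a b c)))
    (eval-block ρ blocks _ (valueTree (tripleBits (triple l) a b c d)) _ _
      (trans (eval-value ρ (tripleBits (triple l) a b c d)) (cong (λ bs → just (value bs)) (tripleBits-cong {f = λ i j k → meaning ρ (triple l i j k)} {g = t} (meaning-triple V) a b c d))))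
  where ρ = environment t

conj-false : ∀ {x} → (x ≡ true → ⊥) → x ≡ false
conj-false {true}  h = ⊥-elim (h refl)
conj-false {false} h = refl

conj-all : ∀ ρ bs → conj ρ bs ≡ true → All (λ b → meaning ρ b ≡ true) bs
conj-all ρ []       h = []
conj-all ρ (b ∷ bs) h = proj₁ (∧-true {meaning ρ b} h) ∷ conj-all ρ bs (proj₂ (∧-true {meaning ρ b} h))

forbidden-zero : ∀ ρ bs → (All (λ b → meaning ρ b ≡ true) bs → ⊥) → eval ρ (forbid bs) ≡ just 0ℤ
forbidden-zero ρ bs absurd = eval-forbid ρ bs (conj-false λ h → absurd (conj-all ρ bs h))

eval-guarded : ∀ ρ b (T : Tree ℤ) → (b ≡ true → eval ρ T ≡ just 0ℤ) → eval ρ (if b then T else leaf 0ℤ) ≡ just 0ℤ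
eval-guarded ρ true  T h = h refl
eval-guarded ρ false T h = refl

eval-codeg : ∀ {l t} → Valid l t → ∀ u → eval (environment t) (codegTree l u) ≡ just 0ℤ
eval-codeg {l} {t} V (p ∷ q ∷ a ∷ b ∷ c ∷ d ∷ []) =
  eval-guarded (environment t) (l p q ∧ l a b) (forbid (triple l p q a ∷ triple l p q b ∷ [])) λ e →
    forbidden-zero (environment t) (triple l p q a ∷ triple l p q b ∷ []) λ { (h₁ ∷ h₂ ∷ []) →
      Valid.codegree V p q a b (proj₁ (∧-true {l p q} e)) (proj₂ (∧-true {l p q} e))
        (trans (sym (meaning-triple V p q a)) h₁) (trans (sym (meaning-triple V p q b)) h₂) }

eval-k4 : ∀ {l t} → Valid l t → ∀ u → eval (environment t) (k4Tree l u) ≡ just 0ℤ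
eval-k4 {l} {t} V (p ∷ q ∷ a ∷ b ∷ c ∷ d ∷ []) =
  forbidden-zero (environment t) (triple l p q a ∷ triple l p q b ∷ triple l p a b ∷ []) λ { (h₁ ∷ h₂ ∷ h₃ ∷ []) →
    Valid.k4-free V p q a b (trans (sym (meaning-triple V p q a)) h₁) (trans (sym (meaning-triple V p q b)) h₂)
      (trans (sym (meaning-triple V p a b)) h₃) }

eval-f32 : ∀ {l t} → Valid l t → ∀ u → eval (environment t) (f32Tree l u) ≡ just 0ℤ
eval-f32 {l} {t} V (p ∷ q ∷ a ∷ b ∷ c ∷ d ∷ []) =
  forbidden-zero (environment t) (triple l p q a ∷ triple l p q b ∷ triple l p q c ∷ triple l a b c ∷ []) λ { (h₁ ∷ h₂ ∷ h₃ ∷ h₄ ∷ []) →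
    Valid.f32-free V p q a b c (trans (sym (meaning-triple V p q a)) h₁) (trans (sym (meaning-triple V p q b)) h₂)
      (trans (sym (meaning-triple V p q c)) h₃) (trans (sym (meaning-triple V a b c)) h₄) }

zeros : {A : Set} (xs : List A) → sumℤ (map (λ _ → 0ℤ) xs) ≡ 0ℤ
zeros []       = refl
zeros (x ∷ xs) = trans (ℤₚ.+-identityˡ _) (zeros xs)

≤ᵇ-true : ∀ x y → (x ≤ᵇ y) ≡ true → x ℤ.≤ y
≤ᵇ-true x y e with y ℤ.- x in eq
... | + n = ℤₚ.0≤i-j⇒j≤i (subst (0ℤ ℤ.≤_) (sym eq) (ℤ.+≤+ ℕ.z≤n))

-- In the environment of a valid structure every forbidden tree evaluates to 0 instead of dying. The
-- added tree therefore evaluates to a live leaf, which carries the whole sum, and the check bounds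
-- all live leaves.
leaves-sound : ∀ {l t} → Valid l t → ∀ t₁ t₂ t₃ ts₂ ts₄ flag → (∀ e bs → look (flag e) bs ≡ pairFlag e bs) →
  ∀ table → (∀ e → table e ≡ gram (pairSquares e)) → ∀ blocks →
  everyLeaf (_≤ᵇ bound)
    (addTrees 10 (forbiddenTrees l t₁ t₂ t₃ ++ map (quadTree (map tabulateBlock blocks) l) ts₄ ++ map (pairTree flag table l) ts₂)) ≡ true →
  sumℤ (map (quadTerm blocks l t) ts₄) ℤ.+ sumℤ (map (pairTerm l t) ts₂) ℤ.≤ bound
leaves-sound {l} {t} V t₁ t₂ t₃ ts₂ ts₄ flag spec table spec′ blocks ok =
  subst (ℤ._≤ bound) total (≤ᵇ-true (sumℤ values) bound
    (everyLeaf-true (_≤ᵇ bound) ρ (addTrees 10 trees) ok (eval-addTrees 10 evaluated)))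
  where
  ρ = environment t
  0s : List ℤ
  0s = map (λ _ → 0ℤ) t₁ ++ map (λ _ → 0ℤ) t₂ ++ map (λ _ → 0ℤ) t₃
  values : List ℤ
  values = 0s ++ map (quadTerm blocks l t) ts₄ ++ map (pairTerm l t) ts₂
  trees : List (Tree ℤ)
  trees = forbiddenTrees l t₁ t₂ t₃ ++ map (quadTree (map tabulateBlock blocks) l) ts₄ ++ map (pairTree flag table l) ts₂
  evaluated : Evals ρ trees values
  evaluated = evals-++ (evals-++ (evals-map (codegTree l) (λ _ → 0ℤ) (eval-codeg V) t₁)
                         (evals-++ (evals-map (k4Tree l) (λ _ → 0ℤ) (eval-k4 V) t₂)
                           (evals-map (f32Tree l) (λ _ → 0ℤ) (eval-f32 V) t₃)))
               (evals-++ (evals-map (quadTree (map tabulateBlock blocks) l) (quadTerm blocks l t) (eval-quad V blocks) ts₄)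
                         (evals-map (pairTree flag table l) (pairTerm l t) (eval-pair V flag spec table spec′) ts₂))
  nothing-added : sumℤ 0s ≡ 0ℤ
  nothing-added = trans (sumℤ-++ (map (λ _ → 0ℤ) t₁) (map (λ _ → 0ℤ) t₂ ++ map (λ _ → 0ℤ) t₃))
    (cong₂ ℤ._+_ (zeros t₁) (trans (sumℤ-++ (map (λ _ → 0ℤ) t₂) (map (λ _ → 0ℤ) t₃)) (cong₂ ℤ._+_ (zeros t₂) (zeros t₃))))
  total : sumℤ values ≡ sumℤ (map (quadTerm blocks l t) ts₄) ℤ.+ sumℤ (map (pairTerm l t) ts₂)
  total = trans (sumℤ-++ 0s (map (quadTerm blocks l t) ts₄ ++ map (pairTerm l t) ts₂))
    (trans (cong₂ ℤ._+_ nothing-added (sumℤ-++ (map (quadTerm blocks l t) ts₄) (map (pairTerm l t) ts₂))) (ℤₚ.+-identityˡ _))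

-- Symmetric bilinear forms behind the Gram tables.

form : List Square → ℕ → ℕ → ℤ
form []             i j = 0ℤ
form ((c , v) ∷ rs) i j = (+ c ℤ.* nth 0ℤ v i) ℤ.* nth 0ℤ v j ℤ.+ form rs i j

nth-addRow : ∀ xs ys i → nth 0ℤ (addRow xs ys) i ≡ nth 0ℤ xs i ℤ.+ nth 0ℤ ys i
nth-addRow []       ys       i       = sym (ℤₚ.+-identityˡ _)
nth-addRow (x ∷ xs) []       i       = sym (ℤₚ.+-identityʳ _)
nth-addRow (x ∷ xs) (y ∷ ys) zero    = refl
nth-addRow (x ∷ xs) (y ∷ ys) (suc i) = nth-addRow xs ys i

entry-addTable : ∀ S T i j → entry (addTable S T) i j ≡ entry S i j ℤ.+ entry T i j
entry-addTable []      T       i       j = sym (ℤₚ.+-identityˡ _)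
entry-addTable (s ∷ S) []      i       j = sym (ℤₚ.+-identityʳ _)
entry-addTable (s ∷ S) (t ∷ T) zero    j = nth-addRow s t j
entry-addTable (s ∷ S) (t ∷ T) (suc i) j = entry-addTable S T i j

nth-scale : ∀ x v j → nth 0ℤ (map (x ℤ.*_) v) j ≡ x ℤ.* nth 0ℤ v j
nth-scale x []      j       = sym (ℤₚ.*-zeroʳ x)
nth-scale x (y ∷ v) zero    = refl
nth-scale x (y ∷ v) (suc j) = nth-scale x v j

entry-outer : ∀ c v w i j → entry (map (λ x → map (λ y → (+ c ℤ.* x) ℤ.* y) w) v) i j ≡ (+ c ℤ.* nth 0ℤ v i) ℤ.* nth 0ℤ w j
entry-outer c []      w i       j = sym (cong (ℤ._* nth 0ℤ w j) (ℤₚ.*-zeroʳ (+ c)))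
entry-outer c (x ∷ v) w zero    j = nth-scale (+ c ℤ.* x) w j
entry-outer c (x ∷ v) w (suc i) j = entry-outer c v w i j

entry-gram : ∀ rs i j → entry (gram rs) i j ≡ form rs i j
entry-gram []             i j = refl
entry-gram ((c , v) ∷ rs) i j =
  trans (entry-addTable (outer c v) (gram rs) i j) (cong₂ ℤ._+_ (entry-outer c v v i j) (entry-gram rs i j))

form-sym : ∀ rs i j → form rs i j ≡ form rs j i
form-sym []             i j = refl
form-sym ((c , v) ∷ rs) i j = cong₂ ℤ._+_ (swap (nth 0ℤ v i) (nth 0ℤ v j)) (form-sym rs i j)
  where
  swap : ∀ x y → (+ c ℤ.* x) ℤ.* y ≡ (+ c ℤ.* y) ℤ.* x
  swap x y = trans (ℤₚ.*-assoc (+ c) x y) (trans (cong (ℤ._*_ (+ c)) (ℤₚ.*-comm x y)) (sym (ℤₚ.*-assoc (+ c) y x)))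

entry-sym : ∀ rs i j → entry (gram rs) i j ≡ entry (gram rs) j i
entry-sym rs i j = trans (entry-gram rs i j) (trans (form-sym rs i j) (sym (entry-gram rs j i)))

blockTerm-sym : ∀ blocks root ts x y → blockTerm blocks root ts x y ≡ blockTerm blocks root ts y x
blockTerm-sym []                  root ts x y = refl
blockTerm-sym ((r , s , sq) ∷ bs) root ts x y with root ≡ᵇ r | ts ≡ᵇ s
... | false | _     = blockTerm-sym bs root ts x y
... | true  | false = cong (ℤ._+_ 0ℤ) (blockTerm-sym bs root ts x y)
... | true  | true  = cong₂ ℤ._+_ (entry-sym sq x y) (blockTerm-sym bs root ts x y)

-- Invariance of the sums under relabelling.

lex : ∀ {k} → Vec (Fin 6) k → Vec (Fin 6) k → Bool
lex []       []       = true
lex (x ∷ xs) (y ∷ ys) = if lt x y then true else if lt y x then false else lex xs ys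

insert : Tuple → List Tuple → List Tuple
insert u []       = u ∷ []
insert u (w ∷ ws) = if lex u w then u ∷ w ∷ ws else w ∷ insert u ws

isort : List Tuple → List Tuple
isort []       = []
isort (u ∷ us) = insert u (isort us)

sumℤ-insert : (G : Tuple → ℤ) → ∀ u us → sumℤ (map G (insert u us)) ≡ G u ℤ.+ sumℤ (map G us)
sumℤ-insert G u []       = refl
sumℤ-insert G u (w ∷ ws) with lex u w
... | true  = refl
... | false = trans (cong (ℤ._+_ (G w)) (sumℤ-insert G u ws))
  (trans (sym (ℤₚ.+-assoc (G w) (G u) _)) (trans (cong (ℤ._+ sumℤ (map G ws)) (ℤₚ.+-comm (G w) (G u))) (ℤₚ.+-assoc (G u) (G w) _)))

sumℤ-isort : (G : Tuple → ℤ) → ∀ us → sumℤ (map G (isort us)) ≡ sumℤ (map G us)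
sumℤ-isort G []       = refl
sumℤ-isort G (u ∷ us) = trans (sumℤ-insert G u (isort us)) (cong (ℤ._+_ (G u)) (sumℤ-isort G us))

sumℤ-cong : {A : Set} {f g : A → ℤ} → (∀ u → f u ≡ g u) → ∀ us → sumℤ (map f us) ≡ sumℤ (map g us)
sumℤ-cong e []       = refl
sumℤ-cong e (u ∷ us) = cong₂ ℤ._+_ (e u) (sumℤ-cong e us)

-- Relabelling by `σ` breaks the order conditions by which the tuples were selected; `canon`
-- restores them without changing `G`. The two lists then agree up to order, and sorting turns this
-- into an equality that can be decided by computation.
reindex : (G : Tuple → ℤ) (canon σ : Tuple → Tuple) → (∀ u → G (canon u) ≡ G u) → ∀ us →
          isort (map (canon ∘ σ) us) ≡ isort us → sumℤ (map (G ∘ σ) us) ≡ sumℤ (map G us)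
reindex G canon σ e us p =
  trans (sumℤ-cong (sym ∘ e ∘ σ) us)
  (trans (cong sumℤ (Listₚ.map-∘ us))
  (trans (sym (sumℤ-isort G (map (canon ∘ σ) us)))
  (trans (cong (sumℤ ∘ map G) p) (sumℤ-isort G us))))

orderLast orderMiddle orderPairs canonPair : Tuple → Tuple
orderLast   (p ∷ q ∷ a ∷ b ∷ c ∷ d ∷ []) = if lt d c then p ∷ q ∷ a ∷ b ∷ d ∷ c ∷ [] else p ∷ q ∷ a ∷ b ∷ c ∷ d ∷ []
orderMiddle (p ∷ q ∷ a ∷ b ∷ c ∷ d ∷ []) = if lt b a then p ∷ q ∷ b ∷ a ∷ c ∷ d ∷ [] else p ∷ q ∷ a ∷ b ∷ c ∷ d ∷ []
orderPairs  (p ∷ q ∷ a ∷ b ∷ c ∷ d ∷ []) = if lt c a then p ∷ q ∷ c ∷ d ∷ a ∷ b ∷ [] else p ∷ q ∷ a ∷ b ∷ c ∷ d ∷ []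
-- Both pairs are sorted internally first, because `orderPairs` compares only their first entries.
canonPair = orderPairs ∘ orderMiddle ∘ orderLast

sameTuple : ∀ {k} → Vec (Fin 6) k → Vec (Fin 6) k → Bool
sameTuple []       []       = true
sameTuple (x ∷ xs) (y ∷ ys) = (toℕ x ≡ᵇ toℕ y) ∧ sameTuple xs ys

sameTuple-true : ∀ {k} (xs ys : Vec (Fin 6) k) → sameTuple xs ys ≡ true → xs ≡ ys
sameTuple-true []       []       h = refl
sameTuple-true (x ∷ xs) (y ∷ ys) h = let h₁ , h₂ = ∧-true {toℕ x ≡ᵇ toℕ y} h in
  cong₂ _∷_ (toℕ-injective (ℕₚ.≡ᵇ⇒≡ (toℕ x) (toℕ y) (≡⇒T h₁))) (sameTuple-true xs ys h₂)

sameTuples : List Tuple → List Tuple → Bool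
sameTuples []       []       = true
sameTuples (u ∷ us) (w ∷ ws) = sameTuple u w ∧ sameTuples us ws
sameTuples _        _        = false

sameTuples-true : ∀ us ws → sameTuples us ws ≡ true → us ≡ ws
sameTuples-true []       []       h = refl
sameTuples-true (u ∷ us) (w ∷ ws) h = let h₁ , h₂ = ∧-true {sameTuple u w} h in
  cong₂ _∷_ (sameTuple-true u w h₁) (sameTuples-true us ws h₂)

Invariant : (Tuple → Tuple) → List Tuple → Fin 5 → Bool
Invariant canon us k = sameTuples (isort (map (canon ∘ Vec.map (transposition k)) us)) (isort us)

pairs-invariant : everyFin 5 (Invariant canonPair (tuplesBy pairOrder)) ≡ true
pairs-invariant = refl

quads-invariant : everyFin 5 (Invariant orderLast (tuplesBy quadOrder)) ≡ true
quads-invariant = refl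

swapBits-involutive : ∀ bs → swapBits (swapBits bs) ≡ bs
swapBits-involutive (_ ∷ _ ∷ _ ∷ _ ∷ _ ∷ _ ∷ _ ∷ _ ∷ _ ∷ []) = refl

pairFlag-swap : ∀ e bs → pairFlag e (swapBits bs) ≡ pairFlag e bs
pairFlag-swap e bs = cong (λ n → position n (pairFlags e))
  (trans (cong (λ cs → value (swapBits bs) ℕ.⊓ value cs) (swapBits-involutive bs)) (ℕₚ.⊓-comm (value (swapBits bs)) (value bs)))

if-same : {A : Set} (f : A → ℤ) (b : Bool) {x y : A} → f x ≡ f y → f (if b then x else y) ≡ f y
if-same f true  e = e
if-same f false e = refl

module _ {l : Graph} {t : Fin 6 → Fin 6 → Fin 6 → Bool} (V : Valid l t) where

  flagOf-swap : ∀ p q a b → flagOf pairFlag l t p q b a ≡ flagOf pairFlag l t p q a b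
  flagOf-swap p q a b = trans (cong (pairFlag (l p q)) bits) (pairFlag-swap (l p q) (edgeBits₅ l p q a b Vec.++ tripleBits t p q a b))
    where
    bits : edgeBits₅ l p q b a Vec.++ tripleBits t p q b a ≡ swapBits (edgeBits₅ l p q a b Vec.++ tripleBits t p q a b)
    bits rewrite Valid.l-sym V b a | Valid.t-swapʳ V p b a | Valid.t-swapʳ V q b a = refl

  pair-orderLast : ∀ u → pairTerm l t (orderLast u) ≡ pairTerm l t u
  pair-orderLast (p ∷ q ∷ a ∷ b ∷ c ∷ d ∷ []) = if-same (pairTerm l t) (lt d c)
    (cong (entry (gram (pairSquares (l p q))) (flagOf pairFlag l t p q a b)) (flagOf-swap p q c d))

  pair-orderMiddle : ∀ u → pairTerm l t (orderMiddle u) ≡ pairTerm l t u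
  pair-orderMiddle (p ∷ q ∷ a ∷ b ∷ c ∷ d ∷ []) = if-same (pairTerm l t) (lt b a)
    (cong (λ x → entry (gram (pairSquares (l p q))) x (flagOf pairFlag l t p q c d)) (flagOf-swap p q a b))

  pair-orderPairs : ∀ u → pairTerm l t (orderPairs u) ≡ pairTerm l t u
  pair-orderPairs (p ∷ q ∷ a ∷ b ∷ c ∷ d ∷ []) = if-same (pairTerm l t) (lt c a)
    (entry-sym (pairSquares (l p q)) (flagOf pairFlag l t p q c d) (flagOf pairFlag l t p q a b))

  pair-canon : ∀ u → pairTerm l t (canonPair u) ≡ pairTerm l t u
  pair-canon u = trans (pair-orderPairs (orderMiddle (orderLast u))) (trans (pair-orderMiddle (orderLast u)) (pair-orderLast u))

  quad-canon : ∀ blocks u → quadTerm blocks l t (orderLast u) ≡ quadTerm blocks l t u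
  quad-canon blocks (a ∷ b ∷ c ∷ d ∷ u ∷ v ∷ []) = if-same (quadTerm blocks l t) (lt v u)
    (cong (ℤ._+_ (weight (t a b c))) (blockTerm-sym blocks (value (edgeBits₆ l a b c d))
      (value (tripleBits t a b c d)) (value (starBits l a b c d v)) (value (starBits l a b c d u))))

pairTerm-map : {X Y : Set} (l : X → X → Bool) (t : X → X → X → Bool) (h : Y → X) → ∀ u →
               pairTerm (λ i j → l (h i) (h j)) (λ i j k → t (h i) (h j) (h k)) u ≡ pairTerm l t (Vec.map h u)
pairTerm-map l t h (p ∷ q ∷ a ∷ b ∷ c ∷ d ∷ []) = refl

quadTerm-map : {X Y : Set} (l : X → X → Bool) (t : X → X → X → Bool) (h : Y → X) → ∀ blocks u →
               quadTerm blocks (λ i j → l (h i) (h j)) (λ i j k → t (h i) (h j) (h k)) u ≡ quadTerm blocks l t (Vec.map h u)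
quadTerm-map l t h blocks (a ∷ b ∷ c ∷ d ∷ u ∷ v ∷ []) = refl

sums : (List (ℕ × ℕ × List Square)) → List Tuple → List Tuple → (l : Graph) (t : Fin 6 → Fin 6 → Fin 6 → Bool) → ℤ
sums blocks us ws l t = sumℤ (map (quadTerm blocks l t) us) ℤ.+ sumℤ (map (pairTerm l t) ws)

sums-transposition : ∀ blocks us ws → everyFin 5 (Invariant orderLast us) ≡ true → everyFin 5 (Invariant canonPair ws) ≡ true →
  ∀ {l t} → Valid l t → ∀ k →
  sums blocks us ws (λ i j → l (transposition k i) (transposition k j))
    (λ i j m → t (transposition k i) (transposition k j) (transposition k m)) ≡ sums blocks us ws l t
sums-transposition blocks us ws inv₁ inv₂ {l} {t} V k = cong₂ ℤ._+_
  (trans (sumℤ-cong (quadTerm-map l t (transposition k) blocks) us)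
         (reindex (quadTerm blocks l t) orderLast (Vec.map (transposition k)) (quad-canon V blocks) us
           (sameTuples-true _ _ (everyFin-true 5 (Invariant orderLast us) inv₁ k))))
  (trans (sumℤ-cong (pairTerm-map l t (transposition k)) ws)
         (reindex (pairTerm l t) canonPair (Vec.map (transposition k)) (pair-canon V) ws
           (sameTuples-true _ _ (everyFin-true 5 (Invariant canonPair ws) inv₂ k))))

module _ {l l′ : Graph} (e : ∀ i j → l i j ≡ l′ i j) (t : Fin 6 → Fin 6 → Fin 6 → Bool) where

  edgeBits₅-cong : ∀ p q a b → edgeBits₅ l p q a b ≡ edgeBits₅ l′ p q a b
  edgeBits₅-cong p q a b rewrite e p a | e p b | e q a | e q b | e a b = refl

  flagOf-cong : ∀ p q a b → flagOf pairFlag l t p q a b ≡ flagOf pairFlag l′ t p q a b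
  flagOf-cong p q a b = cong₂ (λ x bs → pairFlag x (bs Vec.++ tripleBits t p q a b)) (e p q) (edgeBits₅-cong p q a b)

  pairTerm-cong : ∀ u → pairTerm l t u ≡ pairTerm l′ t u
  pairTerm-cong (p ∷ q ∷ a ∷ b ∷ c ∷ d ∷ []) = trans
    (cong₂ (entry (gram (pairSquares (l p q)))) (flagOf-cong p q a b) (flagOf-cong p q c d))
    (cong (λ x → entry (gram (pairSquares x)) (flagOf pairFlag l′ t p q a b) (flagOf pairFlag l′ t p q c d)) (e p q))

  edgeBits₆-cong : ∀ a b c d → edgeBits₆ l a b c d ≡ edgeBits₆ l′ a b c d
  edgeBits₆-cong a b c d rewrite e a b | e a c | e a d | e b c | e b d | e c d = refl

  starBits-cong : ∀ a b c d u → starBits l a b c d u ≡ starBits l′ a b c d u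
  starBits-cong a b c d u rewrite e a u | e b u | e c u | e d u = refl

  quadTerm-cong : ∀ blocks u → quadTerm blocks l t u ≡ quadTerm blocks l′ t u
  quadTerm-cong blocks (a ∷ b ∷ c ∷ d ∷ u ∷ v ∷ []) = cong (ℤ._+_ (weight (t a b c)))
    (trans (cong (λ x → blockTerm blocks (value x) (value (tripleBits t a b c d)) (value (starBits l a b c d u)) (value (starBits l a b c d v)))
             (edgeBits₆-cong a b c d))
           (cong₂ (λ x y → blockTerm blocks (value (edgeBits₆ l′ a b c d)) (value (tripleBits t a b c d)) (value x) (value y))
             (starBits-cong a b c d u) (starBits-cong a b c d v)))

  sums-cong : ∀ blocks us ws → sums blocks us ws l t ≡ sums blocks us ws l′ t
  sums-cong blocks us ws = cong₂ ℤ._+_ (sumℤ-cong (quadTerm-cong blocks) us) (sumℤ-cong pairTerm-cong ws)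

-- The certified bound on six vertices.

opaque
  unfolding scale

  -- The finite verification itself, by evaluation over all 2^15 graphs. It is the one place that
  -- looks at the numeral behind `scale`.
  certified : everyTri 6
    (checkGraph (tuplesBy codegOrder) (tuplesBy k4Order) (tuplesBy f32Order) (tuplesBy pairOrder) (tuplesBy quadOrder)
      (select (tabulateᵗ (pairFlag false)) (tabulateᵗ (pairFlag true)))
      (select (gram nonedgeSquares) (gram edgeSquares)) (map tabulateBlock quadBlocks)) ≡ true
  certified = refl

select-look : (f : Bool → Vec Bool 9 → ℕ) → ∀ e bs →
              look (select (tabulateᵗ (f false)) (tabulateᵗ (f true)) e) bs ≡ f e bs
select-look f false bs = look-tabulate (f false) bs
select-look f true  bs = look-tabulate (f true) bs

select-gram : ∀ (A B : List Square) e → select (gram A) (gram B) e ≡ gram (select A B e)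
select-gram A B false = refl
select-gram A B true  = refl

triangle-found : ∀ {l t} → Valid l t → hasTriangle l ≡ true → ⊥
triangle-found {l} V h =
  let i , h₁ = anyᵇ-true (λ i → anyᵇ (λ j → l i j ∧ anyᵇ (λ k → l i k ∧ l j k) (allFin 6)) (allFin 6)) (allFin 6) h
      j , h₂ = anyᵇ-true (λ j → l i j ∧ anyᵇ (λ k → l i k ∧ l j k) (allFin 6)) (allFin 6) h₁
      e , h₃ = ∧-true {l i j} h₂
      k , h₄ = anyᵇ-true (λ k → l i k ∧ l j k) (allFin 6) h₃
      e₁ , e₂ = ∧-true {l i k} h₄
  in Valid.triangle V i j k e e₁ e₂

check-sound : ∀ t₁ t₂ t₃ ts₂ ts₄ flag → (∀ e bs → look (flag e) bs ≡ pairFlag e bs) →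
  ∀ table → (∀ e → table e ≡ gram (pairSquares e)) → ∀ blocks L {t} → Valid (adj L) t →
  checkGraph t₁ t₂ t₃ ts₂ ts₄ flag table (map tabulateBlock blocks) L ≡ true →
  reducible L ≡ true ⊎ sums blocks ts₄ ts₂ (adj L) t ℤ.≤ bound
check-sound t₁ t₂ t₃ ts₂ ts₄ flag spec table spec′ blocks L V h =
  [ (λ e → ⊥-elim (triangle-found V e)) ,
    (λ h′ → map₂ (leaves-sound V t₁ t₂ t₃ ts₂ ts₄ flag spec table spec′ blocks) (∨-true {reducible L} h′)) ]′
  (∨-true {hasTriangle (adj L)} h)

adj-lowered : ∀ L k {t} → Valid (adj L) t → ∀ i j → adj (lowered L k) i j ≡ adj L (transposition k i) (transposition k j)
adj-lowered L k V = adj-fromAdj (λ i j → adj L (transposition k i) (transposition k j)) (λ i j → Valid.l-sym V (transposition k i) (transposition k j)) (λ i → Valid.l-irrefl V (transposition k i))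

module _ (blocks : List (ℕ × ℕ × List Square)) (us ws : List Tuple)
         (inv₁ : everyFin 5 (Invariant orderLast us) ≡ true) (inv₂ : everyFin 5 (Invariant canonPair ws) ≡ true)
         (checked : ∀ L {t} → Valid (adj L) t → reducible L ≡ true ⊎ sums blocks us ws (adj L) t ℤ.≤ bound) where

  -- Descent on `triCode`. A reducible graph is relabelled together with its marked triples; the
  -- code drops and the sums do not change. Since the marked triples move as well, `t` is quantified
  -- after the accessibility proof.
  tri-bounded : ∀ L → Acc ℕ._<_ (triCode L) → ∀ {t} → Valid (adj L) t → sums blocks us ws (adj L) t ℤ.≤ bound
  tri-bounded L (acc smaller) {t} V = [ descend ∘ anyᵇ-true (λ k → triCode (lowered L k) <ᵇ triCode L) (allFin 5) , (λ h → h) ]′ (checked L V)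
    where
    descend : (∃ λ k → (triCode (lowered L k) <ᵇ triCode L) ≡ true) → sums blocks us ws (adj L) t ℤ.≤ bound
    descend (k , r) = subst (ℤ._≤ bound)
      (trans (sums-cong same (λ i j m → t (transposition k i) (transposition k j) (transposition k m)) blocks us ws)
             (sums-transposition blocks us ws inv₁ inv₂ V k))
      (tri-bounded (lowered L k) (smaller {triCode (lowered L k)} (ℕₚ.<ᵇ⇒< (triCode (lowered L k)) (triCode L) (≡⇒T r)))
        (valid-cong (λ i j → sym (same i j)) (pullback V (transposition k))))
      where
      same : ∀ i j → adj (lowered L k) i j ≡ adj L (transposition k i) (transposition k j)
      same = adj-lowered L k V

  sums-bounded : ∀ {l t} → Valid l t → sums blocks us ws l t ℤ.≤ bound
  sums-bounded {l} {t} V = subst (ℤ._≤ bound) (sums-cong agree t blocks us ws)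
      (tri-bounded (fromAdj l) (<-wellFounded (triCode (fromAdj l))) (valid-cong (λ i j → sym (agree i j)) V))
    where
    agree : ∀ i j → adj (fromAdj l) i j ≡ l i j
    agree = adj-fromAdj l (Valid.l-sym V) (Valid.l-irrefl V)

-- Tuple lists and tables are variables here, so that the deduction is checked without evaluating
-- them.
every-check-sound : ∀ t₁ t₂ t₃ ts₂ ts₄ flag → (∀ e bs → look (flag e) bs ≡ pairFlag e bs) →
  ∀ table → (∀ e → table e ≡ gram (pairSquares e)) → ∀ blocks →
  everyTri 6 (checkGraph t₁ t₂ t₃ ts₂ ts₄ flag table (map tabulateBlock blocks)) ≡ true →
  everyFin 5 (Invariant orderLast ts₄) ≡ true → everyFin 5 (Invariant canonPair ts₂) ≡ true →
  ∀ {l t} → Valid l t → sums blocks ts₄ ts₂ l t ℤ.≤ bound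
every-check-sound t₁ t₂ t₃ ts₂ ts₄ flag spec table spec′ blocks h inv₁ inv₂ {l} V =
  sums-bounded blocks ts₄ ts₂ inv₁ inv₂
    (λ L V′ → check-sound t₁ t₂ t₃ ts₂ ts₄ flag spec table spec′ blocks L V′
      (everyTri-true 6 (checkGraph t₁ t₂ t₃ ts₂ ts₄ flag table (map tabulateBlock blocks)) h L))
    V

total-bounded : ∀ {l t} → Valid l t → sums quadBlocks (tuplesBy quadOrder) (tuplesBy pairOrder) l t ℤ.≤ bound
total-bounded = every-check-sound (tuplesBy codegOrder) (tuplesBy k4Order) (tuplesBy f32Order) (tuplesBy pairOrder) (tuplesBy quadOrder)
  (select (tabulateᵗ (pairFlag false)) (tabulateᵗ (pairFlag true))) (select-look pairFlag)
  (select (gram nonedgeSquares) (gram edgeSquares)) (select-gram nonedgeSquares edgeSquares) quadBlocks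
  certified quads-invariant pairs-invariant

-- Sums over tuples of vertices.

sum : ∀ {n} → (Fin n → ℤ) → ℤ
sum {zero}  f = 0ℤ
sum {suc n} f = f zero ℤ.+ sum (f ∘ suc)

sum-cong-≗ : ∀ {n} {f g : Fin n → ℤ} → (∀ i → f i ≡ g i) → sum f ≡ sum g
sum-cong-≗ {zero}  h = refl
sum-cong-≗ {suc n} h = cong₂ ℤ._+_ (h zero) (sum-cong-≗ (h ∘ suc))

interchange : ∀ a b c d → (a ℤ.+ b) ℤ.+ (c ℤ.+ d) ≡ (a ℤ.+ c) ℤ.+ (b ℤ.+ d)
interchange = solve 4 (λ a b c d → (a :+ b) :+ (c :+ d) := (a :+ c) :+ (b :+ d)) refl

∑-distrib-+ : ∀ {n} (f g : Fin n → ℤ) → sum (λ i → f i ℤ.+ g i) ≡ sum f ℤ.+ sum g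
∑-distrib-+ {zero}  f g = refl
∑-distrib-+ {suc n} f g = trans (cong (ℤ._+_ (f zero ℤ.+ g zero)) (∑-distrib-+ (f ∘ suc) (g ∘ suc)))
  (interchange (f zero) (g zero) (sum (f ∘ suc)) (sum (g ∘ suc)))

*-distribˡ-sum : ∀ {n} c (f : Fin n → ℤ) → c ℤ.* sum f ≡ sum (λ i → c ℤ.* f i)
*-distribˡ-sum {zero}  c f = ℤₚ.*-zeroʳ c
*-distribˡ-sum {suc n} c f = trans (ℤₚ.*-distribˡ-+ c (f zero) (sum (f ∘ suc))) (cong (ℤ._+_ (c ℤ.* f zero)) (*-distribˡ-sum c (f ∘ suc)))

*-distribʳ-sum : ∀ {n} c (f : Fin n → ℤ) → sum f ℤ.* c ≡ sum (λ i → f i ℤ.* c)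
*-distribʳ-sum c f = trans (ℤₚ.*-comm (sum f) c) (trans (*-distribˡ-sum c f) (sum-cong-≗ λ i → ℤₚ.*-comm c (f i)))

sum-const : ∀ n x → sum {n} (λ _ → x) ≡ + n ℤ.* x
sum-const zero    x = sym (ℤₚ.*-zeroˡ x)
sum-const (suc n) x = trans (cong (ℤ._+_ x) (sum-const n x)) (sym (ℤₚ.suc-* (+ n) x))

sum-zero : ∀ n → sum {n} (λ _ → 0ℤ) ≡ 0ℤ
sum-zero n = trans (sum-const n 0ℤ) (ℤₚ.*-zeroʳ (+ n))

∑-comm : ∀ {m n} (f : Fin m → Fin n → ℤ) → sum (λ i → sum (f i)) ≡ sum (λ j → sum λ i → f i j)
∑-comm {zero}  {n} f = sym (sum-zero n)
∑-comm {suc m} {n} f = trans (cong (ℤ._+_ (sum (f zero))) (∑-comm (f ∘ suc))) (sym (∑-distrib-+ (f zero) (λ j → sum λ i → f (suc i) j)))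

sum-mono : ∀ {n} {f g : Fin n → ℤ} → (∀ i → f i ℤ.≤ g i) → sum f ℤ.≤ sum g
sum-mono {zero}  h = ℤₚ.≤-refl
sum-mono {suc n} h = ℤₚ.+-mono-≤ (h zero) (sum-mono (h ∘ suc))

opaque
  ∑ᵛ : ∀ {n} k → (Vec (Fin n) k → ℤ) → ℤ
  ∑ᵛ     zero    f = f []
  ∑ᵛ {n} (suc k) f = sum {n} λ i → ∑ᵛ k λ v → f (i ∷ v)

  ∑ᵛ-mono : ∀ {n} k {f g : Vec (Fin n) k → ℤ} → (∀ v → f v ℤ.≤ g v) → ∑ᵛ k f ℤ.≤ ∑ᵛ k g
  ∑ᵛ-mono zero    h = h []
  ∑ᵛ-mono (suc k) h = sum-mono λ i → ∑ᵛ-mono k λ v → h (i ∷ v)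

  ∑ᵛ-cong : ∀ {n} k {f g : Vec (Fin n) k → ℤ} → (∀ v → f v ≡ g v) → ∑ᵛ k f ≡ ∑ᵛ k g
  ∑ᵛ-cong zero    h = h []
  ∑ᵛ-cong (suc k) h = sum-cong-≗ λ i → ∑ᵛ-cong k λ v → h (i ∷ v)

  ∑ᵛ-+ : ∀ {n} k (f g : Vec (Fin n) k → ℤ) → ∑ᵛ k (λ v → f v ℤ.+ g v) ≡ ∑ᵛ k f ℤ.+ ∑ᵛ k g
  ∑ᵛ-+ zero    f g = refl
  ∑ᵛ-+ (suc k) f g = trans (sum-cong-≗ λ i → ∑ᵛ-+ k (λ v → f (i ∷ v)) (λ v → g (i ∷ v))) (∑-distrib-+ (λ i → ∑ᵛ k λ v → f (i ∷ v)) (λ i → ∑ᵛ k λ v → g (i ∷ v)))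

  ∑ᵛ-*ˡ : ∀ {n} k c (f : Vec (Fin n) k → ℤ) → ∑ᵛ k (λ v → c ℤ.* f v) ≡ c ℤ.* ∑ᵛ k f
  ∑ᵛ-*ˡ zero    c f = refl
  ∑ᵛ-*ˡ (suc k) c f = trans (sum-cong-≗ λ i → ∑ᵛ-*ˡ k c (λ v → f (i ∷ v))) (sym (*-distribˡ-sum c (λ i → ∑ᵛ k λ v → f (i ∷ v))))

  ∑ᵛ-*ʳ : ∀ {n} k c (f : Vec (Fin n) k → ℤ) → ∑ᵛ k (λ v → f v ℤ.* c) ≡ ∑ᵛ k f ℤ.* c
  ∑ᵛ-*ʳ k c f = trans (∑ᵛ-cong k λ v → ℤₚ.*-comm (f v) c) (trans (∑ᵛ-*ˡ k c f) (ℤₚ.*-comm c _))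

  ∑ᵛ-const : ∀ {n} k x → ∑ᵛ {n} k (λ _ → x) ≡ + (n ℕ.^ k) ℤ.* x
  ∑ᵛ-const {n} zero    x = sym (ℤₚ.*-identityˡ x)
  ∑ᵛ-const {n} (suc k) x = trans (sum-cong-≗ {n} λ _ → ∑ᵛ-const k x) (trans (sum-const n _)
    (trans (sym (ℤₚ.*-assoc (+ n) (+ (n ℕ.^ k)) x)) (cong (ℤ._* x) (sym (ℤₚ.pos-* n (n ℕ.^ k))))))

  ∑ᵛ-zero : ∀ {n} k → ∑ᵛ {n} k (λ _ → 0ℤ) ≡ 0ℤ
  ∑ᵛ-zero {n} k = trans (∑ᵛ-const {n} k 0ℤ) (ℤₚ.*-zeroʳ (+ (n ℕ.^ k)))

  ∑ᵛ-nonneg : ∀ {n} k {f : Vec (Fin n) k → ℤ} → (∀ v → 0ℤ ℤ.≤ f v) → 0ℤ ℤ.≤ ∑ᵛ k f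
  ∑ᵛ-nonneg {n} k {f} h = ℤₚ.≤-trans (ℤₚ.≤-reflexive (sym (∑ᵛ-zero {n} k))) (∑ᵛ-mono k h)

  ∑ᵛ-swap : ∀ {m n} k (f : Fin m → Vec (Fin n) k → ℤ) → sum (λ i → ∑ᵛ k (f i)) ≡ ∑ᵛ k (λ v → sum λ i → f i v)
  ∑ᵛ-swap zero    f = refl
  ∑ᵛ-swap (suc k) f = trans (∑-comm (λ i j → ∑ᵛ k λ v → f i (j ∷ v))) (sum-cong-≗ λ j → ∑ᵛ-swap k (λ i v → f i (j ∷ v)))

  ∑ᵛ-insert : ∀ {n} k (j : Fin (suc k)) (f : Vec (Fin n) (suc k) → ℤ) →
              ∑ᵛ (suc k) f ≡ ∑ᵛ k (λ v → sum λ i → f (insertAt v j i))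
  ∑ᵛ-insert k       zero    f = ∑ᵛ-swap k (λ i v → f (i ∷ v))
  ∑ᵛ-insert (suc k) (suc j) f = sum-cong-≗ λ x → ∑ᵛ-insert k j (λ w → f (x ∷ w))

  -- Permuting coordinates only reorders nested sums: each insertion of the code moves one summation
  -- variable, by `∑ᵛ-insert`.
  ∑ᵛ-permute : ∀ {n} k (c : Code k) (f : Vec (Fin n) k → ℤ) → ∑ᵛ k (f ∘ permute c) ≡ ∑ᵛ k f
  ∑ᵛ-permute zero    c       f = refl
  ∑ᵛ-permute (suc k) (j , c) f =
    trans (∑ᵛ-swap k (λ i v → f (insertAt (permute c v) j i)))
    (trans (∑ᵛ-permute k c (λ v → sum λ i → f (insertAt v j i))) (sym (∑ᵛ-insert k j f)))

insertAt-map : {A B : Set} (h : A → B) → ∀ {k} (v : Vec A k) j x → insertAt (Vec.map h v) j (h x) ≡ Vec.map h (insertAt v j x)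
insertAt-map h v       zero    x = refl
insertAt-map h (y ∷ v) (suc j) x = cong (h y ∷_) (insertAt-map h v j x)

permute-map : {A B : Set} (h : A → B) → ∀ {k} (c : Code k) (v : Vec A k) → permute c (Vec.map h v) ≡ Vec.map h (permute c v)
permute-map h c       []      = refl
permute-map h (j , c) (x ∷ v) = trans (cong (λ w → insertAt w j (h x)) (permute-map h c v)) (insertAt-map h (permute c v) j x)

map-tuple : {A : Set} (v : Vec A 6) → ∀ c → Vec.map (Vec.lookup v) (tuple c) ≡ permute c v
map-tuple v c = trans (sym (permute-map (Vec.lookup v) c (Vec.allFin 6))) (cong (permute c) (map-lookup-allFin v))

-- Reading `v` through a fixed ordering permutes its coordinates, so every selected ordering
-- contributes the full sum of `h`.
∑ᵛ-tuples : ∀ {n} (h : Vec (Fin n) 6 → ℤ) (ok : Tuple → Bool) (cs : List (Code 6)) →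
  ∑ᵛ 6 (λ v → sumℤ (map (λ u → h (Vec.map (Vec.lookup v) u)) (filterᵇ ok (map tuple cs))))
  ≡ + length (filterᵇ ok (map tuple cs)) ℤ.* ∑ᵛ 6 h
∑ᵛ-tuples {n} h ok []       = trans (∑ᵛ-zero {n} 6) (sym (ℤₚ.*-zeroˡ (∑ᵛ 6 h)))
∑ᵛ-tuples h ok (c ∷ cs) with ok (tuple c)
... | false = ∑ᵛ-tuples h ok cs
... | true  = trans (∑ᵛ-+ 6 (λ v → h (Vec.map (Vec.lookup v) (tuple c))) _)
  (trans (cong₂ ℤ._+_ (trans (∑ᵛ-cong 6 λ v → cong h (map-tuple v c)) (∑ᵛ-permute 6 c h)) (∑ᵛ-tuples h ok cs))
         (sym (ℤₚ.suc-* (+ length (filterᵇ ok (map tuple cs))) (∑ᵛ 6 h))))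

-- Nonnegativity of the squares and the averaged bound.

square-nonneg : ∀ x → 0ℤ ℤ.≤ x ℤ.* x
square-nonneg (+ n)      = subst (0ℤ ℤ.≤_) (ℤₚ.pos-* n n) (ℤ.+≤+ ℕ.z≤n)
square-nonneg (-[1+ n ]) = ℤ.+≤+ ℕ.z≤n

-- The double sum factors: a square `(c , r)` contributes `c` times the square of the single sum of
-- its linear form.
form-nonneg : ∀ {n} e rs (x : Vec (Fin n) e → ℕ) → 0ℤ ℤ.≤ ∑ᵛ e λ v → ∑ᵛ e λ w → form rs (x v) (x w)
form-nonneg {n} e []             x = ∑ᵛ-nonneg e λ v → ∑ᵛ-nonneg e λ w → ℤₚ.≤-refl
form-nonneg {n} e ((c , r) ∷ rs) x = subst (0ℤ ℤ.≤_) (sym quad-split) (ℤₚ.+-mono-≤ nonneg (form-nonneg e rs x))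
  where
  g : Vec (Fin n) e → ℤ
  g v = nth 0ℤ r (x v)
  s = ∑ᵛ e g
  product : ∑ᵛ e (λ v → ∑ᵛ e λ w → (+ c ℤ.* g v) ℤ.* g w) ≡ + c ℤ.* (s ℤ.* s)
  product = trans (∑ᵛ-cong e λ v → ∑ᵛ-*ˡ e (+ c ℤ.* g v) g)
    (trans (∑ᵛ-*ʳ e s (λ v → + c ℤ.* g v)) (trans (cong (ℤ._* s) (∑ᵛ-*ˡ e (+ c) g)) (ℤₚ.*-assoc (+ c) s s)))
  nonneg : 0ℤ ℤ.≤ ∑ᵛ e (λ v → ∑ᵛ e λ w → (+ c ℤ.* g v) ℤ.* g w)
  nonneg = subst (0ℤ ℤ.≤_) (sym product)
    (subst (ℤ._≤ + c ℤ.* (s ℤ.* s)) (ℤₚ.*-zeroʳ (+ c)) (ℤₚ.*-monoˡ-≤-nonNeg (+ c) (square-nonneg s)))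
  quad-split = trans (∑ᵛ-cong e λ v → ∑ᵛ-+ e (λ w → (+ c ℤ.* g v) ℤ.* g w) (λ w → form rs (x v) (x w)))
                (∑ᵛ-+ e (λ v → ∑ᵛ e λ w → (+ c ℤ.* g v) ℤ.* g w) (λ v → ∑ᵛ e λ w → form rs (x v) (x w)))

entry-nonneg : ∀ {n} e rs (x : Vec (Fin n) e → ℕ) → 0ℤ ℤ.≤ ∑ᵛ e λ v → ∑ᵛ e λ w → entry (gram rs) (x v) (x w)
entry-nonneg e rs x = subst (0ℤ ℤ.≤_) (∑ᵛ-cong e λ v → ∑ᵛ-cong e λ w → sym (entry-gram rs (x v) (x w))) (form-nonneg e rs x)

block-nonneg : ∀ {n} e blocks root ts (x : Vec (Fin n) e → ℕ) → 0ℤ ℤ.≤ ∑ᵛ e λ v → ∑ᵛ e λ w → blockTerm blocks root ts (x v) (x w)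
block-nonneg e []                  root ts x = ∑ᵛ-nonneg e λ v → ∑ᵛ-nonneg e λ w → ℤₚ.≤-refl
block-nonneg e ((r , s , sq) ∷ bs) root ts x with root ≡ᵇ r | ts ≡ᵇ s
... | false | _     = block-nonneg e bs root ts x
... | true  | false = subst (0ℤ ℤ.≤_) (∑ᵛ-cong e λ v → ∑ᵛ-cong e λ w → sym (ℤₚ.+-identityˡ _)) (block-nonneg e bs root ts x)
... | true  | true  = subst (0ℤ ℤ.≤_)
  (sym (trans (∑ᵛ-cong e λ v → ∑ᵛ-+ e (λ w → entry (gram sq) (x v) (x w)) (λ w → blockTerm bs root ts (x v) (x w)))
              (∑ᵛ-+ e (λ v → ∑ᵛ e λ w → entry (gram sq) (x v) (x w)) (λ v → ∑ᵛ e λ w → blockTerm bs root ts (x v) (x w)))))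
  (ℤₚ.+-mono-≤ (entry-nonneg e sq x) (block-nonneg e bs root ts x))

bitᵛ : ∀ {n} → (Fin n → Fin n → Fin n → Bool) → Vec (Fin n) 3 → ℤ
bitᵛ t (a ∷ b ∷ c ∷ []) = + bit (t a b c)

tripleCount : ∀ {n} → (Fin n → Fin n → Fin n → Bool) → ℤ
tripleCount t = ∑ᵛ 3 (bitᵛ t)

opaque
  unfolding ∑ᵛ

  ∑ᵛ-empty : ∀ k (f : Vec (Fin 0) (suc k) → ℤ) → ∑ᵛ (suc k) f ≡ 0ℤ
  ∑ᵛ-empty k f = refl

weight-bit : ∀ b → weight b ≡ + scale ℤ.* + bit b
weight-bit true  = sym (ℤₚ.*-identityʳ (+ scale))
weight-bit false = sym (ℤₚ.*-zeroʳ (+ scale))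

module _ {n : ℕ} {l : Fin n → Fin n → Bool} {t : Fin n → Fin n → Fin n → Bool} (V : Valid l t) where

  opaque
    unfolding ∑ᵛ

    pairs-nonneg : 0ℤ ℤ.≤ ∑ᵛ 6 (pairTerm l t)
    -- Unfolded, the sum over six vertices runs over the two roots, then over two independent pairs;
    -- for fixed roots it is the quadratic form of the certificate in the flag counts.
    pairs-nonneg = ∑ᵛ-nonneg 2 {λ { (p ∷ q ∷ []) → ∑ᵛ 4 λ v → pairTerm l t (p ∷ q ∷ v) }} λ { (p ∷ q ∷ []) →
      entry-nonneg 2 (pairSquares (l p q)) (λ { (a ∷ b ∷ []) → flagOf pairFlag l t p q a b }) }

  weightᵛ : Vec (Fin n) 3 → ℤ
  weightᵛ (a ∷ b ∷ c ∷ []) = weight (t a b c)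

  weightᵛ-bitᵛ : ∀ v → + (n ℕ.^ 3) ℤ.* weightᵛ v ≡ (+ scale ℤ.* + (n ℕ.^ 3)) ℤ.* bitᵛ t v
  weightᵛ-bitᵛ (a ∷ b ∷ c ∷ []) = trans (cong (ℤ._*_ (+ (n ℕ.^ 3))) (weight-bit (t a b c)))
    (regroup (+ (n ℕ.^ 3)) (+ scale) (+ bit (t a b c)))
    where
    regroup : ∀ x y z → x ℤ.* (y ℤ.* z) ≡ (y ℤ.* x) ℤ.* z
    regroup x y z = trans (sym (ℤₚ.*-assoc x y z)) (cong (ℤ._* z) (ℤₚ.*-comm x y))

  module _ (blocks : List (ℕ × ℕ × List Square)) where
    blockRest : Vec (Fin n) 3 → Vec (Fin n) 3 → ℤ
    blockRest (a ∷ b ∷ c ∷ []) (d ∷ u ∷ v ∷ []) =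
      blockTerm blocks (value (edgeBits₆ l a b c d)) (value (tripleBits t a b c d)) (value (starBits l a b c d u)) (value (starBits l a b c d v))

    opaque
      unfolding ∑ᵛ

      -- The weight depends on the first three vertices only, so the fourth root `d` is summed
      -- together with the extensions; for each `d` the sum over `u` and `v` is a nonnegative form.
      blockRest-nonneg : ∀ w → 0ℤ ℤ.≤ ∑ᵛ 3 (blockRest w)
      blockRest-nonneg (a ∷ b ∷ c ∷ []) = ∑ᵛ-nonneg 1 {λ { (d ∷ []) → ∑ᵛ 2 λ v → blockRest (a ∷ b ∷ c ∷ []) (d ∷ v) }} λ { (d ∷ []) →
        block-nonneg 1 blocks (value (edgeBits₆ l a b c d)) (value (tripleBits t a b c d)) (λ { (u ∷ []) → value (starBits l a b c d u) }) }

      quad-split : ∑ᵛ 6 (quadTerm blocks l t) ≡ ∑ᵛ 3 (λ w → + (n ℕ.^ 3) ℤ.* weightᵛ w ℤ.+ ∑ᵛ 3 (blockRest w))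
      quad-split = ∑ᵛ-cong 3 {λ { (a ∷ b ∷ c ∷ []) → ∑ᵛ 3 λ v → quadTerm blocks l t (a ∷ b ∷ c ∷ v) }} {λ w → + (n ℕ.^ 3) ℤ.* weightᵛ w ℤ.+ ∑ᵛ 3 (blockRest w)} λ { w@(a ∷ b ∷ c ∷ []) →
        trans (∑ᵛ-cong 3 {λ v → quadTerm blocks l t (a ∷ b ∷ c ∷ v)} {λ v → weightᵛ w ℤ.+ blockRest w v} λ { (d ∷ u ∷ v ∷ []) → refl })
          (trans (∑ᵛ-+ 3 (λ _ → weightᵛ w) (blockRest w)) (cong (ℤ._+ ∑ᵛ 3 (blockRest w)) (∑ᵛ-const {n} 3 (weightᵛ w)))) }

    -- Dropping the nonnegative squares leaves the weights, each repeated once for every choice of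
    -- the last three vertices.
    quads-bounded : (+ scale ℤ.* + (n ℕ.^ 3)) ℤ.* tripleCount t ℤ.≤ ∑ᵛ 6 (quadTerm blocks l t)
    quads-bounded = ℤₚ.≤-trans (ℤₚ.≤-reflexive counted) (ℤₚ.≤-trans
      (∑ᵛ-mono 3 {λ w → + (n ℕ.^ 3) ℤ.* weightᵛ w} {λ w → + (n ℕ.^ 3) ℤ.* weightᵛ w ℤ.+ ∑ᵛ 3 (blockRest w)} λ w →
        subst (ℤ._≤ + (n ℕ.^ 3) ℤ.* weightᵛ w ℤ.+ ∑ᵛ 3 (blockRest w)) (ℤₚ.+-identityʳ (+ (n ℕ.^ 3) ℤ.* weightᵛ w))
          (ℤₚ.+-monoʳ-≤ (+ (n ℕ.^ 3) ℤ.* weightᵛ w) (blockRest-nonneg w)))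
      (ℤₚ.≤-reflexive (sym quad-split)))
      where
      counted : (+ scale ℤ.* + (n ℕ.^ 3)) ℤ.* tripleCount t ≡ ∑ᵛ 3 (λ w → + (n ℕ.^ 3) ℤ.* weightᵛ w)
      counted = trans (sym (∑ᵛ-*ˡ 3 (+ scale ℤ.* + (n ℕ.^ 3)) (bitᵛ t))) (∑ᵛ-cong 3 (sym ∘ weightᵛ-bitᵛ))

tuples-sum : ∀ {n} (h : Vec (Fin n) 6 → ℤ) us ok cs → us ≡ filterᵇ ok (map tuple cs) →
  ∑ᵛ 6 (λ v → sumℤ (map (λ u → h (Vec.map (Vec.lookup v) u)) us)) ≡ + length us ℤ.* ∑ᵛ 6 h
tuples-sum h _ ok cs refl = ∑ᵛ-tuples h ok cs

-- The six-vertex bound applies to the structure pulled back along every `v`, injective or not;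
-- these bounds are summed over all `n ^ 6` choices.
totals-bounded : ∀ blocks us ws ok₁ ok₂ cs → us ≡ filterᵇ ok₁ (map tuple cs) → ws ≡ filterᵇ ok₂ (map tuple cs) →
  (∀ {l t} → Valid l t → sums blocks us ws l t ℤ.≤ bound) →
  ∀ {n} {l : Fin n → Fin n → Bool} {t : Fin n → Fin n → Fin n → Bool} → Valid l t →
  + length us ℤ.* ∑ᵛ 6 (quadTerm blocks l t) ℤ.+ + length ws ℤ.* ∑ᵛ 6 (pairTerm l t) ℤ.≤ + (n ℕ.^ 6) ℤ.* bound
totals-bounded blocks us ws ok₁ ok₂ cs e₁ e₂ bounded {n} {l} {t} V =
  ℤₚ.≤-trans (ℤₚ.≤-reflexive (sym left)) (ℤₚ.≤-trans pointwise (ℤₚ.≤-reflexive (∑ᵛ-const {n} 6 bound)))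
  where
  lᵛ : Vec (Fin n) 6 → Graph
  lᵛ v i j = l (Vec.lookup v i) (Vec.lookup v j)
  tᵛ : Vec (Fin n) 6 → Fin 6 → Fin 6 → Fin 6 → Bool
  tᵛ v i j k = t (Vec.lookup v i) (Vec.lookup v j) (Vec.lookup v k)
  Qᵛ Pᵛ : Vec (Fin n) 6 → ℤ
  Qᵛ v = sumℤ (map (quadTerm blocks (lᵛ v) (tᵛ v)) us)
  Pᵛ v = sumℤ (map (pairTerm (lᵛ v) (tᵛ v)) ws)
  pointwise : ∑ᵛ 6 (λ v → Qᵛ v ℤ.+ Pᵛ v) ℤ.≤ ∑ᵛ {n} 6 (λ _ → bound)
  pointwise = ∑ᵛ-mono 6 {λ v → Qᵛ v ℤ.+ Pᵛ v} {λ _ → bound} λ v → bounded {lᵛ v} {tᵛ v} (pullback V (Vec.lookup v))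
  left : ∑ᵛ 6 (λ v → Qᵛ v ℤ.+ Pᵛ v) ≡ + length us ℤ.* ∑ᵛ 6 (quadTerm blocks l t) ℤ.+ + length ws ℤ.* ∑ᵛ 6 (pairTerm l t)
  left = trans (∑ᵛ-+ 6 Qᵛ Pᵛ) (cong₂ ℤ._+_
    (trans (∑ᵛ-cong 6 {Qᵛ} {λ v → sumℤ (map (λ u → quadTerm blocks l t (Vec.map (Vec.lookup v) u)) us)} λ v → sumℤ-cong (quadTerm-map l t (Vec.lookup v) blocks) us)
           (tuples-sum (quadTerm blocks l t) us ok₁ cs e₁))
    (trans (∑ᵛ-cong 6 {Pᵛ} {λ v → sumℤ (map (λ u → pairTerm l t (Vec.map (Vec.lookup v) u)) ws)} λ v → sumℤ-cong (pairTerm-map l t (Vec.lookup v)) ws)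
           (tuples-sum (pairTerm l t) ws ok₂ cs e₂)))

counted-bound : ∀ n us ws (A B Q P : ℤ) → length us ≡ 360 → length {A = Tuple} ws ≡ 90 → 0ℤ ℤ.≤ P → A ℤ.≤ Q →
  + length {A = Tuple} us ℤ.* Q ℤ.+ + length ws ℤ.* P ℤ.≤ + (n ℕ.^ 6) ℤ.* B → + 360 ℤ.* A ℤ.≤ + (n ℕ.^ 6) ℤ.* B
counted-bound n us ws A B Q P e₁ e₂ h₁ h₂ h rewrite e₁ | e₂ =
  ℤₚ.≤-trans (ℤₚ.*-monoˡ-≤-nonNeg (+ 360) h₂) (ℤₚ.≤-trans
    (subst (ℤ._≤ + 360 ℤ.* Q ℤ.+ + 90 ℤ.* P) (ℤₚ.+-identityʳ (+ 360 ℤ.* Q)) (ℤₚ.+-monoʳ-≤ (+ 360 ℤ.* Q) (ℤₚ.*-monoˡ-≤-nonNeg (+ 90) h₁))) h)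

quad-length : length (tuplesBy quadOrder) ≡ 360
quad-length = refl

pair-length : length (tuplesBy pairOrder) ≡ 90
pair-length = refl

quad-filtered : tuplesBy quadOrder ≡ filterᵇ quadOrder (map tuple (allCodes 6))
quad-filtered = refl

pair-filtered : tuplesBy pairOrder ≡ filterᵇ pairOrder (map tuple (allCodes 6))
pair-filtered = refl

triples-bounded : ∀ {n} {l : Fin n → Fin n → Bool} {t : Fin n → Fin n → Fin n → Bool} → Valid l t →
                  + 18 ℤ.* tripleCount t ℤ.≤ + 5 ℤ.* + (n ℕ.^ 3)
-- The empty vertex set is separate because a factor `n ^ 3` is cancelled below.
triples-bounded {zero} {t = t} V = ℤₚ.≤-reflexive (cong (ℤ._*_ (+ 18)) (∑ᵛ-empty 2 (bitᵛ t)))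
triples-bounded {suc m} {l} {t} V = cancel scale (suc m ℕ.^ 3) (tripleCount t) (ℤₚ.≤-trans chain
    (ℤₚ.≤-reflexive (cong₂ ℤ._*_ (cong +_ (ℕₚ.^-distribˡ-+-* (suc m) 3 3)) refl)))
  where
  chain : + 360 ℤ.* ((+ scale ℤ.* + (suc m ℕ.^ 3)) ℤ.* tripleCount t) ℤ.≤ + (suc m ℕ.^ 6) ℤ.* bound
  chain = counted-bound (suc m) (tuplesBy quadOrder) (tuplesBy pairOrder) ((+ scale ℤ.* + (suc m ℕ.^ 3)) ℤ.* tripleCount t) bound
    (∑ᵛ 6 (quadTerm quadBlocks l t)) (∑ᵛ 6 (pairTerm l t)) quad-length pair-length (pairs-nonneg V) (quads-bounded V quadBlocks)
    (totals-bounded quadBlocks (tuplesBy quadOrder) (tuplesBy pairOrder) quadOrder pairOrder (allCodes 6) quad-filtered pair-filtered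
      total-bounded V)
  cancel : ∀ M N T .{{_ : ℕ.NonZero M}} .{{_ : ℕ.NonZero N}} →
           + 360 ℤ.* ((+ M ℤ.* + N) ℤ.* T) ℤ.≤ + (N ℕ.* N) ℤ.* + (100 ℕ.* M) → + 18 ℤ.* T ℤ.≤ + 5 ℤ.* + N
  -- The common factor is `20 M N`, as 360 = 20 * 18 and 100 = 20 * 5.
  cancel M@(suc _) N@(suc _) T h = ℤₚ.*-cancelˡ-≤-pos (+ 18 ℤ.* T) (+ 5 ℤ.* + N) (+ (20 ℕ.* (M ℕ.* N)))
    (subst₂ ℤ._≤_ left right h)
    where
    20MN : + (20 ℕ.* (M ℕ.* N)) ≡ + 20 ℤ.* (+ M ℤ.* + N)
    20MN = trans (ℤₚ.pos-* 20 (M ℕ.* N)) (cong (ℤ._*_ (+ 20)) (ℤₚ.pos-* M N))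
    left : + 360 ℤ.* ((+ M ℤ.* + N) ℤ.* T) ≡ + (20 ℕ.* (M ℕ.* N)) ℤ.* (+ 18 ℤ.* T)
    left = trans (ring₁ (+ M) (+ N) T) (cong (ℤ._* (+ 18 ℤ.* T)) (sym 20MN))
      where
      ring₁ : ∀ x y z → + 360 ℤ.* ((x ℤ.* y) ℤ.* z) ≡ (+ 20 ℤ.* (x ℤ.* y)) ℤ.* (+ 18 ℤ.* z)
      ring₁ = solve 3 (λ x y z → con (+ 360) :* ((x :* y) :* z) := (con (+ 20) :* (x :* y)) :* (con (+ 18) :* z)) refl
    right : + (N ℕ.* N) ℤ.* + (100 ℕ.* M) ≡ + (20 ℕ.* (M ℕ.* N)) ℤ.* (+ 5 ℤ.* + N)
    right = trans (cong₂ ℤ._*_ (ℤₚ.pos-* N N) (ℤₚ.pos-* 100 M))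
      (trans (ring₂ (+ M) (+ N)) (cong (ℤ._* (+ 5 ℤ.* + N)) (sym 20MN)))
      where
      ring₂ : ∀ x y → (y ℤ.* y) ℤ.* (+ 100 ℤ.* x) ≡ (+ 20 ℤ.* (x ℤ.* y)) ℤ.* (+ 5 ℤ.* y)
      ring₂ = solve 2 (λ x y → (y :* y) :* (con (+ 100) :* x) := (con (+ 20) :* (x :* y)) :* (con (+ 5) :* y)) refl

-- Symmetry of `hasEdge` and recognition of forbidden subgraphs.

eqF-refl : ∀ {n} (x : Fin n) → eqF x x ≡ true
eqF-refl x with x ≟ x
... | yes _ = refl
... | no ¬p = ⊥-elim (¬p refl)

eqF-sym : ∀ {n} (x y : Fin n) → eqF x y ≡ eqF y x
eqF-sym x y with x ≟ y | y ≟ x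
... | yes _ | yes _ = refl
... | no _  | no _  = refl
... | yes p | no ¬q = ⊥-elim (¬q (sym p))
... | no ¬p | yes q = ⊥-elim (¬p (sym q))

eqF-true : ∀ {n} (x y : Fin n) → eqF x y ≡ true → x ≡ y
eqF-true x y h with x ≟ y
... | yes p = p

ltF-true : ∀ {n} (x y : Fin n) → ltF x y ≡ true → toℕ x ℕ.< toℕ y
ltF-true x y h = ℕₚ.<ᵇ⇒< (toℕ x) (toℕ y) (≡⇒T h)

ltF-false : ∀ {n} (x y : Fin n) → ltF x y ≡ false → toℕ y ℕ.≤ toℕ x
ltF-false x y h = ℕₚ.≮⇒≥ λ lt → case trans (sym h) (T⇒≡ (ℕₚ.<⇒<ᵇ lt)) of λ ()

ltF-flip : ∀ {n} (x y : Fin n) → eqF x y ≡ false → ltF y x ≡ not (ltF x y)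
ltF-flip x y d with ltF x y in p | ltF y x in q
... | true  | true  = ⊥-elim (ℕₚ.<-asym (ltF-true x y p) (ltF-true y x q))
... | true  | false = refl
... | false | true  = refl
... | false | false = case trans (sym d) (trans (cong (eqF x) (sym equal)) (eqF-refl x)) of λ ()
  where
  equal : x ≡ y
  equal = toℕ-injective (ℕₚ.≤-antisym (ltF-false y x q) (ltF-false x y p))

hasEdge-swap : ∀ {n} (G : ThreeGraph n) x y z → hasEdge G x y z ≡ hasEdge G y x z
hasEdge-swap G x y z with eqF x y in d₁ | eqF y x in d₁′
... | true  | true  = refl
... | true  | false = case trans (sym d₁) (trans (eqF-sym x y) d₁′) of λ ()
... | false | true  = case trans (sym d₁) (trans (eqF-sym x y) d₁′) of λ ()
... | false | false with eqF y z | eqF x z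
... | true  | true  = refl
... | true  | false = refl
... | false | true  = refl
... | false | false rewrite ltF-flip x y d₁ with ltF x y
... | true  = refl
... | false = refl

hasEdge-swapʳ : ∀ {n} (G : ThreeGraph n) x y z → hasEdge G x y z ≡ hasEdge G x z y
hasEdge-swapʳ G x y z with eqF y z in d₁ | eqF z y in d₁′
... | true  | false = case trans (sym d₁) (trans (eqF-sym y z) d₁′) of λ ()
... | false | true  = case trans (sym d₁) (trans (eqF-sym y z) d₁′) of λ ()
... | true  | true with eqF x y | eqF x z
...   | true  | true  = refl
...   | true  | false = refl
...   | false | true  = refl
...   | false | false = refl
hasEdge-swapʳ G x y z | false | false with eqF x y | eqF x z
... | true  | true  = refl
... | true  | false = refl
... | false | true  = refl
... | false | false rewrite ltF-flip y z d₁ with ltF x y in a | ltF y z in b | ltF x z in c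
... | true  | true  | true  = refl
... | true  | true  | false = ⊥-elim (ℕₚ.<-irrefl refl (ℕₚ.<-≤-trans (ℕₚ.<-trans (ltF-true x y a) (ltF-true y z b)) (ltF-false x z c)))
... | true  | false | true  = refl
... | true  | false | false = refl
... | false | true  | true  = refl
... | false | true  | false = refl
... | false | false | true  = ⊥-elim (ℕₚ.<-irrefl refl (ℕₚ.<-≤-trans (ltF-true x z c) (ℕₚ.≤-trans (ltF-false y z b) (ltF-false x y a))))
... | false | false | false = refl

hasEdge-distinct : ∀ {n} (G : ThreeGraph n) x y z → hasEdge G x y z ≡ true → x ≢ y
hasEdge-distinct G x y z h refl with eqF x x in d
... | false = case trans (sym d) (eqF-refl x) of λ ()
hasEdge-distinct G x y z () refl | true

-- If any two vertices of `F` lie in a common edge, then a map that preserves edges is injective by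
-- itself, because `hasEdge` is false on repeated vertices. Both `K4⁻` and `F32` have this property,
-- which is why the clauses of `Valid` can do without distinct points.
everyPair : ∀ {k} → ThreeGraph k → Bool
everyPair {k} F = everyFin k λ i → everyFin k λ j → eqF i j ∨ anyᵇ (λ m → hasEdge F i j m) (allFin k)

listed : ∀ {k} → ThreeGraph k → List (Fin k × Fin k × Fin k) → Bool
listed {k} F es = everyFin k λ i → everyFin k λ j → everyFin k λ m → not (hasEdge F i j m) ∨ anyᵇ (rearranged i j m) es

contains : ∀ {k n} (F : ThreeGraph k) (es : List (Fin k × Fin k × Fin k)) → everyPair F ≡ true → listed F es ≡ true →
           (G : ThreeGraph n) (φ : Fin k → Fin n) →
           All (λ (a , b , c) → hasEdge G (φ a) (φ b) (φ c) ≡ true) es → Contains F G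
contains {k} F es covered complete G φ edges = φ , injective , preserves
  where
  E : Fin k → Fin k → Fin k → Bool
  E a b c = hasEdge G (φ a) (φ b) (φ c)
  found : ∀ {es} i j m → All (λ (a , b , c) → E a b c ≡ true) es → anyᵇ (rearranged i j m) es ≡ true → E i j m ≡ true
  found {(a , b , c) ∷ es} i j m (e ∷ all) h with ∨-true {rearranged i j m (a , b , c)} h
  ... | inj₁ r = trans (sym (rearranged-value {t = E} (λ x y z → hasEdge-swap G (φ x) (φ y) (φ z)) (λ x y z → hasEdge-swapʳ G (φ x) (φ y) (φ z))
                              i j m (a , b , c) (rearranged-true i j m (a , b , c) r))) e
  ... | inj₂ r = found i j m all r
  preserves : ∀ i j m → hasEdge F i j m ≡ true → E i j m ≡ true
  preserves i j m h with ∨-true {not (hasEdge F i j m)}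
      (everyFin-true k (λ m → not (hasEdge F i j m) ∨ anyᵇ (rearranged i j m) es)
        (everyFin-true k (λ j → everyFin k λ m → not (hasEdge F i j m) ∨ anyᵇ (rearranged i j m) es)
          (everyFin-true k (λ i → everyFin k λ j → everyFin k λ m → not (hasEdge F i j m) ∨ anyᵇ (rearranged i j m) es) complete i) j) m)
  ... | inj₁ n = case trans (sym n) (cong not h) of λ ()
  ... | inj₂ r = found i j m edges r
  injective : ∀ {i j} → φ i ≡ φ j → i ≡ j
  injective {i} {j} eq with ∨-true {eqF i j}
      (everyFin-true k (λ j → eqF i j ∨ anyᵇ (λ m → hasEdge F i j m) (allFin k))
        (everyFin-true k (λ i → everyFin k λ j → eqF i j ∨ anyᵇ (λ m → hasEdge F i j m) (allFin k)) covered i) j)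
  ... | inj₁ e = eqF-true i j e
  ... | inj₂ h = let m , e = anyᵇ-true (λ m → hasEdge F i j m) (allFin k) h in
                 ⊥-elim (hasEdge-distinct G (φ i) (φ j) (φ m) (preserves i j m e) eq)

contains-K4⁻ : ∀ {n} (G : ThreeGraph n) p q a b →
               hasEdge G p q a ≡ true → hasEdge G p q b ≡ true → hasEdge G p a b ≡ true → Contains K4⁻ G
contains-K4⁻ G p q a b h₁ h₂ h₃ =
  contains K4⁻ ((# 0 , # 1 , # 2) ∷ (# 0 , # 1 , # 3) ∷ (# 0 , # 2 , # 3) ∷ []) refl refl G
    (Vec.lookup (p ∷ q ∷ a ∷ b ∷ [])) (h₁ ∷ h₂ ∷ h₃ ∷ [])

contains-F32 : ∀ {n} (G : ThreeGraph n) p q a b c → hasEdge G p q a ≡ true → hasEdge G p q b ≡ true →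
               hasEdge G p q c ≡ true → hasEdge G a b c ≡ true → Contains F32 G
contains-F32 G p q a b c h₁ h₂ h₃ h₄ =
  contains F32 ((# 0 , # 1 , # 2) ∷ (# 0 , # 1 , # 3) ∷ (# 0 , # 1 , # 4) ∷ (# 2 , # 3 , # 4) ∷ []) refl refl G
    (Vec.lookup (p ∷ q ∷ a ∷ b ∷ c ∷ [])) (h₁ ∷ h₂ ∷ h₃ ∷ h₄ ∷ [])

-- The link of a vertex and its marked triples.

linked : ∀ {n} → ThreeGraph n → Fin n → Fin n → Fin n → Fin n → Bool
linked G x a b c = hasEdge G a b c ∧ (hasEdge G x a b ∨ hasEdge G x b c ∨ hasEdge G x a c)

-- Each clause exhibits a forbidden copy. A triangle of the link spans `K4⁻` with `x`, and so does
-- an edge `ijk` with two of its pairs in the link; hence an edge with at least one pair in the link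
-- has exactly one.
link-valid : ∀ {n} (G : ThreeGraph n) → K4⁻F32-free n G → ∀ x → Valid (hasEdge G x) (linked G x)
link-valid {n} G (noK4 , noF32) x = record
  { l-sym    = λ i j → hasEdge-swapʳ G x i j
  ; l-irrefl = λ i → conj-false λ h → hasEdge-distinct G i i x (trans (rot x i i) h) refl
  ; t-swap   = λ i j k → cong₂ _∧_ (hasEdge-swap G i j k)
                 (cong₂ _∨_ (hasEdge-swapʳ G x i j) (∨-comm (hasEdge G x j k) (hasEdge G x i k)))
  ; t-swapʳ  = λ i j k → cong₂ _∧_ (hasEdge-swapʳ G i j k)
                 (trans (reverse (hasEdge G x i j) (hasEdge G x j k) (hasEdge G x i k))
                        (cong (λ e → hasEdge G x i k ∨ e ∨ hasEdge G x i j) (hasEdge-swapʳ G x j k)))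
  ; triangle = λ i j k p q r → noK4 (contains-K4⁻ G x i j k p q r)
  ; t-edge   = one
  ; codegree = λ p q a b e f h₁ h₂ → noF32 (contains-F32 G p q x a b (trans (rot x p q) e) (edge h₁) (edge h₂) f)
  ; k4-free  = λ p q a b h₁ h₂ h₃ → noK4 (contains-K4⁻ G p q a b (edge h₁) (edge h₂) (edge h₃))
  ; f32-free = λ p q a b c h₁ h₂ h₃ h₄ → noF32 (contains-F32 G p q a b c (edge h₁) (edge h₂) (edge h₃) (edge h₄)) }
  where
  rot : ∀ x p q → hasEdge G p q x ≡ hasEdge G x p q
  rot x p q = trans (hasEdge-swapʳ G p q x) (hasEdge-swap G p x q)
  edge : ∀ {a b c} → linked G x a b c ≡ true → hasEdge G a b c ≡ true
  edge {a} {b} {c} h = proj₁ (∧-true {hasEdge G a b c} h)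
  reverse : ∀ a b c → a ∨ b ∨ c ≡ c ∨ b ∨ a
  reverse false false false = refl
  reverse false false true  = refl
  reverse false true  false = refl
  reverse false true  true  = refl
  reverse true  false false = refl
  reverse true  false true  = refl
  reverse true  true  false = refl
  reverse true  true  true  = refl
  one : ∀ i j k → linked G x i j k ≡ true → oneEdge (hasEdge G x) i j k ≡ true
  one i j k h with hasEdge G i j k in e | hasEdge G x i j in a | hasEdge G x j k in b | hasEdge G x i k in c
  -- The first vertex given to `contains-K4⁻` lies in all three edges; it is the point shared by the
  -- two link pairs.
  ... | true | true  | true  | _     = ⊥-elim (noK4 (contains-K4⁻ G j x i k (trans (hasEdge-swap G j x i) (trans (hasEdge-swapʳ G x j i) a)) (trans (hasEdge-swap G j x k) b) (trans (hasEdge-swap G j i k) e)))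
  ... | true | true  | false | true  = ⊥-elim (noK4 (contains-K4⁻ G i x j k (trans (hasEdge-swap G i x j) a) (trans (hasEdge-swap G i x k) c) e))
  ... | true | true  | false | false = refl
  ... | true | false | true  | true  = ⊥-elim (noK4 (contains-K4⁻ G k x i j (trans (hasEdge-swap G k x i) (trans (hasEdge-swapʳ G x k i) c)) (trans (hasEdge-swap G k x j) (trans (hasEdge-swapʳ G x k j) b)) (trans (sym (rot k i j)) e)))
  ... | true | false | true  | false = refl
  ... | true | false | false | true  = refl

-- Counting copies through ordered quadruples.

cnt : {A : Set} → (A → Bool) → List A → ℤ
cnt P xs = + length (filterᵇ P xs)

cnt-++ : {A : Set} (P : A → Bool) → ∀ xs ys → cnt P (xs ++ ys) ≡ cnt P xs ℤ.+ cnt P ys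
cnt-++ P []       ys = sym (ℤₚ.+-identityˡ _)
cnt-++ P (x ∷ xs) ys with P x
... | false = cnt-++ P xs ys
... | true  = trans (cong (ℤ._+_ (+ 1)) (cnt-++ P xs ys)) (sym (ℤₚ.+-assoc (+ 1) (cnt P xs) (cnt P ys)))

cnt-map : {A B : Set} (P : B → Bool) (f : A → B) → ∀ xs → cnt P (map f xs) ≡ cnt (P ∘ f) xs
cnt-map P f []       = refl
cnt-map P f (x ∷ xs) with P (f x)
... | false = cnt-map P f xs
... | true  = cong (ℤ._+_ (+ 1)) (cnt-map P f xs)

cnt-concatMap : {A B : Set} (P : B → Bool) (F : A → List B) → ∀ {n} (g : Fin n → A) →
                cnt P (concatMap F (tabulate g)) ≡ sum (λ i → cnt P (F (g i)))
cnt-concatMap P F {zero}  g = refl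
cnt-concatMap P F {suc n} g = trans (cnt-++ P (F (g zero)) _) (cong (ℤ._+_ (cnt P (F (g zero)))) (cnt-concatMap P F (g ∘ suc)))

opaque
  unfolding ∑ᵛ

  cnt-allVecs : ∀ h {n} (P : Vec (Fin n) h → Bool) → cnt P (allVecs h n) ≡ ∑ᵛ h (λ v → + bit (P v))
  cnt-allVecs zero    P with P []
  ... | true  = refl
  ... | false = refl
  cnt-allVecs (suc h) {n} P = trans (cnt-concatMap P (λ i → map (i ∷_) (allVecs h n)) (λ i → i))
    (sum-cong-≗ λ i → trans (cnt-map P (i ∷_) (allVecs h n)) (cnt-allVecs h (λ v → P (i ∷ v))))

all-true : {A : Set} (P : A → Bool) → ∀ {n} (g : Fin n → A) → all P (tabulate g) ≡ true → ∀ i → P (g i) ≡ true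
all-true P {suc n} g h zero    = proj₁ (∧-true {P (g zero)} h)
all-true P {suc n} g h (suc i) = all-true P (g ∘ suc) (proj₂ (∧-true {P (g zero)} h)) i

any-true : {A : Set} (P : A → Bool) (xs : List A) → any P xs ≡ true → ∃ λ x → P x ≡ true
any-true P (x ∷ xs) h with ∨-true {P x} h
... | inj₁ e = x , e
... | inj₂ e = any-true P xs e

any-allFin : ∀ {n} (P : Fin n → Bool) i → P i ≡ true → anyᵇ P (allFin n) ≡ true
any-allFin {n} P i h = go (λ j → j) i h
  where
  go : ∀ {m} (g : Fin m → Fin n) j → P (g j) ≡ true → anyᵇ P (tabulate g) ≡ true
  go g zero    e rewrite e = refl
  go g (suc j) e with P (g zero)
  ... | true  = refl
  ... | false = go (g ∘ suc) j e

bit-mono : ∀ {a b} → (a ≡ true → b ≡ true) → + bit a ℤ.≤ + bit b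
bit-mono {false} {b}     h = ℤ.+≤+ ℕ.z≤n
bit-mono {true}  {true}  h = ℤₚ.≤-refl
bit-mono {true}  {false} h = case h refl of λ ()

-- Unlike `increasing`, this compares neighbours only, which suits induction on insertions;
-- transitivity makes the two agree.
chain : ∀ {n k} → Vec (Fin n) k → Bool
chain []           = true
chain (x ∷ [])     = true
chain (x ∷ y ∷ ys) = ltF x y ∧ chain (y ∷ ys)

ltF-trans : ∀ {n} (x y z : Fin n) → ltF x y ≡ true → ltF y z ≡ true → ltF x z ≡ true
ltF-trans x y z h₁ h₂ = T⇒≡ (ℕₚ.<⇒<ᵇ (ℕₚ.<-trans (ltF-true x y h₁) (ltF-true y z h₂)))

chain-tail : ∀ {n k} (y : Fin n) (w : Vec (Fin n) k) → chain (y ∷ w) ≡ true → chain w ≡ true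
chain-tail y []      h = refl
chain-tail y (z ∷ w) h = proj₂ (∧-true {ltF y z} h)

chain-head : ∀ {n k} (y : Fin n) (w : Vec (Fin n) k) → chain (y ∷ w) ≡ true → ∀ j → ltF y (Vec.lookup w j) ≡ true
chain-head y (z ∷ w) h zero    = proj₁ (∧-true {ltF y z} h)
chain-head y (z ∷ w) h (suc j) =
  ltF-trans y z (Vec.lookup w j) (proj₁ (∧-true {ltF y z} h)) (chain-head z w (proj₂ (∧-true {ltF y z} h)) j)

chain-remove : ∀ {n k} (y x : Fin n) (w : Vec (Fin n) k) i → chain (y ∷ insertAt w i x) ≡ true → chain (y ∷ w) ≡ true
chain-remove y x []      i       h = refl
chain-remove y x (z ∷ w) zero    h =
  let h₁ , h′ = ∧-true {ltF y x} h ; h₂ , h₃ = ∧-true {ltF x z} h′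
  in cong₂ _∧_ (ltF-trans y x z h₁ h₂) h₃
chain-remove y x (z ∷ w) (suc i) h =
  let h₁ , h′ = ∧-true {ltF y z} h in cong₂ _∧_ h₁ (chain-remove z x w i h′)

-- At most one position of `x` gives an increasing vector, and none does if `w` is not increasing.
-- If `x` precedes the head `y`, only the front is possible; otherwise the front fails and the
-- question passes to the tail.
insertions-bounded : ∀ {n k} (x : Fin n) (w : Vec (Fin n) k) → sum (λ i → + bit (chain (insertAt w i x))) ℤ.≤ + bit (chain w)
insertions-bounded x []      = ℤₚ.≤-refl
insertions-bounded {n} {suc k} x (y ∷ w) with chain (y ∷ w) in c | ltF x y in o
... | false | b = subst (ℤ._≤ 0ℤ) (sym (cong (ℤ._+ rest) (cong (λ b → + bit b) (∧-falseʳ b)))) (subst (ℤ._≤ 0ℤ) (sym (ℤₚ.+-identityˡ rest))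
      (ℤₚ.≤-trans (sum-mono λ i → bit-mono {b = false} λ h → case trans (sym c) (chain-remove y x w i h) of λ ()) (ℤₚ.≤-reflexive (sum-zero (suc k)))))
  where
  rest = sum (λ i → + bit (chain (y ∷ insertAt w i x)))
  ∧-falseʳ : ∀ b → b ∧ false ≡ false
  ∧-falseʳ true  = refl
  ∧-falseʳ false = refl
... | true | true  = subst (ℤ._≤ + 1) (ℤₚ.+-comm rest (+ 1)) (ℤₚ.≤-trans (ℤₚ.+-monoˡ-≤ (+ 1)
      (ℤₚ.≤-trans (sum-mono λ i → bit-mono {b = false} λ h →
          ⊥-elim (ℕₚ.<-asym (ltF-true x y o) (ltF-true y x (trans (sym (cong (ltF y) (insertAt-lookup w i x))) (chain-head y (insertAt w i x) h i)))))
        (ℤₚ.≤-reflexive (sum-zero (suc k))))) ℤₚ.≤-refl)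
  where rest = sum (λ i → + bit (chain (y ∷ insertAt w i x)))
... | true | false = subst (ℤ._≤ + 1) (sym (ℤₚ.+-identityˡ rest))
      (ℤₚ.≤-trans (sum-mono λ i → bit-mono (chain-tail y (insertAt w i x)))
        (ℤₚ.≤-trans (insertions-bounded x w) (bit≤1 (chain w))))
  where
  rest = sum (λ i → + bit (chain (y ∷ insertAt w i x)))
  bit≤1 : ∀ b → + bit b ℤ.≤ + 1
  bit≤1 true  = ℤₚ.≤-refl
  bit≤1 false = ℤ.+≤+ ℕ.z≤n

∑ᶜ : ∀ k → (Code k → ℤ) → ℤ
∑ᶜ zero    f = f tt
∑ᶜ (suc k) f = ∑ᶜ k λ c → sum λ i → f (i , c)

∑ᶜ-mono : ∀ k {f g : Code k → ℤ} → (∀ c → f c ℤ.≤ g c) → ∑ᶜ k f ℤ.≤ ∑ᶜ k g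
∑ᶜ-mono zero    h = h tt
∑ᶜ-mono (suc k) h = ∑ᶜ-mono k λ c → sum-mono λ i → h (i , c)

∑ᶜ-cong : ∀ k {f g : Code k → ℤ} → (∀ c → f c ≡ g c) → ∑ᶜ k f ≡ ∑ᶜ k g
∑ᶜ-cong zero    h = h tt
∑ᶜ-cong (suc k) h = ∑ᶜ-cong k λ c → sum-cong-≗ λ i → h (i , c)

∑ᶜ-*ʳ : ∀ k (f : Code k → ℤ) x → ∑ᶜ k (λ c → f c ℤ.* x) ≡ ∑ᶜ k f ℤ.* x
∑ᶜ-*ʳ zero    f x = refl
∑ᶜ-*ʳ (suc k) f x = trans (∑ᶜ-cong k λ c → sym (*-distribʳ-sum x (λ i → f (i , c)))) (∑ᶜ-*ʳ k (λ c → sum λ i → f (i , c)) x)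

∑ᶜ-∑ᵛ : ∀ k {n} h (f : Code k → Vec (Fin n) h → ℤ) → ∑ᶜ k (λ c → ∑ᵛ h (f c)) ≡ ∑ᵛ h (λ v → ∑ᶜ k λ c → f c v)
∑ᶜ-∑ᵛ zero    h f = refl
∑ᶜ-∑ᵛ (suc k) h f = trans (∑ᶜ-cong k λ c → ∑ᵛ-swap h (λ i → f (i , c))) (∑ᶜ-∑ᵛ k h (λ c v → sum λ i → f (i , c) v))

-- Iterating the bound for one insertion shows that a tuple has at most one increasing
-- rearrangement.
sortings-bounded : ∀ {n} k (v : Vec (Fin n) k) → ∑ᶜ k (λ c → + bit (chain (permute c v))) ℤ.≤ + 1
sortings-bounded zero    []      = ℤₚ.≤-refl
sortings-bounded (suc k) (x ∷ v) = ℤₚ.≤-trans (∑ᶜ-mono k λ c → insertions-bounded x (permute c v)) (sortings-bounded k v)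

everyCode : ∀ k → (Code k → Bool) → Bool
everyCode zero    ok = ok tt
everyCode (suc k) ok = everyFin (suc k) λ i → everyCode k λ c → ok (i , c)

everyCode-true : ∀ k (ok : Code k → Bool) → everyCode k ok ≡ true → ∀ c → ok c ≡ true
everyCode-true zero    ok h tt      = h
everyCode-true (suc k) ok h (i , c) =
  everyCode-true k (λ c → ok (i , c)) (everyFin-true (suc k) (λ i → everyCode k λ c → ok (i , c)) h i) c

others : Fin 4 → Fin 4 × Fin 4 × Fin 4
others zero                   = # 1 , # 2 , # 3
others (suc zero)             = # 0 , # 2 , # 3
others (suc (suc zero))       = # 0 , # 1 , # 3
others (suc (suc (suc zero))) = # 0 , # 1 , # 2

face : ∀ {n} → ThreeGraph n → (Fin 4 → Fin n) → Fin 4 → Bool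
face G v d = hasEdge G (v (proj₁ (others d))) (v (proj₁ (proj₂ (others d)))) (v (proj₂ (proj₂ (others d))))

-- At least two edges, in place of an induced copy: the condition follows from a copy, is symmetric
-- in the four vertices, and is enough for an upper bound.
twoFaces : (Fin 4 → Bool) → Bool
twoFaces e = anyᵇ (λ i → anyᵇ (λ j → not (eqF i j) ∧ e i ∧ e j) (allFin 4)) (allFin 4)

twoFaces-intro : ∀ e i j → eqF i j ≡ false → e i ≡ true → e j ≡ true → twoFaces e ≡ true
twoFaces-intro e i j d h₁ h₂ = any-allFin (λ i → anyᵇ (λ j → not (eqF i j) ∧ e i ∧ e j) (allFin 4)) i
  (any-allFin (λ j → not (eqF i j) ∧ e i ∧ e j) j (cong₂ _∧_ (cong not d) (cong₂ _∧_ h₁ h₂)))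

twoFaces-elim : ∀ e → twoFaces e ≡ true → ∃ λ i → ∃ λ j → eqF i j ≡ false × e i ≡ true × e j ≡ true
twoFaces-elim e h =
  let i , h₁ = anyᵇ-true (λ i → anyᵇ (λ j → not (eqF i j) ∧ e i ∧ e j) (allFin 4)) (allFin 4) h
      j , h₂ = anyᵇ-true (λ j → not (eqF i j) ∧ e i ∧ e j) (allFin 4) h₁
      d , h₃ = ∧-true {not (eqF i j)} h₂
      e₁ , e₂ = ∧-true {e i} h₃
  in i , j , not-true d , e₁ , e₂
  where
  not-true : ∀ {b} → not b ≡ true → b ≡ false
  not-true {false} _ = refl

distinct₄ : {A : Set} → (A → A → Bool) → A → A → A → A → Bool
distinct₄ eq a b c d = not (eq a b) ∧ not (eq a c) ∧ not (eq a d) ∧ not (eq b c) ∧ not (eq b d) ∧ not (eq c d)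

others-checked : everyFin 4 (λ a → everyFin 4 λ b → everyFin 4 λ c → everyFin 4 λ d →
                   not (distinct₄ eqF a b c d) ∨ rearranged a b c (others d)) ≡ true
others-checked = refl

face-omits : ∀ {n} (G : ThreeGraph n) (v : Fin 4 → Fin n) a b c d → distinct₄ eqF a b c d ≡ true →
             hasEdge G (v a) (v b) (v c) ≡ face G v d
face-omits G v a b c d h with ∨-true {not (distinct₄ eqF a b c d)}
    (everyFin-true 4 (λ d → not (distinct₄ eqF a b c d) ∨ rearranged a b c (others d))
      (everyFin-true 4 (λ c → everyFin 4 λ d → not (distinct₄ eqF a b c d) ∨ rearranged a b c (others d))
        (everyFin-true 4 (λ b → everyFin 4 λ c → everyFin 4 λ d → not (distinct₄ eqF a b c d) ∨ rearranged a b c (others d))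
          (everyFin-true 4 (λ a → everyFin 4 λ b → everyFin 4 λ c → everyFin 4 λ d →
              not (distinct₄ eqF a b c d) ∨ rearranged a b c (others d)) others-checked a) b) c) d)
... | inj₁ n = case trans (sym n) (cong not h) of λ ()
... | inj₂ r = sym (rearranged-value {t = λ a b c → hasEdge G (v a) (v b) (v c)}
    (λ x y z → hasEdge-swap G (v x) (v y) (v z)) (λ x y z → hasEdge-swapʳ G (v x) (v y) (v z))
    a b c (others d) (rearranged-true a b c (others d) r))

twoEdges : ∀ {n} → ThreeGraph n → Vec (Fin n) 4 → Bool
twoEdges G v = twoFaces (face G (Vec.lookup v))

allFinB-true : ∀ {h} (P : Fin h → Bool) → allFinB P ≡ true → ∀ i → P i ≡ true
allFinB-true P = all-true P (λ i → i)

-- The predicate inside `inducesCopyOf`, named so that a witness can be extracted from `any`.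
copyBy : ∀ {h n} → ThreeGraph h → ThreeGraph n → Vec (Fin n) h → Vec (Fin h) h → Bool
copyBy H G S p = injectiveB p ∧
  (allFinB λ a → allFinB λ b → allFinB λ c →
    not (hasEdge H a b c xor hasEdge G (Vec.lookup S (Vec.lookup p a)) (Vec.lookup S (Vec.lookup p b)) (Vec.lookup S (Vec.lookup p c))))

copyBy-apart : ∀ {h n} (H : ThreeGraph h) (G : ThreeGraph n) S p → copyBy H G S p ≡ true →
               ∀ i j → eqF i j ≡ false → eqF (Vec.lookup p i) (Vec.lookup p j) ≡ false
copyBy-apart H G S p e i j d =
  [ (λ e′ → case trans (sym d) e′ of λ ()) , not-true ]′ (∨-true {eqF i j}
    (allFinB-true (λ j → eqF i j ∨ not (eqF (Vec.lookup p i) (Vec.lookup p j)))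
      (allFinB-true (λ i → allFinB λ j → eqF i j ∨ not (eqF (Vec.lookup p i) (Vec.lookup p j))) (proj₁ (∧-true {injectiveB p} e)) i) j))
  where
  not-true : ∀ {b} → not b ≡ true → b ≡ false
  not-true {false} _ = refl

copyBy-edge : ∀ {h n} (H : ThreeGraph h) (G : ThreeGraph n) S p → copyBy H G S p ≡ true → ∀ a b c → hasEdge H a b c ≡ true →
              hasEdge G (Vec.lookup S (Vec.lookup p a)) (Vec.lookup S (Vec.lookup p b)) (Vec.lookup S (Vec.lookup p c)) ≡ true
copyBy-edge {h} H G S p e a b c t = same (subst (λ x → not (x xor E a b c) ≡ true) t
    (allFinB-true (λ c → not (hasEdge H a b c xor E a b c))
      (allFinB-true (λ b → allFinB λ c → not (hasEdge H a b c xor E a b c))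
        (allFinB-true (λ a → allFinB λ b → allFinB λ c → not (hasEdge H a b c xor E a b c)) (proj₂ (∧-true {injectiveB p} e)) a) b) c))
  where
  E : Fin h → Fin h → Fin h → Bool
  E a b c = hasEdge G (Vec.lookup S (Vec.lookup p a)) (Vec.lookup S (Vec.lookup p b)) (Vec.lookup S (Vec.lookup p c))
  same : ∀ {x} → not (true xor x) ≡ true → x ≡ true
  same {true} _ = refl

copyBy-exists : ∀ {h n} (H : ThreeGraph h) (G : ThreeGraph n) S → inducesCopyOf H G S ≡ true → ∃ λ p → copyBy H G S p ≡ true
copyBy-exists {h} H G S = any-true (copyBy H G S) (allVecs h h)

increasing-lookup : ∀ {h n} (S : Vec (Fin n) h) → increasing S ≡ true → ∀ i j → ltF i j ≡ true → ltF (Vec.lookup S i) (Vec.lookup S j) ≡ true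
increasing-lookup S e i j o =
  [ (λ e′ → case trans (sym e′) (cong not o) of λ ()) , (λ e′ → e′) ]′ (∨-true {not (ltF i j)}
    (allFinB-true (λ j → not (ltF i j) ∨ ltF (Vec.lookup S i) (Vec.lookup S j))
      (allFinB-true (λ i → allFinB λ j → not (ltF i j) ∨ ltF (Vec.lookup S i) (Vec.lookup S j)) e i) j))

distinct₄-intro : ∀ {n} (a b c d : Fin n) → eqF a b ≡ false → eqF a c ≡ false → eqF a d ≡ false → eqF b c ≡ false →
                  eqF b d ≡ false → eqF c d ≡ false → distinct₄ eqF a b c d ≡ true
distinct₄-intro a b c d e₁ e₂ e₃ e₄ e₅ e₆ =
  cong₂ _∧_ (cong not e₁) (cong₂ _∧_ (cong not e₂) (cong₂ _∧_ (cong not e₃) (cong₂ _∧_ (cong not e₄) (cong₂ _∧_ (cong not e₅) (cong not e₆)))))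

-- The edges 012 and 013 of `G4-2` omit the vertices 3 and 2, so their images are the faces opposite
-- to `P 3` and `P 2`.
copy-twoEdges : ∀ {n} (G : ThreeGraph n) S → inducesCopyOf G4-2 G S ≡ true → twoEdges G S ≡ true
copy-twoEdges {n} G S h = from (copyBy-exists G4-2 G S h)
  where
  from : (∃ λ p → copyBy G4-2 G S p ≡ true) → twoEdges G S ≡ true
  from (p , e) = twoFaces-intro (face G (Vec.lookup S)) (P (# 3)) (P (# 2)) (apart (# 3) (# 2) refl)
      (trans (sym (face-omits G (Vec.lookup S) (P (# 0)) (P (# 1)) (P (# 2)) (P (# 3))
        (distinct₄-intro _ _ _ _ (apart (# 0) (# 1) refl) (apart (# 0) (# 2) refl) (apart (# 0) (# 3) refl)
          (apart (# 1) (# 2) refl) (apart (# 1) (# 3) refl) (apart (# 2) (# 3) refl)))) (copyBy-edge G4-2 G S p e (# 0) (# 1) (# 2) refl))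
      (trans (sym (face-omits G (Vec.lookup S) (P (# 0)) (P (# 1)) (P (# 3)) (P (# 2))
        (distinct₄-intro _ _ _ _ (apart (# 0) (# 1) refl) (apart (# 0) (# 3) refl) (apart (# 0) (# 2) refl)
          (apart (# 1) (# 3) refl) (apart (# 1) (# 2) refl) (apart (# 3) (# 2) refl)))) (copyBy-edge G4-2 G S p e (# 0) (# 1) (# 3) refl))
    where
    P : Fin 4 → Fin 4
    P = Vec.lookup p
    apart : ∀ i j → eqF i j ≡ false → eqF (P i) (P j) ≡ false
    apart = copyBy-apart G4-2 G S p e

position₄ : Code 4 → Fin 4 → Fin 4
position₄ c = Vec.lookup (permute c (Vec.allFin 4))

position₄-injective : everyCode 4 (λ c → everyFin 4 λ i → everyFin 4 λ j → eqF i j ∨ not (eqF (position₄ c i) (position₄ c j))) ≡ true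
position₄-injective = refl

position₄-distinct : everyCode 4 (λ c → everyFin 4 λ d →
  distinct₄ eqF (position₄ c (proj₁ (others d))) (position₄ c (proj₁ (proj₂ (others d)))) (position₄ c (proj₂ (proj₂ (others d)))) (position₄ c d)) ≡ true
position₄-distinct = refl

lookup-permute : ∀ {n} (c : Code 4) (v : Vec (Fin n) 4) i → Vec.lookup (permute c v) i ≡ Vec.lookup v (position₄ c i)
lookup-permute c v i = trans (cong (λ w → Vec.lookup w i)
    (trans (cong (permute c) (sym (map-lookup-allFin v))) (permute-map (Vec.lookup v) c (Vec.allFin 4))))
  (lookup-map i (Vec.lookup v) (permute c (Vec.allFin 4)))

position₄-apart : ∀ c d → distinct₄ eqF (position₄ c (proj₁ (others d))) (position₄ c (proj₁ (proj₂ (others d))))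
                                    (position₄ c (proj₂ (proj₂ (others d)))) (position₄ c d) ≡ true
position₄-apart c d = everyFin-true 4 (λ d →
    distinct₄ eqF (position₄ c (proj₁ (others d))) (position₄ c (proj₁ (proj₂ (others d)))) (position₄ c (proj₂ (proj₂ (others d)))) (position₄ c d))
  (everyCode-true 4 (λ c → everyFin 4 λ d →
    distinct₄ eqF (position₄ c (proj₁ (others d))) (position₄ c (proj₁ (proj₂ (others d)))) (position₄ c (proj₂ (proj₂ (others d)))) (position₄ c d))
    position₄-distinct c) d

hasEdge-cong : ∀ {n} (G : ThreeGraph n) {x x′ y y′ z z′} → x ≡ x′ → y ≡ y′ → z ≡ z′ → hasEdge G x y z ≡ hasEdge G x′ y′ z′
hasEdge-cong G refl refl refl = refl

face-permute : ∀ {n} (G : ThreeGraph n) c v d → face G (Vec.lookup (permute c v)) d ≡ face G (Vec.lookup v) (position₄ c d)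
face-permute G c v d = trans
  (hasEdge-cong G (lookup-permute c v (proj₁ (others d))) (lookup-permute c v (proj₁ (proj₂ (others d)))) (lookup-permute c v (proj₂ (proj₂ (others d)))))
  (face-omits G (Vec.lookup v) (position₄ c (proj₁ (others d))) (position₄ c (proj₁ (proj₂ (others d)))) (position₄ c (proj₂ (proj₂ (others d))))
    (position₄ c d) (position₄-apart c d))

twoEdges-permute : ∀ {n} (G : ThreeGraph n) c v → twoEdges G (permute c v) ≡ true → twoEdges G v ≡ true
twoEdges-permute G c v h =
  let i , j , d , e₁ , e₂ = twoFaces-elim (face G (Vec.lookup (permute c v))) h
  in twoFaces-intro (face G (Vec.lookup v)) (position₄ c i) (position₄ c j) (apart i j d)
       (trans (sym (face-permute G c v i)) e₁) (trans (sym (face-permute G c v j)) e₂)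
  where
  apart : ∀ i j → eqF i j ≡ false → eqF (position₄ c i) (position₄ c j) ≡ false
  apart i j d with ∨-true {eqF i j} (everyFin-true 4 (λ j → eqF i j ∨ not (eqF (position₄ c i) (position₄ c j)))
      (everyFin-true 4 (λ i → everyFin 4 λ j → eqF i j ∨ not (eqF (position₄ c i) (position₄ c j)))
        (everyCode-true 4 (λ c → everyFin 4 λ i → everyFin 4 λ j → eqF i j ∨ not (eqF (position₄ c i) (position₄ c j))) position₄-injective c) i) j)
  ... | inj₁ e = case trans (sym d) e of λ ()
  ... | inj₂ e with eqF (position₄ c i) (position₄ c j)
  ...   | false = refl

linkedᵛ : ∀ {n} → ThreeGraph n → Vec (Fin n) 4 → Bool
linkedᵛ G (x ∷ a ∷ b ∷ c ∷ []) = linked G x a b c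

-- Summing the left side over all 24 permutations of coordinates multiplies it by 24, while each
-- quadruple is made increasing by at most one of them.
sorted-twoEdges : ∀ {n} (G : ThreeGraph n) →
  + 24 ℤ.* ∑ᵛ 4 (λ v → + bit (chain v ∧ twoEdges G v)) ℤ.≤ ∑ᵛ 4 (λ v → + bit (twoEdges G v))
sorted-twoEdges {n} G = subst (ℤ._≤ ∑ᵛ 4 (λ v → + bit (twoEdges G v))) repeated
  (∑ᵛ-mono 4 λ v → ℤₚ.≤-trans (∑ᶜ-mono 4 λ c → weaken c v) (ℤₚ.≤-trans
    (ℤₚ.≤-reflexive (∑ᶜ-*ʳ 4 (λ c → + bit (chain (permute c v))) (+ bit (twoEdges G v))))
    (ℤₚ.≤-trans (ℤₚ.*-monoʳ-≤-nonNeg (+ bit (twoEdges G v)) (sortings-bounded 4 v)) (ℤₚ.≤-reflexive (ℤₚ.*-identityˡ _)))))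
  where
  s = ∑ᵛ {n} 4 (λ v → + bit (chain v ∧ twoEdges G v))
  weaken : ∀ c v → + bit (chain (permute c v) ∧ twoEdges G (permute c v)) ℤ.≤ + bit (chain (permute c v)) ℤ.* + bit (twoEdges G v)
  weaken c v with chain (permute c v)
  ... | false = ℤₚ.≤-refl
  ... | true  = ℤₚ.≤-trans (bit-mono (twoEdges-permute G c v)) (ℤₚ.≤-reflexive (sym (ℤₚ.*-identityˡ _)))
  repeated : ∑ᵛ 4 (λ v → ∑ᶜ 4 λ c → + bit (chain (permute c v) ∧ twoEdges G (permute c v))) ≡ + 24 ℤ.* s
  repeated = trans (sym (∑ᶜ-∑ᵛ 4 4 (λ c v → + bit (chain (permute c v) ∧ twoEdges G (permute c v)))))
    (trans (∑ᶜ-cong 4 λ c → trans (∑ᵛ-permute 4 c (λ v → + bit (chain v ∧ twoEdges G v))) (sym (ℤₚ.*-identityˡ s)))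
           -- The sum of ones over the codes of length 4 evaluates to 24.
           (∑ᶜ-*ʳ 4 (λ _ → + 1) s))

-- From a vertex outside a face, the pairs of that face lie in the link exactly when the other three
-- faces are edges. So this counts the vertices that see the opposite face as a marked triple; two
-- edges on four vertices are seen from the two vertices that they omit.
linkedFaces : Vec Bool 4 → ℕ
linkedFaces (e₀ ∷ e₁ ∷ e₂ ∷ e₃ ∷ []) =
  bit (e₀ ∧ (e₃ ∨ e₁ ∨ e₂)) ℕ.+ (bit (e₁ ∧ (e₃ ∨ e₀ ∨ e₂)) ℕ.+ (bit (e₂ ∧ (e₃ ∨ e₀ ∨ e₁)) ℕ.+ bit (e₃ ∧ (e₂ ∨ e₀ ∨ e₁))))

facesCheck : Vec Bool 4 → Bool
facesCheck e = (2 ℕ.* bit (twoFaces (Vec.lookup e))) ℕ.≤ᵇ linkedFaces e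

faces-checked : everyVec 4 facesCheck ≡ true
faces-checked = refl

twoFaces-cong : ∀ {e f : Fin 4 → Bool} → (∀ i → e i ≡ f i) → twoFaces e ≡ true → twoFaces f ≡ true
twoFaces-cong {e} {f} q h = let i , j , d , h₁ , h₂ = twoFaces-elim e h in
  twoFaces-intro f i j d (trans (sym (q i)) h₁) (trans (sym (q j)) h₂)

-- These bring the second, third and fourth entry to the front and keep the remaining entries in
-- order.
front₁ front₂ front₃ : Code 4
front₁ = # 1 , # 0 , # 0 , # 0 , tt
front₂ = # 1 , # 1 , # 0 , # 0 , tt
front₃ = # 1 , # 1 , # 1 , # 0 , tt

twoEdges-linked : ∀ {n} (G : ThreeGraph n) v → + 2 ℤ.* + bit (twoEdges G v) ℤ.≤
  + bit (linkedᵛ G v) ℤ.+ (+ bit (linkedᵛ G (permute front₁ v)) ℤ.+ (+ bit (linkedᵛ G (permute front₂ v)) ℤ.+ + bit (linkedᵛ G (permute front₃ v))))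
twoEdges-linked G v@(p ∷ q ∷ r ∷ s ∷ []) = ℤₚ.≤-trans
    (ℤₚ.*-monoˡ-≤-nonNeg (+ 2) (bit-mono (twoFaces-cong {face G (Vec.lookup v)} agree)))
    (ℤₚ.≤-trans (ℤₚ.≤-reflexive (sym (ℤₚ.pos-* 2 (bit (twoFaces (Vec.lookup (e₀ ∷ e₁ ∷ e₂ ∷ e₃ ∷ []))))))) (ℤₚ.≤-trans (ℤ.+≤+ (ℕₚ.≤ᵇ⇒≤ (2 ℕ.* bit (twoFaces (Vec.lookup (e₀ ∷ e₁ ∷ e₂ ∷ e₃ ∷ [])))) (linkedFaces (e₀ ∷ e₁ ∷ e₂ ∷ e₃ ∷ [])) (≡⇒T (everyVec-true 4 facesCheck faces-checked (e₀ ∷ e₁ ∷ e₂ ∷ e₃ ∷ [])))))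
      (ℤₚ.≤-reflexive rewritten)))
  where
  e₀ = hasEdge G q r s
  e₁ = hasEdge G p r s
  e₂ = hasEdge G p q s
  e₃ = hasEdge G p q r
  agree : ∀ i → face G (Vec.lookup v) i ≡ Vec.lookup (e₀ ∷ e₁ ∷ e₂ ∷ e₃ ∷ []) i
  agree zero                   = refl
  agree (suc zero)             = refl
  agree (suc (suc zero))       = refl
  agree (suc (suc (suc zero))) = refl
  rot : ∀ x a b → hasEdge G a b x ≡ hasEdge G x a b
  rot x a b = trans (hasEdge-swapʳ G a b x) (hasEdge-swap G a x b)
  rewritten : + (bit (e₀ ∧ (e₃ ∨ e₁ ∨ e₂)) ℕ.+ (bit (e₁ ∧ (e₃ ∨ e₀ ∨ e₂)) ℕ.+ (bit (e₂ ∧ (e₃ ∨ e₀ ∨ e₁)) ℕ.+ bit (e₃ ∧ (e₂ ∨ e₀ ∨ e₁)))))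
    ≡ + bit (linkedᵛ G v) ℤ.+ (+ bit (linkedᵛ G (permute front₁ v)) ℤ.+ (+ bit (linkedᵛ G (permute front₂ v)) ℤ.+ + bit (linkedᵛ G (permute front₃ v))))
  rewritten = cong₂ (λ a b → + (bit (linkedᵛ G v) ℕ.+ (bit a ℕ.+ b)))
    (cong₂ (λ a b → e₁ ∧ (a ∨ e₀ ∨ b)) (hasEdge-swap G p q r) (hasEdge-swap G p q s))
    (cong₂ (λ a b → bit a ℕ.+ bit b)
      (cong₂ (λ a b → e₂ ∧ (a ∨ b)) (rot r p q) (cong₂ _∨_ (hasEdge-swap G q r s) (hasEdge-swap G p r s)))
      (cong₂ (λ a b → e₃ ∧ (a ∨ b)) (rot s p q) (cong₂ _∨_ (rot s q r) (rot s p r))))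

link-count : ∀ {n} (G : ThreeGraph n) → + 2 ℤ.* ∑ᵛ 4 (λ v → + bit (twoEdges G v)) ℤ.≤ + 4 ℤ.* ∑ᵛ 4 (λ v → + bit (linkedᵛ G v))
link-count {n} G = subst₂ ℤ._≤_ (∑ᵛ-*ˡ 4 (+ 2) (λ v → + bit (twoEdges G v))) four (∑ᵛ-mono 4 (twoEdges-linked G))
  where
  L : Vec (Fin n) 4 → ℤ
  L v = + bit (linkedᵛ G v)
  S = ∑ᵛ 4 L
  times4 : ∀ x → x ℤ.+ (x ℤ.+ (x ℤ.+ x)) ≡ + 4 ℤ.* x
  times4 = solve 1 (λ x → x :+ (x :+ (x :+ x)) := con (+ 4) :* x) refl
  four : ∑ᵛ 4 (λ v → L v ℤ.+ (L (permute front₁ v) ℤ.+ (L (permute front₂ v) ℤ.+ L (permute front₃ v)))) ≡ + 4 ℤ.* S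
  four = trans (∑ᵛ-+ 4 L _) (trans (cong (ℤ._+_ S) (trans (∑ᵛ-+ 4 (L ∘ permute front₁) _)
    (cong₂ ℤ._+_ (∑ᵛ-permute 4 front₁ L) (trans (∑ᵛ-+ 4 (L ∘ permute front₂) (L ∘ permute front₃))
      (cong₂ ℤ._+_ (∑ᵛ-permute 4 front₂ L) (∑ᵛ-permute 4 front₃ L)))))) (times4 S))

increasing-chain : ∀ {n} (S : Vec (Fin n) 4) → increasing S ≡ true → chain S ≡ true
increasing-chain S@(a ∷ b ∷ c ∷ d ∷ []) h =
  cong₂ _∧_ (less (# 0) (# 1) refl) (cong₂ _∧_ (less (# 1) (# 2) refl) (cong₂ _∧_ (less (# 2) (# 3) refl) refl))
  where
  less : ∀ i j → ltF i j ≡ true → ltF (Vec.lookup S i) (Vec.lookup S j) ≡ true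
  less = increasing-lookup S h

opaque
  unfolding ∑ᵛ

  link-sum : ∀ {n} (G : ThreeGraph n) → sum (λ x → tripleCount (linked G x)) ≡ ∑ᵛ 4 (λ v → + bit (linkedᵛ G v))
  link-sum G = refl

linked-bounded : ∀ {n} (G : ThreeGraph n) → K4⁻F32-free n G → + 18 ℤ.* ∑ᵛ 4 (λ v → + bit (linkedᵛ G v)) ℤ.≤ + 5 ℤ.* + (n ℕ.^ 4)
linked-bounded {n} G free = ℤₚ.≤-trans (ℤₚ.≤-reflexive (trans (cong (ℤ._*_ (+ 18)) (sym (link-sum G))) (*-distribˡ-sum (+ 18) (λ x → tripleCount (linked G x)))))
  (ℤₚ.≤-trans (sum-mono λ x → triples-bounded (link-valid G free x)) (ℤₚ.≤-reflexive total))
  where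
  total : sum {n} (λ _ → + 5 ℤ.* + (n ℕ.^ 3)) ≡ + 5 ℤ.* + (n ℕ.^ 4)
  total = trans (sum-const n _) (trans (rearrange (+ n) (+ (n ℕ.^ 3))) (cong (ℤ._*_ (+ 5)) (sym (ℤₚ.pos-* n (n ℕ.^ 3)))))
    where
    rearrange : ∀ x y → x ℤ.* (+ 5 ℤ.* y) ≡ + 5 ℤ.* (x ℤ.* y)
    rearrange = solve 2 (λ x y → x :* (con (+ 5) :* y) := con (+ 5) :* (x :* y)) refl

-- 216 = 9 * 24, and `24 * (n C 4)` is `n ^ 4` up to lower order, so this is the density 5/9.
upper-bound : ∀ {n} (G : ThreeGraph n) → K4⁻F32-free n G → 216 ℕ.* eH G4-2 G ℕ.≤ 5 ℕ.* n ℕ.^ 4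
upper-bound {n} G free = ℤₚ.drop‿+≤+ (subst₂ ℤ._≤_ (sym (ℤₚ.pos-* 216 (eH G4-2 G))) (sym (ℤₚ.pos-* 5 (n ℕ.^ 4)))
  (assemble (+ eH G4-2 G) A B C copies (sorted-twoEdges G) (link-count G) (linked-bounded G free)))
  where
  A = ∑ᵛ {n} 4 (λ v → + bit (chain v ∧ twoEdges G v))
  B = ∑ᵛ {n} 4 (λ v → + bit (twoEdges G v))
  C = ∑ᵛ {n} 4 (λ v → + bit (linkedᵛ G v))
  copies : + eH G4-2 G ℤ.≤ A
  copies = subst (ℤ._≤ A) (sym (cnt-allVecs 4 (λ S → increasing S ∧ inducesCopyOf G4-2 G S)))
    (∑ᵛ-mono 4 λ S → bit-mono λ h → cong₂ _∧_ (increasing-chain S (proj₁ (∧-true {increasing S} h)))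
                                              (copy-twoEdges G S (proj₂ (∧-true {increasing S} h))))
  assemble : ∀ e A B C → e ℤ.≤ A → + 24 ℤ.* A ℤ.≤ B → + 2 ℤ.* B ℤ.≤ + 4 ℤ.* C → + 18 ℤ.* C ℤ.≤ + 5 ℤ.* + (n ℕ.^ 4) →
            + 216 ℤ.* e ℤ.≤ + 5 ℤ.* + (n ℕ.^ 4)
  -- The inequalities are chained at four times the claim, since 18 * 2 * 24 = 4 * 216, and the
  -- factor 4 is cancelled at the end.
  assemble e A B C h₁ h₂ h₃ h₄ = ℤₚ.*-cancelˡ-≤-pos _ _ (+ 4) (ℤₚ.≤-trans (ℤₚ.≤-trans
      (subst (ℤ._≤ + 18 ℤ.* (+ 2 ℤ.* B)) (flat e) (ℤₚ.*-monoˡ-≤-nonNeg (+ 18) (ℤₚ.*-monoˡ-≤-nonNeg (+ 2) (ℤₚ.≤-trans (ℤₚ.*-monoˡ-≤-nonNeg (+ 24) h₁) h₂))))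
      (ℤₚ.*-monoˡ-≤-nonNeg (+ 18) h₃))
    (subst (ℤ._≤ + 4 ℤ.* (+ 5 ℤ.* + (n ℕ.^ 4))) (flat′ C) (ℤₚ.*-monoˡ-≤-nonNeg (+ 4) h₄)))
    where
    flat : ∀ e → + 18 ℤ.* (+ 2 ℤ.* (+ 24 ℤ.* e)) ≡ + 4 ℤ.* (+ 216 ℤ.* e)
    flat = solve 1 (λ e → con (+ 18) :* (con (+ 2) :* (con (+ 24) :* e)) := con (+ 4) :* (con (+ 216) :* e)) refl
    flat′ : ∀ C → + 4 ℤ.* (+ 18 ℤ.* C) ≡ + 18 ℤ.* (+ 4 ℤ.* C)
    flat′ = solve 1 (λ C → con (+ 4) :* (con (+ 18) :* C) := con (+ 18) :* (con (+ 4) :* C)) refl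

open import Data.Nat.Combinatorics using (_C_; nCk+nC[k+1]≡[n+1]C[k+1]; nC1≡n)

-- Binomial coefficients and the passage to densities.

-- This and the next two are falling factorials, with the argument shifted so that no subtraction
-- occurs.
binomial₂ : ∀ n → 2 * (suc n C 2) ≡ suc n * n
binomial₂ zero    = refl
binomial₂ (suc n) = trans (cong (2 *_) (sym (nCk+nC[k+1]≡[n+1]C[k+1] (suc n) 1)))
  (trans (ℕₚ.*-distribˡ-+ 2 (suc n C 1) (suc n C 2))
  (trans (cong₂ _+_ (cong (2 *_) (nC1≡n (suc n))) (binomial₂ n))
    (solveℕ 1 (λ n → conℕ 2 ⊗ (conℕ 1 ⊕ n) ⊕ (conℕ 1 ⊕ n) ⊗ n ≜ (conℕ 2 ⊕ n) ⊗ (conℕ 1 ⊕ n)) refl n)))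

binomial₃ : ∀ n → 6 * ((2 + n) C 3) ≡ (2 + n) * (suc n * n)
binomial₃ zero    = refl
binomial₃ (suc n) = trans (cong (6 *_) (sym (nCk+nC[k+1]≡[n+1]C[k+1] (2 + n) 2)))
  (trans (solveℕ 2 (λ a b → conℕ 6 ⊗ (a ⊕ b) ≜ conℕ 3 ⊗ (conℕ 2 ⊗ a) ⊕ conℕ 6 ⊗ b) refl ((2 + n) C 2) ((2 + n) C 3))
  (trans (cong₂ _+_ (cong (3 *_) (binomial₂ (suc n))) (binomial₃ n))
    (solveℕ 1 (λ n → conℕ 3 ⊗ ((conℕ 2 ⊕ n) ⊗ (conℕ 1 ⊕ n)) ⊕ (conℕ 2 ⊕ n) ⊗ ((conℕ 1 ⊕ n) ⊗ n) ≜
                     (conℕ 3 ⊕ n) ⊗ ((conℕ 2 ⊕ n) ⊗ (conℕ 1 ⊕ n))) refl n)))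

binomial₄ : ∀ n → 24 * ((3 + n) C 4) ≡ (3 + n) * ((2 + n) * (suc n * n))
binomial₄ zero    = refl
binomial₄ (suc n) = trans (cong (24 *_) (sym (nCk+nC[k+1]≡[n+1]C[k+1] (3 + n) 3)))
  (trans (solveℕ 2 (λ a b → conℕ 24 ⊗ (a ⊕ b) ≜ conℕ 4 ⊗ (conℕ 6 ⊗ a) ⊕ conℕ 24 ⊗ b) refl ((3 + n) C 3) ((3 + n) C 4))
  (trans (cong₂ _+_ (cong (4 *_) (binomial₃ (suc n))) (binomial₄ n))
    (solveℕ 1 (λ n → conℕ 4 ⊗ ((conℕ 3 ⊕ n) ⊗ ((conℕ 2 ⊕ n) ⊗ (conℕ 1 ⊕ n))) ⊕ (conℕ 3 ⊕ n) ⊗ ((conℕ 2 ⊕ n) ⊗ ((conℕ 1 ⊕ n) ⊗ n)) ≜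
                     (conℕ 4 ⊕ n) ⊗ ((conℕ 3 ⊕ n) ⊗ ((conℕ 2 ⊕ n) ⊗ (conℕ 1 ⊕ n)))) refl n)))

binomial-≤ : ∀ n → 3 ≤ n → 24 * (n C 4) ≤ n ^ 4
binomial-≤ n h with ℕₚ.m≤n⇒∃[o]m+o≡n h
... | x , refl = subst₂ _≤_ (sym (binomial₄ x)) (remainder x)
    (ℕₚ.m≤m+n ((3 + x) * ((2 + x) * (suc x * x))) ((3 + x) * (6 * (x * x) + 25 * x + 27)))
  where
  remainder : ∀ x → (3 + x) * ((2 + x) * (suc x * x)) + (3 + x) * (6 * (x * x) + 25 * x + 27) ≡ (3 + x) ^ 4
  remainder = solveℕ 1 (λ x → let n = conℕ 3 ⊕ x in
    n ⊗ ((conℕ 2 ⊕ x) ⊗ ((conℕ 1 ⊕ x) ⊗ x)) ⊕ n ⊗ (conℕ 6 ⊗ (x ⊗ x) ⊕ conℕ 25 ⊗ x ⊕ conℕ 27) ≜ n ⊗ (n ⊗ (n ⊗ (n ⊗ conℕ 1)))) refl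

-- The falling factorial is `n^4 - 6 n^3 + 11 n^2 - 6 n`, and for `n = 3 + x` the surplus
-- `11 n^2 - 6 n` is `n (11 x + 27)`.
binomial-≥ : ∀ n → 3 ≤ n → n ^ 4 ≤ 24 * (n C 4) + 6 * n ^ 3
binomial-≥ n h with ℕₚ.m≤n⇒∃[o]m+o≡n h
... | x , refl = subst ((3 + x) ^ 4 ≤_) (trans (remainder x) (cong (_+ 6 * (3 + x) ^ 3) (sym (binomial₄ x))))
    (ℕₚ.m≤m+n ((3 + x) ^ 4) ((3 + x) * (11 * x + 27)))
  where
  remainder : ∀ x → (3 + x) ^ 4 + (3 + x) * (11 * x + 27) ≡ (3 + x) * ((2 + x) * (suc x * x)) + 6 * (3 + x) ^ 3
  remainder = solveℕ 1 (λ x → let n = conℕ 3 ⊕ x in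
    n ⊗ (n ⊗ (n ⊗ (n ⊗ conℕ 1))) ⊕ n ⊗ (conℕ 11 ⊗ x ⊕ conℕ 27) ≜
    n ⊗ ((conℕ 2 ⊕ x) ⊗ ((conℕ 1 ⊕ x) ⊗ x)) ⊕ conℕ 6 ⊗ (n ⊗ (n ⊗ (n ⊗ conℕ 1)))) refl

-- Discarding the remainder `r` of `n` costs at most `4 r n^3`. The slack `s` is chosen later with
-- `r + s = 5`, which makes the constant independent of `r`.
fourth-power-shift : ∀ y r s → (y + r) ^ 4 ≤ y ^ 4 + 4 * (r + s) * (y + r) ^ 3
fourth-power-shift y r s = subst ((y + r) ^ 4 ≤_) (remainder y r s)
    (ℕₚ.m≤m+n ((y + r) ^ 4) (r * (6 * (y * y * r) + 8 * (y * r * r) + 3 * (r * r * r)) + 4 * s * (y + r) ^ 3))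
  where
  remainder : ∀ y r s → (y + r) ^ 4 + (r * (6 * (y * y * r) + 8 * (y * r * r) + 3 * (r * r * r)) + 4 * s * (y + r) ^ 3) ≡
              y ^ 4 + 4 * (r + s) * (y + r) ^ 3
  remainder = solveℕ 3 (λ y r s → let n = y ⊕ r ; n³ = n ⊗ (n ⊗ (n ⊗ conℕ 1)) in
    n ⊗ n³ ⊕ (r ⊗ (conℕ 6 ⊗ (y ⊗ y ⊗ r) ⊕ conℕ 8 ⊗ (y ⊗ r ⊗ r) ⊕ conℕ 3 ⊗ (r ⊗ r ⊗ r)) ⊕ conℕ 4 ⊗ s ⊗ n³) ≜
    y ⊗ (y ⊗ (y ⊗ (y ⊗ conℕ 1))) ⊕ conℕ 4 ⊗ (r ⊕ s) ⊗ n³) refl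

three≤ : ∀ k n → 19 * suc k ≤ n → 3 ≤ n
three≤ k n h = ℕₚ.≤-trans (ℕₚ.≤-trans (ℕₚ.m≤m+n 3 16) (ℕₚ.m≤m*n 19 (suc k))) h

-- Source of the threshold: 117 + 54 = 171 = 9 * 19, where 54 = 9 * 6 is nine times the cubic loss
-- of `binomial-≥`. The constant 117 covers both cubic errors that occur, 30 in the upper estimate
-- and 115 in the lower one.
cubic-negligible : ∀ k n → 19 * suc k ≤ n → 117 * suc k * n ^ 3 ≤ 9 * (24 * (n C 4))
cubic-negligible k n h = ℕₚ.+-cancelʳ-≤ (54 * c) (117 * K * c) (9 * (24 * (n C 4))) (begin
  117 * K * c + 54 * c           ≤⟨ ℕₚ.+-monoʳ-≤ (117 * K * c) (ℕₚ.*-monoˡ-≤ c (ℕₚ.m≤m*n 54 K)) ⟩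
  117 * K * c + 54 * K * c       ≡⟨ collect K c ⟩
  9 * (19 * K * c)               ≤⟨ ℕₚ.*-monoʳ-≤ 9 (ℕₚ.*-monoˡ-≤ c h) ⟩
  9 * n ^ 4                      ≤⟨ ℕₚ.*-monoʳ-≤ 9 (binomial-≥ n (three≤ k n h)) ⟩
  9 * (24 * (n C 4) + 6 * c)     ≡⟨ expand (24 * (n C 4)) c ⟩
  9 * (24 * (n C 4)) + 54 * c    ∎)
  where
  open ℕₚ.≤-Reasoning
  K = suc k
  c = n ^ 3
  collect : ∀ K c → 117 * K * c + 54 * K * c ≡ 9 * (19 * K * c)
  collect = solveℕ 2 (λ K c → conℕ 117 ⊗ K ⊗ c ⊕ conℕ 54 ⊗ K ⊗ c ≜ conℕ 9 ⊗ (conℕ 19 ⊗ K ⊗ c)) refl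
  expand : ∀ F c → 9 * (F + 6 * c) ≡ 9 * F + 54 * c
  expand = solveℕ 2 (λ F c → conℕ 9 ⊗ (F ⊕ conℕ 6 ⊗ c) ≜ conℕ 9 ⊗ F ⊕ conℕ 54 ⊗ c) refl

density-≤ : ∀ k n e → 19 * suc k ≤ n → 216 * e ≤ 5 * n ^ 4 → 9 * suc k * e ≤ 5 * suc k * (n C 4) + 9 * (n C 4)
density-≤ k n e h bound = ℕₚ.*-cancelˡ-≤ 24 (begin
  24 * (9 * K * e)                     ≡⟨ scale-left K e ⟩
  K * (216 * e)                        ≤⟨ ℕₚ.*-monoʳ-≤ K bound ⟩
  K * (5 * n ^ 4)                      ≤⟨ ℕₚ.*-monoʳ-≤ K (ℕₚ.*-monoʳ-≤ 5 (binomial-≥ n (three≤ k n h))) ⟩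
  K * (5 * (24 * B + 6 * c))           ≡⟨ expand K B c ⟩
  5 * K * (24 * B) + 30 * K * c        ≤⟨ ℕₚ.+-monoʳ-≤ (5 * K * (24 * B)) (ℕₚ.*-monoˡ-≤ c (ℕₚ.*-monoˡ-≤ K (ℕₚ.m≤m+n 30 87))) ⟩
  5 * K * (24 * B) + 117 * K * c       ≤⟨ ℕₚ.+-monoʳ-≤ (5 * K * (24 * B)) (cubic-negligible k n h) ⟩
  5 * K * (24 * B) + 9 * (24 * B)      ≡⟨ scale-right K B ⟩
  24 * (5 * K * B + 9 * B)             ∎)
  where
  open ℕₚ.≤-Reasoning
  K = suc k
  B = n C 4
  c = n ^ 3
  scale-left : ∀ K e → 24 * (9 * K * e) ≡ K * (216 * e)
  scale-left = solveℕ 2 (λ K e → conℕ 24 ⊗ (conℕ 9 ⊗ K ⊗ e) ≜ K ⊗ (conℕ 216 ⊗ e)) refl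
  expand : ∀ K B c → K * (5 * (24 * B + 6 * c)) ≡ 5 * K * (24 * B) + 30 * K * c
  expand = solveℕ 3 (λ K B c → K ⊗ (conℕ 5 ⊗ (conℕ 24 ⊗ B ⊕ conℕ 6 ⊗ c)) ≜ conℕ 5 ⊗ K ⊗ (conℕ 24 ⊗ B) ⊕ conℕ 30 ⊗ K ⊗ c) refl
  scale-right : ∀ K B → 5 * K * (24 * B) + 9 * (24 * B) ≡ 24 * (5 * K * B + 9 * B)
  scale-right = solveℕ 2 (λ K B → conℕ 5 ⊗ K ⊗ (conℕ 24 ⊗ B) ⊕ conℕ 9 ⊗ (conℕ 24 ⊗ B) ≜ conℕ 24 ⊗ (conℕ 5 ⊗ K ⊗ B ⊕ conℕ 9 ⊗ B)) refl

-- The cubic losses are 5 * 20 = 100 from at most five leftover vertices, and 15 from the term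
-- `15 * m ^ 3`, because `216 * m ^ 3` equals `(6 * m) ^ 3`.
density-≥ : ∀ k m r e → r ≤ 5 → 19 * suc k ≤ 6 * m + r → 30 * m ^ 4 ≤ e + 15 * m ^ 3 →
            5 * suc k * ((6 * m + r) C 4) ≤ 9 * suc k * e + 9 * ((6 * m + r) C 4)
density-≥ k m r e r≤5 h bound = ℕₚ.*-cancelˡ-≤ 24 (begin
  24 * (5 * K * B)                                   ≡⟨ scale-left K B ⟩
  K * (5 * (24 * B))                                 ≤⟨ ℕₚ.*-monoʳ-≤ K (ℕₚ.*-monoʳ-≤ 5 (binomial-≤ n (three≤ k n h))) ⟩
  K * (5 * n ^ 4)                                    ≤⟨ ℕₚ.*-monoʳ-≤ K (ℕₚ.*-monoʳ-≤ 5 shifted) ⟩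
  K * (5 * ((6 * m) ^ 4 + 20 * c))                   ≡⟨ expand K m c ⟩
  K * (216 * (30 * m ^ 4)) + 100 * K * c             ≤⟨ ℕₚ.+-monoˡ-≤ (100 * K * c) (ℕₚ.*-monoʳ-≤ K (ℕₚ.*-monoʳ-≤ 216 bound)) ⟩
  K * (216 * (e + 15 * m ^ 3)) + 100 * K * c         ≡⟨ cubes K e m c ⟩
  216 * K * e + (15 * K * (6 * m) ^ 3 + 100 * K * c) ≤⟨ ℕₚ.+-monoʳ-≤ (216 * K * e) (ℕₚ.+-monoˡ-≤ (100 * K * c) (ℕₚ.*-monoʳ-≤ (15 * K) (ℕₚ.^-monoˡ-≤ 3 (ℕₚ.m≤m+n (6 * m) r)))) ⟩
  216 * K * e + (15 * K * c + 100 * K * c)           ≡⟨ collect K e c ⟩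
  216 * K * e + 115 * K * c                          ≤⟨ ℕₚ.+-monoʳ-≤ (216 * K * e) (ℕₚ.*-monoˡ-≤ c (ℕₚ.*-monoˡ-≤ K (ℕₚ.m≤m+n 115 2))) ⟩
  216 * K * e + 117 * K * c                          ≤⟨ ℕₚ.+-monoʳ-≤ (216 * K * e) (cubic-negligible k n h) ⟩
  216 * K * e + 9 * (24 * B)                         ≡⟨ scale-right K e B ⟩
  24 * (9 * K * e + 9 * B)                           ∎)
  where
  open ℕₚ.≤-Reasoning
  K = suc k
  n = 6 * m + r
  B = n C 4
  c = n ^ 3
  shifted : n ^ 4 ≤ (6 * m) ^ 4 + 20 * c
  shifted = let s , q = ℕₚ.m≤n⇒∃[o]m+o≡n r≤5 in
    subst (λ t → n ^ 4 ≤ (6 * m) ^ 4 + 4 * t * c) q (fourth-power-shift (6 * m) r s)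
  scale-left : ∀ K B → 24 * (5 * K * B) ≡ K * (5 * (24 * B))
  scale-left = solveℕ 2 (λ K B → conℕ 24 ⊗ (conℕ 5 ⊗ K ⊗ B) ≜ K ⊗ (conℕ 5 ⊗ (conℕ 24 ⊗ B))) refl
  expand : ∀ K m c → K * (5 * ((6 * m) ^ 4 + 20 * c)) ≡ K * (216 * (30 * m ^ 4)) + 100 * K * c
  expand = solveℕ 3 (λ K m c → let y = conℕ 6 ⊗ m in
    K ⊗ (conℕ 5 ⊗ (y ⊗ (y ⊗ (y ⊗ (y ⊗ conℕ 1))) ⊕ conℕ 20 ⊗ c)) ≜
    K ⊗ (conℕ 216 ⊗ (conℕ 30 ⊗ (m ⊗ (m ⊗ (m ⊗ (m ⊗ conℕ 1)))))) ⊕ conℕ 100 ⊗ K ⊗ c) refl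
  cubes : ∀ K e m c → K * (216 * (e + 15 * m ^ 3)) + 100 * K * c ≡ 216 * K * e + (15 * K * (6 * m) ^ 3 + 100 * K * c)
  cubes = solveℕ 4 (λ K e m c → let y = conℕ 6 ⊗ m in
    K ⊗ (conℕ 216 ⊗ (e ⊕ conℕ 15 ⊗ (m ⊗ (m ⊗ (m ⊗ conℕ 1))))) ⊕ conℕ 100 ⊗ K ⊗ c ≜
    conℕ 216 ⊗ K ⊗ e ⊕ (conℕ 15 ⊗ K ⊗ (y ⊗ (y ⊗ (y ⊗ conℕ 1))) ⊕ conℕ 100 ⊗ K ⊗ c)) refl
  collect : ∀ K e c → 216 * K * e + (15 * K * c + 100 * K * c) ≡ 216 * K * e + 115 * K * c
  collect = solveℕ 3 (λ K e c → conℕ 216 ⊗ K ⊗ e ⊕ (conℕ 15 ⊗ K ⊗ c ⊕ conℕ 100 ⊗ K ⊗ c) ≜ conℕ 216 ⊗ K ⊗ e ⊕ conℕ 115 ⊗ K ⊗ c) refl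
  scale-right : ∀ K e B → 216 * K * e + 9 * (24 * B) ≡ 24 * (9 * K * e + 9 * B)
  scale-right = solveℕ 3 (λ K e B → conℕ 216 ⊗ K ⊗ e ⊕ conℕ 9 ⊗ (conℕ 24 ⊗ B) ≜ conℕ 24 ⊗ (conℕ 9 ⊗ K ⊗ e ⊕ conℕ 9 ⊗ B)) refl

sixths : ∀ n → 6 ≤ n → ∃ λ m → ∃ λ r → r ≤ 5 × 6 * suc m + r ≡ n
sixths n h with ℕₚ.m≤n⇒∃[o]m+o≡n h
... | o , refl = o / 6 , o % 6 , ℕ.s≤s⁻¹ (m%n<n o 6) ,
    trans (regroup (o / 6) (o % 6)) (cong (λ x → 6 + x) (sym (m≡m%n+[m/n]*n o 6)))
  where
  regroup : ∀ m r → 6 * suc m + r ≡ 6 + (r + m * 6)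
  regroup = solveℕ 2 (λ m r → conℕ 6 ⊗ (conℕ 1 ⊕ m) ⊕ r ≜ conℕ 6 ⊕ (r ⊕ m ⊗ conℕ 6)) refl

-- The blow-up of the design and its copies of 4.2.

-- For each of three neighbouring comparisons, `x` and `y` say that the part goes up or stays the
-- same, and `l` compares positions within a part; `κ` says that the parts induce a copy. At most
-- one of the four summands is 1, because `not x ∧ y` excludes `x`, and each of them implies the
-- right-hand side.
case₁₀ : Vec Bool 10 → Bool
case₁₀ (x₁ ∷ y₁ ∷ l₁ ∷ x₂ ∷ y₂ ∷ l₂ ∷ x₃ ∷ y₃ ∷ l₃ ∷ κ ∷ []) =
  (+ bit (x₁ ∧ x₂ ∧ x₃ ∧ κ) ℤ.+ (+ bit ((not x₁ ∧ y₁) ∧ x₂ ∧ x₃ ∧ κ) ℤ.* + bit l₁ ℤ.+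
    (+ bit (x₁ ∧ (not x₂ ∧ y₂) ∧ x₃ ∧ κ) ℤ.* + bit l₂ ℤ.+ + bit (x₁ ∧ x₂ ∧ (not x₃ ∧ y₃) ∧ κ) ℤ.* + bit l₃)))
  ≤ᵇ (+ bit ((x₁ ∨ (y₁ ∧ l₁)) ∧ (x₂ ∨ (y₂ ∧ l₂)) ∧ (x₃ ∨ (y₃ ∧ l₃)) ∧ κ))

case₁₀-checked : everyVec 10 case₁₀ ≡ true
case₁₀-checked = refl

everyVec′ : ∀ k → (Vec (Fin 6) k → Bool) → Bool
everyVec′ zero    ok = ok []
everyVec′ (suc k) ok = everyFin 6 λ i → everyVec′ k (ok ∘ (i ∷_))

everyVec′-true : ∀ k (ok : Vec (Fin 6) k → Bool) → everyVec′ k ok ≡ true → ∀ v → ok v ≡ true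
everyVec′-true zero    ok h []      = h
everyVec′-true (suc k) ok h (i ∷ v) = everyVec′-true k (ok ∘ (i ∷_)) (everyFin-true 6 (λ i → everyVec′ k (ok ∘ (i ∷_))) h i) v

-- `hasEdge` consults its function on increasing triples only, and the images of `x`, `y`, `z` may
-- be ordered differently; symmetry of `hasEdge H` absorbs this. Equal vertices have equal images,
-- which never form an edge.
hasEdge-blowup : ∀ {k n} (H : ThreeGraph k) (f : Fin n → Fin k) x y z →
                 hasEdge (λ a b c → hasEdge H (f a) (f b) (f c)) x y z ≡ hasEdge H (f x) (f y) (f z)
hasEdge-blowup H f x y z with eqF x y in d₁ | eqF y z in d₂ | eqF x z in d₃
... | true  | _     | _     = sym (conj-false λ h → hasEdge-distinct H (f x) (f y) (f z) h (cong f (eqF-true x y d₁)))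
... | false | true  | _     = sym (conj-false λ h → hasEdge-distinct H (f y) (f z) (f x)
    (trans (trans (hasEdge-swapʳ H (f y) (f z) (f x)) (hasEdge-swap H (f y) (f x) (f z))) h) (cong f (eqF-true y z d₂)))
... | false | false | true  = sym (conj-false λ h → hasEdge-distinct H (f x) (f z) (f y)
    (trans (hasEdge-swapʳ H (f x) (f z) (f y)) h) (cong f (eqF-true x z d₃)))
... | false | false | false with ltF x y | ltF y z | ltF x z
... | true  | true  | _     = refl
... | true  | false | true  = hasEdge-swapʳ H (f x) (f z) (f y)
... | true  | false | false = trans (hasEdge-swap H (f z) (f x) (f y)) (hasEdge-swapʳ H (f x) (f z) (f y))
... | false | _     | true  = hasEdge-swap H (f y) (f x) (f z)
... | false | true  | false = trans (hasEdge-swapʳ H (f y) (f z) (f x)) (hasEdge-swap H (f y) (f x) (f z))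
... | false | false | false = trans (hasEdge-swap H (f z) (f y) (f x)) (trans (hasEdge-swapʳ H (f y) (f z) (f x)) (hasEdge-swap H (f y) (f x) (f z)))

-- The 2-(6,3,2) design: every pair lies in two edges and every four points span exactly two.
design : ThreeGraph 6
design a b c = anyᵇ (sameTriple (a , b , c))
  ((# 0 , # 1 , # 2) ∷ (# 0 , # 1 , # 3) ∷ (# 0 , # 2 , # 4) ∷ (# 0 , # 3 , # 5) ∷ (# 0 , # 4 , # 5) ∷
   (# 1 , # 2 , # 5) ∷ (# 1 , # 3 , # 4) ∷ (# 1 , # 4 , # 5) ∷ (# 2 , # 3 , # 4) ∷ (# 2 , # 3 , # 5) ∷ [])

blowup : ∀ {n} → (Fin n → Fin 6) → ThreeGraph n
blowup f a b c = hasEdge design (f a) (f b) (f c)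

-- Tested on all tuples of points, repetitions included, since a copy in the blow-up may place
-- several vertices in one part.
noK4⁻ : Fin 6 → Fin 6 → Fin 6 → Fin 6 → Bool
noK4⁻ p q a b = not (hasEdge design p q a ∧ hasEdge design p q b ∧ hasEdge design p a b)

noF32 : Fin 6 → Fin 6 → Fin 6 → Fin 6 → Fin 6 → Bool
noF32 p q a b c = not (hasEdge design p q a ∧ hasEdge design p q b ∧ hasEdge design p q c ∧ hasEdge design a b c)

design-noK4⁻ : everyVec′ 4 (λ { (p ∷ q ∷ a ∷ b ∷ []) → noK4⁻ p q a b }) ≡ true
design-noK4⁻ = refl

design-noF32 : everyVec′ 5 (λ { (p ∷ q ∷ a ∷ b ∷ c ∷ []) → noF32 p q a b c }) ≡ true
design-noF32 = refl

blowup-free : ∀ {n} (f : Fin n → Fin 6) → K4⁻F32-free n (blowup f)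
blowup-free {n} f = noK , noF
  where
  E : ∀ x y z → hasEdge (blowup f) x y z ≡ true → hasEdge design (f x) (f y) (f z) ≡ true
  E x y z h = trans (sym (hasEdge-blowup design f x y z)) h
  noK : ¬ Contains K4⁻ (blowup f)
  noK (φ , _ , h) = case trans (sym (everyVec′-true 4 (λ { (p ∷ q ∷ a ∷ b ∷ []) → noK4⁻ p q a b }) design-noK4⁻
      (f (φ (# 0)) ∷ f (φ (# 1)) ∷ f (φ (# 2)) ∷ f (φ (# 3)) ∷ [])))
    (cong not (cong₂ _∧_ (E _ _ _ (h (# 0) (# 1) (# 2) refl)) (cong₂ _∧_ (E _ _ _ (h (# 0) (# 1) (# 3) refl)) (E _ _ _ (h (# 0) (# 2) (# 3) refl))))) of λ ()
  noF : ¬ Contains F32 (blowup f)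
  noF (φ , _ , h) = case trans (sym (everyVec′-true 5 (λ { (p ∷ q ∷ a ∷ b ∷ c ∷ []) → noF32 p q a b c }) design-noF32
      (f (φ (# 0)) ∷ f (φ (# 1)) ∷ f (φ (# 2)) ∷ f (φ (# 3)) ∷ f (φ (# 4)) ∷ [])))
    (cong not (cong₂ _∧_ (E _ _ _ (h (# 0) (# 1) (# 2) refl)) (cong₂ _∧_ (E _ _ _ (h (# 0) (# 1) (# 3) refl))
      (cong₂ _∧_ (E _ _ _ (h (# 0) (# 1) (# 4) refl)) (E _ _ _ (h (# 2) (# 3) (# 4) refl)))))) of λ ()

any-cong : {A : Set} {P Q : A → Bool} → (∀ x → P x ≡ Q x) → ∀ xs → any P xs ≡ any Q xs
any-cong e []       = refl
any-cong e (x ∷ xs) = cong₂ _∨_ (e x) (any-cong e xs)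

all-cong : {A : Set} {P Q : A → Bool} → (∀ x → P x ≡ Q x) → ∀ xs → all P xs ≡ all Q xs
all-cong e []       = refl
all-cong e (x ∷ xs) = cong₂ _∧_ (e x) (all-cong e xs)

copy-blowup : ∀ {h n} (H : ThreeGraph h) (f : Fin n → Fin 6) (S : Vec (Fin n) h) →
              inducesCopyOf H (blowup f) S ≡ inducesCopyOf H design (Vec.map f S)
copy-blowup {h} H f S = any-cong (λ p → cong (injectiveB p ∧_)
  (all-cong (λ a → all-cong (λ b → all-cong (λ c → cong (λ e → not (hasEdge H a b c xor e)) (edge p a b c)) (allFin h)) (allFin h)) (allFin h)))
  (allVecs h h)
  where
  edge : ∀ p a b c → hasEdge (blowup f) (Vec.lookup S (Vec.lookup p a)) (Vec.lookup S (Vec.lookup p b)) (Vec.lookup S (Vec.lookup p c))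
       ≡ hasEdge design (Vec.lookup (Vec.map f S) (Vec.lookup p a)) (Vec.lookup (Vec.map f S) (Vec.lookup p b)) (Vec.lookup (Vec.map f S) (Vec.lookup p c))
  edge p a b c = trans (hasEdge-blowup design f _ _ _) (hasEdge-cong design (at a) (at b) (at c))
    where
    at : ∀ a → f (Vec.lookup S (Vec.lookup p a)) ≡ Vec.lookup (Vec.map f S) (Vec.lookup p a)
    at a = sym (lookup-map (Vec.lookup p a) f S)

all-intro : {A : Set} (P : A → Bool) → ∀ {n} (g : Fin n → A) → (∀ i → P (g i) ≡ true) → all P (tabulate g) ≡ true
all-intro P {zero}  g h = refl
all-intro P {suc n} g h = cong₂ _∧_ (h zero) (all-intro P (g ∘ suc) (h ∘ suc))

chain-lookup : ∀ {n k} (S : Vec (Fin n) k) → chain S ≡ true → ∀ i j → ltF i j ≡ true → ltF (Vec.lookup S i) (Vec.lookup S j) ≡ true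
chain-lookup (x ∷ S) h zero    (suc j) o = chain-head x S h j
chain-lookup (x ∷ S) h (suc i) (suc j) o = chain-lookup S (chain-tail x S h) i j o

chain-increasing : ∀ {n k} (S : Vec (Fin n) k) → chain S ≡ true → increasing S ≡ true
chain-increasing S h = all-intro (λ i → allFinB λ j → not (ltF i j) ∨ ltF (Vec.lookup S i) (Vec.lookup S j)) (λ i → i)
  λ i → all-intro (λ j → not (ltF i j) ∨ ltF (Vec.lookup S i) (Vec.lookup S j)) (λ j → j) (implied i)
  where
  implied : ∀ i j → not (ltF i j) ∨ ltF (Vec.lookup S i) (Vec.lookup S j) ≡ true
  implied i j with ltF i j in o
  ... | false = refl
  ... | true  = chain-lookup S h i j o

sum-split : ∀ k {r} (f : Fin (k ℕ.+ r) → ℤ) → sum f ≡ sum (λ i → f (i ↑ˡ r)) ℤ.+ sum (λ i → f (k ↑ʳ i))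
sum-split zero    f = sym (ℤₚ.+-identityˡ _)
sum-split (suc k) f = trans (cong (ℤ._+_ (f zero)) (sum-split k (f ∘ suc))) (sym (ℤₚ.+-assoc (f zero) _ _))

sum-combine : ∀ k {m} (f : Fin (k ℕ.* m) → ℤ) → sum f ≡ sum (λ a → sum λ i → f (combine {k} {m} a i))
sum-combine zero    f = refl
sum-combine (suc k) {m} f = trans (sum-split m {k ℕ.* m} f) (cong (ℤ._+_ (sum λ i → f (i ↑ˡ (k ℕ.* m)))) (sum-combine k {m} (λ i → f (m ↑ʳ i))))

triangular : ∀ m → + 2 ℤ.* sum {m} (λ i → sum {m} λ j → + bit (ltF i j)) ℤ.+ + m ≡ + m ℤ.* + m
triangular zero    = refl
triangular (suc m) = trans (cong (λ x → + 2 ℤ.* x ℤ.+ + suc m) unfolded)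
  (trans (step₁ (+ m) S) (trans (cong (λ x → x ℤ.+ (+ 2 ℤ.* + m ℤ.+ + 1)) (triangular m)) (step₂ (+ m))))
  where
  S = sum {m} λ i → sum {m} λ j → + bit (ltF i j)
  unfolded : sum {suc m} (λ i → sum {suc m} λ j → + bit (ltF i j)) ≡ + m ℤ.+ S
  unfolded = cong₂ ℤ._+_ (trans (ℤₚ.+-identityˡ _) (trans (sum-const m (+ 1)) (ℤₚ.*-identityʳ (+ m))))
    (sum-cong-≗ {m} {λ i → 0ℤ ℤ.+ sum {m} λ j → + bit (ltF i j)} λ i → ℤₚ.+-identityˡ (sum {m} λ j → + bit (ltF i j)))
  step₁ : ∀ x s → + 2 ℤ.* (x ℤ.+ s) ℤ.+ (+ 1 ℤ.+ x) ≡ (+ 2 ℤ.* s ℤ.+ x) ℤ.+ (+ 2 ℤ.* x ℤ.+ + 1)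
  step₁ = solve 2 (λ x s → con (+ 2) :* (x :+ s) :+ (con (+ 1) :+ x) := (con (+ 2) :* s :+ x) :+ (con (+ 2) :* x :+ con (+ 1))) refl
  step₂ : ∀ x → x ℤ.* x ℤ.+ (+ 2 ℤ.* x ℤ.+ + 1) ≡ (+ 1 ℤ.+ x) ℤ.* (+ 1 ℤ.+ x)
  step₂ = solve 1 (λ x → x :* x :+ (con (+ 2) :* x :+ con (+ 1)) := (con (+ 1) :+ x) :* (con (+ 1) :+ x)) refl

isSorted : ∀ {h n} → ThreeGraph h → ThreeGraph n → Vec (Fin n) h → Bool
isSorted H G S = increasing S ∧ inducesCopyOf H G S

eH-sum : ∀ {h n} (H : ThreeGraph h) (G : ThreeGraph n) → + eH H G ≡ ∑ᵛ h (λ S → + bit (isSorted H G S))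
eH-sum {h} H G = cnt-allVecs h (isSorted H G)

-- The parts are consecutive intervals of length `m`, so vertices are ordered by part and then by
-- position. The last `r` vertices are sent by `clamp` to the last part, and the lower bound leaves
-- out the copies through them.
module Blowup (m r : ℕ) {{_ : ℕ.NonZero m}} where

  n = 6 ℕ.* m ℕ.+ r

  part : Fin 6 → Fin m → Fin n
  part a i = combine a i ↑ˡ r

  class : Fin n → Fin 6
  class x = clamp 5 (toℕ x / m)

  toℕ-part : ∀ a i → toℕ (part a i) ≡ m ℕ.* toℕ a ℕ.+ toℕ i
  toℕ-part a i = trans (toℕ-↑ˡ (combine a i) r) (toℕ-combine a i)

  clamp-toℕ : ∀ {k} (a : Fin (suc k)) → clamp k (toℕ a) ≡ a
  clamp-toℕ zero            = refl
  clamp-toℕ {suc k} (suc a) = cong suc (clamp-toℕ a)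

  class-part : ∀ a i → class (part a i) ≡ a
  class-part a i = trans (cong (clamp 5) quotient) (clamp-toℕ a)
    where
    quotient : toℕ (part a i) / m ≡ toℕ a
    quotient = trans (cong (_/ m) (trans (toℕ-part a i) (cong (ℕ._+ toℕ i) (ℕₚ.*-comm m (toℕ a)))))
      (trans (+-distrib-/-∣ˡ (toℕ i) (divides-refl (toℕ a)))
        (trans (cong₂ ℕ._+_ (m*n/n≡m (toℕ a) m) (m<n⇒m/n≡0 (toℕ<n i))) (ℕₚ.+-identityʳ (toℕ a))))

  before : Fin 6 → Fin 6 → Fin m → Fin m → Bool
  before a b i j = ltF a b ∨ (eqF a b ∧ ltF i j)

  before-part : ∀ a b i j → before a b i j ≡ true → ltF (part a i) (part b j) ≡ true
  before-part a b i j h = T⇒≡ (ℕₚ.<⇒<ᵇ (subst₂ ℕ._<_ (sym (toℕ-part a i)) (sym (toℕ-part b j)) (cases (∨-true {ltF a b} h))))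
    where
    cases : ltF a b ≡ true ⊎ eqF a b ∧ ltF i j ≡ true → m ℕ.* toℕ a ℕ.+ toℕ i ℕ.< m ℕ.* toℕ b ℕ.+ toℕ j
    cases (inj₁ l) = ℕₚ.<-≤-trans (ℕₚ.+-monoʳ-< (m ℕ.* toℕ a) (toℕ<n i))
      (ℕₚ.≤-trans (ℕₚ.≤-reflexive (trans (ℕₚ.+-comm (m ℕ.* toℕ a) m) (sym (ℕₚ.*-suc m (toℕ a)))))
        (ℕₚ.≤-trans (ℕₚ.*-monoʳ-≤ m (ltF-true a b l)) (ℕₚ.m≤m+n (m ℕ.* toℕ b) (toℕ j))))
    cases (inj₂ e) with ∧-true {eqF a b} e
    ... | e₁ , e₂ rewrite eqF-true a b e₁ = ℕₚ.+-monoʳ-< (m ℕ.* toℕ b) (ltF-true i j e₂)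

  sum-parts : (f : Fin n → ℤ) → (∀ x → 0ℤ ℤ.≤ f x) → sum (λ a → sum λ i → f (part a i)) ℤ.≤ sum f
  sum-parts f h = ℤₚ.≤-trans (ℤₚ.≤-reflexive (trans (sym (sum-combine 6 {m} (λ x → f (x ↑ˡ r)))) (sym (ℤₚ.+-identityʳ front))))
    (ℤₚ.≤-trans (ℤₚ.+-monoʳ-≤ front (subst (ℤ._≤ rest) (sum-zero r) (sum-mono {r} {λ _ → 0ℤ} {λ i → f ((6 ℕ.* m) ↑ʳ i)} λ i → h ((6 ℕ.* m) ↑ʳ i))))
      (ℤₚ.≤-reflexive (sym (sum-split (6 ℕ.* m) {r} f))))
    where
    front = sum (λ x → f (x ↑ˡ r))
    rest = sum (λ i → f ((6 ℕ.* m) ↑ʳ i))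

  opaque
    unfolding ∑ᵛ

    ∑ᵛ-parts : ∀ k (f : Vec (Fin n) k → ℤ) → (∀ v → 0ℤ ℤ.≤ f v) →
               ∑ᵛ k (λ as → ∑ᵛ k λ is → f (Vec.zipWith part as is)) ℤ.≤ ∑ᵛ k f
    ∑ᵛ-parts zero    f h = ℤₚ.≤-refl
    ∑ᵛ-parts (suc k) f h = ℤₚ.≤-trans
      (ℤₚ.≤-reflexive (sum-cong-≗ {6} λ a → sym (∑ᵛ-swap k (λ i as → ∑ᵛ k λ is → f (part a i ∷ Vec.zipWith part as is)))))
      (ℤₚ.≤-trans (sum-mono λ a → sum-mono λ i → ∑ᵛ-parts k (λ v → f (part a i ∷ v)) (λ v → h (part a i ∷ v)))
        (sum-parts (λ x → ∑ᵛ k λ v → f (x ∷ v)) (λ x → ∑ᵛ-nonneg k λ v → h (x ∷ v))))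

  opaque
    isCopy : Vec (Fin 6) 4 → Bool
    isCopy = inducesCopyOf G4-2 design

    isSorted-intro : ∀ S as → Vec.map class S ≡ as → chain S ≡ true → isCopy as ≡ true → isSorted G4-2 (blowup class) S ≡ true
    isSorted-intro S as e h₁ h₂ = cong₂ _∧_ {increasing S} {true} (chain-increasing S h₁) (trans (copy-blowup G4-2 class S) (trans (cong isCopy e) h₂))

  -- Part patterns of a sorted quadruple: all four parts increase, or exactly one neighbouring pair
  -- coincides. Writing `not (ltF a b)` beside `eqF a b` makes the patterns disjoint for arbitrary
  -- truth values, as the propositional check `case₁₀` requires.
  strict first second third : Vec (Fin 6) 4 → Bool
  strict (a ∷ b ∷ c ∷ d ∷ []) = ltF a b ∧ ltF b c ∧ ltF c d ∧ isCopy (a ∷ b ∷ c ∷ d ∷ [])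
  first  (a ∷ b ∷ c ∷ d ∷ []) = (not (ltF a b) ∧ eqF a b) ∧ ltF b c ∧ ltF c d ∧ isCopy (a ∷ b ∷ c ∷ d ∷ [])
  second (a ∷ b ∷ c ∷ d ∷ []) = ltF a b ∧ (not (ltF b c) ∧ eqF b c) ∧ ltF c d ∧ isCopy (a ∷ b ∷ c ∷ d ∷ [])
  third  (a ∷ b ∷ c ∷ d ∷ []) = ltF a b ∧ ltF b c ∧ (not (ltF c d) ∧ eqF c d) ∧ isCopy (a ∷ b ∷ c ∷ d ∷ [])

  contribution : Vec (Fin 6) 4 → Vec (Fin m) 4 → ℤ
  contribution as (i ∷ j ∷ k ∷ l ∷ []) =
    + bit (strict as) ℤ.+ (+ bit (first as) ℤ.* + bit (ltF i j) ℤ.+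
      (+ bit (second as) ℤ.* + bit (ltF j k) ℤ.+ + bit (third as) ℤ.* + bit (ltF k l)))

  contribution-bounded : ∀ as is → contribution as is ℤ.≤ + bit (isSorted G4-2 (blowup class) (Vec.zipWith part as is))
  contribution-bounded as@(a ∷ b ∷ c ∷ d ∷ []) is@(i ∷ j ∷ k ∷ l ∷ []) =
    ℤₚ.≤-trans (boolean (ltF a b) (eqF a b) (ltF i j) (ltF b c) (eqF b c) (ltF j k) (ltF c d) (eqF c d) (ltF k l) (isCopy as))
      (bit-mono λ h →
        let h₁ , h′ = ∧-true {before a b i j} h ; h₂ , h″ = ∧-true {before b c j k} h′ ; h₃ , h₄ = ∧-true {before c d k l} h″
        in isSorted-intro (Vec.zipWith part as is) as classes
          (cong₂ _∧_ (before-part a b i j h₁) (cong₂ _∧_ (before-part b c j k h₂) (cong₂ _∧_ (before-part c d k l h₃) refl))) h₄)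
    where
    classes : Vec.map class (Vec.zipWith part as is) ≡ as
    classes = cong₂ _∷_ (class-part a i) (cong₂ _∷_ (class-part b j) (cong₂ _∷_ (class-part c k) (cong (_∷ []) (class-part d l))))
    boolean : ∀ x₁ y₁ l₁ x₂ y₂ l₂ x₃ y₃ l₃ κ →
      + bit (x₁ ∧ x₂ ∧ x₃ ∧ κ) ℤ.+ (+ bit ((not x₁ ∧ y₁) ∧ x₂ ∧ x₃ ∧ κ) ℤ.* + bit l₁ ℤ.+
        (+ bit (x₁ ∧ (not x₂ ∧ y₂) ∧ x₃ ∧ κ) ℤ.* + bit l₂ ℤ.+ + bit (x₁ ∧ x₂ ∧ (not x₃ ∧ y₃) ∧ κ) ℤ.* + bit l₃))
      ℤ.≤ + bit ((x₁ ∨ (y₁ ∧ l₁)) ∧ (x₂ ∨ (y₂ ∧ l₂)) ∧ (x₃ ∨ (y₃ ∧ l₃)) ∧ κ)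
    boolean x₁ y₁ l₁ x₂ y₂ l₂ x₃ y₃ l₃ κ = ≤ᵇ-true _ _ (everyVec-true 10 case₁₀ case₁₀-checked (x₁ ∷ y₁ ∷ l₁ ∷ x₂ ∷ y₂ ∷ l₂ ∷ x₃ ∷ y₃ ∷ l₃ ∷ κ ∷ []))

  T₂ : ℤ
  T₂ = sum {m} λ i → sum {m} λ j → + bit (ltF i j)

  m² : ℤ
  m² = + m ℤ.* + m

  sum-scale : ∀ {k} c (f : Fin k → ℤ) → sum (λ i → c ℤ.* f i) ≡ c ℤ.* sum f
  sum-scale c f = sym (*-distribˡ-sum c f)

  opaque
    unfolding ∑ᵛ

    pairs₁ : ∑ᵛ {m} 4 (λ { (i ∷ j ∷ k ∷ l ∷ []) → + bit (ltF i j) }) ≡ m² ℤ.* T₂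
    pairs₁ = trans (sum-cong-≗ {m} λ i → trans (sum-cong-≗ {m} λ j → twice (+ bit (ltF i j))) (sum-scale {m} m² (λ j → + bit (ltF i j))))
      (sum-scale {m} m² (λ i → sum λ j → + bit (ltF i j)))
      where
      twice : ∀ x → sum {m} (λ _ → sum {m} (λ _ → x)) ≡ m² ℤ.* x
      twice x = trans (sum-const m _) (trans (cong (ℤ._*_ (+ m)) (sum-const m x)) (sym (ℤₚ.*-assoc (+ m) (+ m) x)))

    pairs₂ : ∑ᵛ {m} 4 (λ { (i ∷ j ∷ k ∷ l ∷ []) → + bit (ltF j k) }) ≡ m² ℤ.* T₂
    pairs₂ = trans (sum-const m _) (trans (cong (ℤ._*_ (+ m))
        (trans (sum-cong-≗ {m} λ j → trans (sum-cong-≗ {m} λ k → sum-const m (+ bit (ltF j k))) (sum-scale {m} (+ m) (λ k → + bit (ltF j k))))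
               (sum-scale {m} (+ m) (λ j → sum λ k → + bit (ltF j k)))))
      (sym (ℤₚ.*-assoc (+ m) (+ m) T₂)))

    pairs₃ : ∑ᵛ {m} 4 (λ { (i ∷ j ∷ k ∷ l ∷ []) → + bit (ltF k l) }) ≡ m² ℤ.* T₂
    pairs₃ = trans (sum-const m _) (trans (cong (ℤ._*_ (+ m)) (sum-const m T₂)) (sym (ℤₚ.*-assoc (+ m) (+ m) T₂)))

  contributions : ∀ as → ∑ᵛ 4 (contribution as) ≡
    + (m ℕ.^ 4) ℤ.* + bit (strict as) ℤ.+ (m² ℤ.* T₂) ℤ.* (+ bit (first as) ℤ.+ (+ bit (second as) ℤ.+ + bit (third as)))
  contributions as = trans (∑ᵛ-cong 4 λ { (i ∷ j ∷ k ∷ l ∷ []) → refl })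
    (trans (∑ᵛ-+ 4 (λ _ → + bit (strict as)) (λ v → F v ℤ.+ (S v ℤ.+ U v)))
    (trans (cong₂ ℤ._+_ (∑ᵛ-const {m} 4 (+ bit (strict as)))
        (trans (∑ᵛ-+ 4 F (λ v → S v ℤ.+ U v)) (cong₂ ℤ._+_ (scaled first pairs₁ (λ { (i ∷ j ∷ k ∷ l ∷ []) → refl }))
          (trans (∑ᵛ-+ 4 S U) (cong₂ ℤ._+_ (scaled second pairs₂ (λ { (i ∷ j ∷ k ∷ l ∷ []) → refl }))
                                            (scaled third pairs₃ (λ { (i ∷ j ∷ k ∷ l ∷ []) → refl })))))))
      (cong (ℤ._+_ (+ (m ℕ.^ 4) ℤ.* + bit (strict as))) (factor (+ bit (first as)) (+ bit (second as)) (+ bit (third as)) (m² ℤ.* T₂)))))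
    where
    F S U : Vec (Fin m) 4 → ℤ
    F (i ∷ j ∷ k ∷ l ∷ []) = + bit (first as) ℤ.* + bit (ltF i j)
    S (i ∷ j ∷ k ∷ l ∷ []) = + bit (second as) ℤ.* + bit (ltF j k)
    U (i ∷ j ∷ k ∷ l ∷ []) = + bit (third as) ℤ.* + bit (ltF k l)
    scaled : (p : Vec (Fin 6) 4 → Bool) {f g : Vec (Fin m) 4 → ℤ} → ∑ᵛ 4 f ≡ m² ℤ.* T₂ →
             (∀ v → g v ≡ + bit (p as) ℤ.* f v) → ∑ᵛ 4 g ≡ + bit (p as) ℤ.* (m² ℤ.* T₂)
    scaled p {f} e q = trans (∑ᵛ-cong 4 q) (trans (∑ᵛ-*ˡ 4 (+ bit (p as)) f) (cong (ℤ._*_ (+ bit (p as))) e))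
    factor : ∀ a b c x → a ℤ.* x ℤ.+ (b ℤ.* x ℤ.+ c ℤ.* x) ≡ x ℤ.* (a ℤ.+ (b ℤ.+ c))
    factor = solve 4 (λ a b c x → a :* x :+ (b :* x :+ c :* x) := x :* (a :+ (b :+ c))) refl

  opaque
    unfolding ∑ᵛ isCopy

    -- 15 is the number of four-point subsets: any four points of the design span exactly two edges.
    strict-count : ∑ᵛ 4 (λ as → + bit (strict as)) ≡ + 15
    strict-count = refl

    -- 30 = 10 * 3: one of the ten edges, and the point of it that is doubled; the two resulting
    -- edges share the other two points.
    repeated-count : ∑ᵛ 4 (λ as → + bit (first as) ℤ.+ (+ bit (second as) ℤ.+ + bit (third as))) ≡ + 30
    repeated-count = refl

  copies-counted : + (m ℕ.^ 4) ℤ.* + 15 ℤ.+ (m² ℤ.* T₂) ℤ.* + 30 ℤ.≤ + eH G4-2 (blowup class)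
  copies-counted = ℤₚ.≤-trans (ℤₚ.≤-reflexive (sym counted)) (ℤₚ.≤-trans
      (∑ᵛ-mono 4 λ as → ∑ᵛ-mono 4 λ is → contribution-bounded as is)
      (ℤₚ.≤-trans (∑ᵛ-parts 4 (λ v → + bit (isSorted G4-2 (blowup class) v)) (λ v → ℤ.+≤+ ℕ.z≤n))
        (ℤₚ.≤-reflexive (sym (eH-sum G4-2 (blowup class))))))
    where
    counted : ∑ᵛ 4 (λ as → ∑ᵛ 4 (contribution as)) ≡ + (m ℕ.^ 4) ℤ.* + 15 ℤ.+ (m² ℤ.* T₂) ℤ.* + 30
    counted = trans (∑ᵛ-cong 4 contributions) (trans (∑ᵛ-+ 4 _ _) (cong₂ ℤ._+_
      (trans (∑ᵛ-*ˡ 4 (+ (m ℕ.^ 4)) (λ as → + bit (strict as))) (cong (ℤ._*_ (+ (m ℕ.^ 4))) strict-count))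
      (trans (∑ᵛ-*ˡ 4 (m² ℤ.* T₂) _) (cong (ℤ._*_ (m² ℤ.* T₂)) repeated-count))))

  -- With `T₂` equal to `m (m - 1) / 2`, the count `15 m^4 + 30 m^2 T₂` is `30 m^4 - 15 m^3`; moving
  -- the cubic term to the other side avoids the subtraction.
  lower-bound : 30 ℕ.* m ℕ.^ 4 ℕ.≤ eH G4-2 (blowup class) ℕ.+ 15 ℕ.* m ℕ.^ 3
  lower-bound = ℤₚ.drop‿+≤+ (subst₂ ℤ._≤_ left right (ℤₚ.+-monoˡ-≤ (+ 15 ℤ.* + (m ℕ.^ 3)) copies-counted))
    where
    right : + eH G4-2 (blowup class) ℤ.+ + 15 ℤ.* + (m ℕ.^ 3) ≡ + (eH G4-2 (blowup class) ℕ.+ 15 ℕ.* m ℕ.^ 3)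
    right = cong (ℤ._+_ (+ eH G4-2 (blowup class))) (sym (ℤₚ.pos-* 15 (m ℕ.^ 3)))
    power₃ : + (m ℕ.^ 3) ≡ + m ℤ.* m²
    power₃ = trans (ℤₚ.pos-* m (m ℕ.* (m ℕ.* 1))) (cong (ℤ._*_ (+ m)) (trans (ℤₚ.pos-* m (m ℕ.* 1)) (cong (λ x → + m ℤ.* + x) (ℕₚ.*-identityʳ m))))
    power₄ : + (m ℕ.^ 4) ≡ m² ℤ.* m²
    power₄ = trans (ℤₚ.pos-* m (m ℕ.^ 3)) (trans (cong (ℤ._*_ (+ m)) power₃) (sym (ℤₚ.*-assoc (+ m) (+ m) m²)))
    left : (+ (m ℕ.^ 4) ℤ.* + 15 ℤ.+ (m² ℤ.* T₂) ℤ.* + 30) ℤ.+ + 15 ℤ.* + (m ℕ.^ 3) ≡ + (30 ℕ.* m ℕ.^ 4)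
    left = trans (cong₂ (λ x y → (x ℤ.* + 15 ℤ.+ (m² ℤ.* T₂) ℤ.* + 30) ℤ.+ + 15 ℤ.* y) power₄ power₃)
      (trans (collect (+ m) m² T₂) (trans (cong (λ x → + 15 ℤ.* (m² ℤ.* m²) ℤ.+ + 15 ℤ.* (m² ℤ.* x)) (triangular m))
        (trans (double m²) (trans (cong (ℤ._*_ (+ 30)) (sym power₄)) (sym (ℤₚ.pos-* 30 (m ℕ.^ 4)))))))
      where
      collect : ∀ x s t → ((s ℤ.* s) ℤ.* + 15 ℤ.+ (s ℤ.* t) ℤ.* + 30) ℤ.+ + 15 ℤ.* (x ℤ.* s) ≡ + 15 ℤ.* (s ℤ.* s) ℤ.+ + 15 ℤ.* (s ℤ.* (+ 2 ℤ.* t ℤ.+ x))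
      collect = solve 3 (λ x s t → ((s :* s) :* con (+ 15) :+ (s :* t) :* con (+ 30)) :+ con (+ 15) :* (x :* s) :=
                                   con (+ 15) :* (s :* s) :+ con (+ 15) :* (s :* (con (+ 2) :* t :+ x))) refl
      double : ∀ s → + 15 ℤ.* (s ℤ.* s) ℤ.+ + 15 ℤ.* (s ℤ.* s) ≡ + 30 ℤ.* (s ℤ.* s)
      double = solve 1 (λ s → con (+ 15) :* (s :* s) :+ con (+ 15) :* (s :* s) := con (+ 30) :* (s :* s)) refl

-- A record, so that comparing two of its instances never unfolds eH.
record Attained (k n : ℕ) : Set where
  field
    graph : ThreeGraph n
    free  : K4⁻F32-free n graph
    dense : 5 * suc k * (n C 4) ≤ 9 * suc k * eH G4-2 graph + 9 * (n C 4)

attained-intro : ∀ k n m r (G : ThreeGraph n) → K4⁻F32-free n G → 6 * m + r ≡ n → r ≤ 5 → 19 * suc k ≤ n →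
                 30 * m ^ 4 ≤ eH G4-2 G + 15 * m ^ 3 → Attained k n
attained-intro k .(6 * m + r) m r G free refl r≤5 h bound =
  record { graph = G ; free = free ; dense = density-≥ k m r (eH G4-2 G) r≤5 h bound }

-- The instance is passed explicitly: were it still unsolved, comparing the two graphs would unfold eH.
blowup-attained : ∀ k m r {{_ : ℕ.NonZero m}} → r ≤ 5 → 19 * suc k ≤ 6 * m + r → Attained k (6 * m + r)
blowup-attained k m r {{nz}} r≤5 h = attained-intro k (Blowup.n m r {{nz}}) m r (blowup (Blowup.class m r {{nz}}))
  (blowup-free (Blowup.class m r {{nz}})) refl r≤5 h (Blowup.lower-bound m r {{nz}})

attained-sixths : ∀ k n → 19 * suc k ≤ n → (∃ λ m → ∃ λ r → r ≤ 5 × 6 * suc m + r ≡ n) → Attained k n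
attained-sixths k _ h (m , r , r≤5 , refl) = blowup-attained k (suc m) r r≤5 h

attained : ∀ k n → 19 * suc k ≤ n → Attained k n
attained k n h = attained-sixths k n h (sixths n (ℕₚ.≤-trans (ℕₚ.≤-trans (ℕₚ.m≤m+n 6 13) (ℕₚ.m≤m*n 19 (suc k))) h))

theorem2p14 : DensityIs G4-2 K4⁻F32-free 5 9
theorem2p14 k = 19 * suc k , λ n h →
  (λ G free → density-≤ k n (eH G4-2 G) h (upper-bound G free)) ,
  Attained.graph (attained k n h) , Attained.free (attained k n h) , Attained.dense (attained k n h)
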